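{- Let $t\ge 2$, $q\ge 0$ and $s_1,\dots,s_t\ge 3$ be integers such that the graph $G=K_1\vee (C_{s_1}\cup C_{s_2}\cup\cdots\cup C_{s_t}\cup qK_2)$ has at least $52$ vertices. Then $G$ is determined by its signless Laplacian spectrum, i.e., every simple graph whose signless Laplacian spectrum equals that of $G$ is isomorphic to $G$.
   Context: All graphs are finite, simple and undirected. $K_n$ and $C_n$ denote the complete graph and the cycle on $n$ vertices; $\cup$ is disjoint union, $qK_2$ is the disjoint union of $q$ copies of $K_2$, and $G\vee H$ (join) is obtained from $G\cup H$ by adding all edges between a vertex of $G$ and a vertex of $H$. The signless Laplacian matrix is $Q(G)=D(G)+A(G)$, where $D(G)$ is the diagonal degree matrix and $A(G)$ the adjacency matrix; its spectrum (as a multiset) is the signless Laplacian spectrum. -}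

module Defs where

open import Data.Nat as ℕ using (ℕ; zero; suc; _+_; _%_)
open import Data.Bool using (Bool; true; false; not; _∧_; _∨_; if_then_else_)
open import Data.Fin using (Fin; zero; suc; toℕ; splitAt; punchIn)
open import Data.Fin.Properties using () renaming (_≟_ to _≟ᶠ_)
open import Data.Sum using (inj₁; inj₂)
open import Data.Vec using (Vec; []; _∷_)
open import Data.Integer as ℤ using (ℤ; +_; -_)
open import Data.Fin.Permutation using (Permutation′; _⟨$⟩ʳ_)
open import Relation.Nullary.Decidable using (⌊_⌋)
open import Relation.Binary.PropositionalEquality using (_≡_)
open import Data.Product using (∃)

Graph : ℕ → Set
Graph n = Fin n → Fin n → Bool

IsSimple : ∀ {n} → Graph n → Set
IsSimple {n} G = (∀ i j → G i j ≡ G j i) × (∀ i → G i i ≡ false)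
  where open import Data.Product using (_×_)

_≅_ : ∀ {n} → Graph n → Graph n → Set
_≅_ {n} H G = ∃ λ (π : Permutation′ n) → ∀ i j → H i j ≡ G (π ⟨$⟩ʳ i) (π ⟨$⟩ʳ j)

_⊕_ : ∀ {m n} → Graph m → Graph n → Graph (m + n)
_⊕_ {m} G H i j with splitAt m i | splitAt m j
... | inj₁ a | inj₁ b = G a b
... | inj₂ a | inj₂ b = H a b
... | _      | _      = false

_⋁_ : ∀ {m n} → Graph m → Graph n → Graph (m + n)
_⋁_ {m} G H i j with splitAt m i | splitAt m j
... | inj₁ a | inj₁ b = G a b
... | inj₂ a | inj₂ b = H a b
... | _      | _      = true

K₁ : Graph 1
K₁ _ _ = false

K₂ : Graph 2
K₂ i j = not ⌊ i ≟ᶠ j ⌋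

K₀ : Graph 0
K₀ ()

-- cycle C_s on Fin s: vertex i adjacent to i+1 mod s (a cycle when s ≥ 3)
C : ∀ s → Graph s
C zero    ()
C (suc k) i j = ⌊ (suc (toℕ i) % suc k) ℕ.≟ toℕ j ⌋ ∨ ⌊ (suc (toℕ j) % suc k) ℕ.≟ toℕ i ⌋

sumV : ∀ {t} → Vec ℕ t → ℕ
sumV []       = 0
sumV (x ∷ xs) = x + sumV xs

cycles : ∀ {t} (s : Vec ℕ t) → Graph (sumV s)
cycles []       = K₀
cycles (x ∷ xs) = C x ⊕ cycles xs

copiesK₂ : ∀ q → Graph (q ℕ.* 2)
copiesK₂ zero    = K₀
copiesK₂ (suc q) = K₂ ⊕ copiesK₂ q

theGraph : ∀ {t} (s : Vec ℕ t) (q : ℕ) → Graph (1 + (sumV s + q ℕ.* 2))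
theGraph s q = K₁ ⋁ (cycles s ⊕ copiesK₂ q)

sumFin : ∀ n → (Fin n → ℤ) → ℤ
sumFin zero    f = + 0
sumFin (suc n) f = f zero ℤ.+ sumFin n (λ i → f (suc i))

sign : ℕ → ℤ
sign zero          = + 1
sign (suc zero)    = - (+ 1)
sign (suc (suc k)) = sign k

det : ∀ n → (Fin n → Fin n → ℤ) → ℤ
det zero    M = + 1
det (suc n) M = sumFin (suc n) λ j →
  sign (toℕ j) ℤ.* M zero j ℤ.* det n (λ a b → M (suc a) (punchIn j b))

b2z : Bool → ℤ
b2z true  = + 1
b2z false = + 0

degree : ∀ {n} → Graph n → Fin n → ℤ
degree {n} G i = sumFin n (λ j → b2z (G i j))

Q : ∀ {n} → Graph n → Fin n → Fin n → ℤ
Q G i j = if ⌊ i ≟ᶠ j ⌋ then degree G i ℤ.+ b2z (G i j) else b2z (G i j)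

charQ : ∀ {n} → Graph n → ℤ → ℤ
charQ {n} G x = det n (λ i j → (if ⌊ i ≟ᶠ j ⌋ then x else + 0) ℤ.- Q G i j)

-- Q-cospectral (same signless Laplacian spectrum) for graphs of the same order:
-- equal characteristic polynomials of Q, i.e. agreeing at every integer.
QCospectral : ∀ {n} → Graph n → Graph n → Set
QCospectral H G = ∀ x → charQ H x ≡ charQ G x

{-# OPTIONS --safe #-}
module Submission where

-- Q-cospectral graphs H and G = K₁ ∨ Y on N + 1 vertices have equal traces tr Q^k for every k. For k ≤ 3 these
-- give Σd, Σd² and, up to the number of triangles, Σd³; with Σ (d - 2)(d - 3)(D - d) ≥ 0, where D is the maximal
-- degree of H, this forces D = N and all other degrees to be 2 or 3. So H is a cone K₁ ∨ X over disjoint paths and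
-- cycles. Cutting closed walks at their visits to the apex expresses tr Q^k by the numbers tr P^j and 1ᵀP^j1, where
-- P is the block of Q that belongs to X; a path with at least 3 vertices has so few walks that tr Q^10 is too small.
-- So X consists of cycles and copies of K₂, the walks through the apex cancel, and tr P^k is the same for X and Y.
-- A closed walk can go around a cycle only if its length is at least that of the cycle, so these traces determine
-- the components, shortest first.

-- No eigenvalues are available: the hypothesis is an identity between integer values of two
-- determinants. Power traces are extracted from it by congruences, an integer divisible by every
-- positive integer being 0. From then on all quantities are natural numbers that count weighted
-- walks, and the arguments are inequalities between them. Three traces suffice for the degrees
-- because degrees control triangles: a vertex of degree `d` carries at most `d(d - 1)` closed
-- 3-walks. The paths are excluded as follows. The degree sum fixes the number of vertices of degree
-- 1 in `X`. A row of `P` sums to 5, but to 3 at such an end, so the total number of walks falls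
-- short of its maximal growth in proportion to the walks that start at ends. Copies of K₂ keep
-- these at the minimum `3^j`, so `Y` has as many walks as the degrees allow. A longer path loses at
-- least 4 walks of length 3, and the weight `n` at the apex multiplies this loss at every further
-- step, while the walks that avoid the apex grow only like `5^k`.

open import Defs
open import Data.Bool using (Bool; true; false; _∨_; if_then_else_)
open import Data.Bool.Properties using (∨-comm)
open import Data.Empty using (⊥; ⊥-elim)
open import Data.Product using (∃; Σ; _,_; proj₁; proj₂; _×_)
open import Data.Sum as Sum using (_⊎_; inj₁; inj₂)
open import Data.Sum.Function.Propositional using (_⊎-↔_)
open import Data.Unit using (tt)
open import Function using (_∘_; _↔_; mk↔ₛ′; Inverse)
open import Function.Properties.Inverse using (↔-refl; ↔-sym; ↔-trans)
open import Relation.Binary.Definitions using (tri<; tri≈; tri>)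
open import Relation.Binary.PropositionalEquality
open import Relation.Nullary using (yes; no; Dec)
open import Relation.Nullary.Decidable using (⌊_⌋)

-- Determinants over the integers: rows, directional derivatives, homogeneous polynomials

module Determinants where

  open import Data.Nat as ℕ using (ℕ; zero; suc; z≤n; s≤s)
  import Data.Nat.Properties as ℕ
  open import Data.Fin using (Fin; zero; suc; toℕ; inject₁; punchIn)
  open import Data.Fin.Properties using (suc-injective)
  open import Data.Integer using (ℤ; -_; _+_; _*_; _-_; _^_; 0ℤ; 1ℤ; ∣_∣; NonZero) renaming (+_ to pos)
  open import Data.Integer.Properties
  open import Data.Integer.Tactic.RingSolver using (solve-∀)
  open import Data.Vec using (Vec; []; _∷_; _∷ʳ_; zipWith; map; replicate)
  open import Algebra.Properties.AbelianGroup +-0-abelianGroup using (∙-cancelˡ)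
  open import Algebra.Properties.Semiring.Sum +-*-semiring
    using (sum; sum-cong-≗; ∑-distrib-+; ∑-comm; *-distribˡ-sum; *-distribʳ-sum; sum-replicate-zero)

  Mat : ℕ → ℕ → Set
  Mat m n = Fin m → Fin n → ℤ

  infix 4 _≗₂_
  _≗₂_ : ∀ {m n} → Mat m n → Mat m n → Set
  M ≗₂ N = ∀ i j → M i j ≡ N i j

  minor : ∀ {m n} → Fin (suc n) → Mat (suc m) (suc n) → Mat m n
  minor j M a b = M (suc a) (punchIn j b)

  repl : ∀ {m n} → Fin m → (Fin n → ℤ) → Mat m n → Mat m n
  repl zero    v M zero    = v
  repl zero    v M (suc i) = M (suc i)
  repl (suc r) v M zero    = M zero
  repl (suc r) v M (suc i) = repl r v (M ∘ suc) i

  sumFin-sum : ∀ n (f : Fin n → ℤ) → sumFin n f ≡ sum f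
  sumFin-sum zero    f = refl
  sumFin-sum (suc n) f = cong (f zero +_) (sumFin-sum n (f ∘ suc))

  sum-zero : ∀ {n} (f : Fin n → ℤ) → (∀ i → f i ≡ 0ℤ) → sum f ≡ 0ℤ
  sum-zero {n} f f≗0 = trans (sum-cong-≗ f≗0) (sum-replicate-zero n)

  term : ∀ {n} → Mat (suc n) (suc n) → Fin (suc n) → ℤ
  term {n} M j = sign (toℕ j) * M zero j * det n (minor j M)

  det-expand : ∀ {n} (M : Mat (suc n) (suc n)) → det (suc n) M ≡ sum (term M)
  det-expand {n} M = sumFin-sum (suc n) (term M)

  det-cong : ∀ {n} {M N : Mat n n} → M ≗₂ N → det n M ≡ det n N
  det-cong {zero}          M≗N = refl
  det-cong {suc n} {M} {N} M≗N = trans (det-expand M) (trans (sum-cong-≗ eq) (sym (det-expand N)))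
    where
    eq : ∀ j → term M j ≡ term N j
    eq j = cong₂ (λ x y → sign (toℕ j) * x * y) (M≗N zero j) (det-cong (λ a b → M≗N (suc a) (punchIn j b)))

  repl-∘ : ∀ {m n k} (r : Fin m) (v : Fin n → ℤ) (M : Mat m n) (f : Fin k → Fin n) →
           (λ a b → repl r v M a (f b)) ≗₂ repl r (v ∘ f) (λ a b → M a (f b))
  repl-∘ zero    v M f zero    b = refl
  repl-∘ zero    v M f (suc a) b = refl
  repl-∘ (suc r) v M f zero    b = refl
  repl-∘ (suc r) v M f (suc a) b = repl-∘ r v (M ∘ suc) f a b

  repl-cong : ∀ {m n} (r : Fin m) {u v : Fin n → ℤ} {M N : Mat m n} →
              (∀ j → u j ≡ v j) → M ≗₂ N → repl r u M ≗₂ repl r v N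
  repl-cong zero    u≗v M≗N zero    j = u≗v j
  repl-cong zero    u≗v M≗N (suc i) j = M≗N (suc i) j
  repl-cong (suc r) u≗v M≗N zero    j = M≗N zero j
  repl-cong (suc r) u≗v M≗N (suc i) j = repl-cong r u≗v (M≗N ∘ suc) i j

  repl-same : ∀ {m n} (r : Fin m) (M : Mat m n) → repl r (M r) M ≗₂ M
  repl-same zero    M zero    j = refl
  repl-same zero    M (suc i) j = refl
  repl-same (suc r) M zero    j = refl
  repl-same (suc r) M (suc i) j = repl-same r (M ∘ suc) i j

  repl-at : ∀ {m n} (r : Fin m) (v : Fin n → ℤ) (M : Mat m n) j → repl r v M r j ≡ v j
  repl-at zero    v M j = refl
  repl-at (suc r) v M j = repl-at r v (M ∘ suc) j

  repl-off : ∀ {m n} (r s : Fin m) (v : Fin n → ℤ) (M : Mat m n) j → r ≢ s → repl r v M s j ≡ M s j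
  repl-off zero    zero    v M j r≢s = ⊥-elim (r≢s refl)
  repl-off zero    (suc s) v M j r≢s = refl
  repl-off (suc r) zero    v M j r≢s = refl
  repl-off (suc r) (suc s) v M j r≢s = repl-off r s v (M ∘ suc) j (r≢s ∘ cong suc)

  repl-comm : ∀ {m n} (r s : Fin m) (u v : Fin n → ℤ) (M : Mat m n) → r ≢ s →
              repl r u (repl s v M) ≗₂ repl s v (repl r u M)
  repl-comm zero    zero    u v M r≢s i       j = ⊥-elim (r≢s refl)
  repl-comm zero    (suc s) u v M r≢s zero    j = refl
  repl-comm zero    (suc s) u v M r≢s (suc i) j = refl
  repl-comm (suc r) zero    u v M r≢s zero    j = refl
  repl-comm (suc r) zero    u v M r≢s (suc i) j = refl
  repl-comm (suc r) (suc s) u v M r≢s zero    j = refl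
  repl-comm (suc r) (suc s) u v M r≢s (suc i) j = repl-comm r s u v (M ∘ suc) (r≢s ∘ cong suc) i j

  det-repl-linear : ∀ {n} (r : Fin n) (u v : Fin n → ℤ) (c : ℤ) (M : Mat n n) →
    det n (repl r (λ j → u j + c * v j) M) ≡ det n (repl r u M) + c * det n (repl r v M)
  det-repl-linear {suc n} r u v c M = begin
    det (suc n) (repl r w M)                              ≡⟨ det-expand (repl r w M) ⟩
    sum (term (repl r w M))                               ≡⟨ sum-cong-≗ (split r) ⟩
    sum (λ j → term (repl r u M) j + c * term (repl r v M) j)
      ≡⟨ ∑-distrib-+ (term (repl r u M)) (λ j → c * term (repl r v M) j) ⟩
    sum (term (repl r u M)) + sum (λ j → c * term (repl r v M) j)
      ≡⟨ cong₂ _+_ (sym (det-expand (repl r u M)))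
           (trans (sym (*-distribˡ-sum c (term (repl r v M)))) (cong (c *_) (sym (det-expand (repl r v M))))) ⟩
    det (suc n) (repl r u M) + c * det (suc n) (repl r v M) ∎
    where
    open ≡-Reasoning
    w : Fin (suc n) → ℤ
    w j = u j + c * v j
    alg₀ : ∀ s x y k d → s * (x + k * y) * d ≡ s * x * d + k * (s * y * d)
    alg₀ = solve-∀
    alg₁ : ∀ s x k d e → s * x * (d + k * e) ≡ s * x * d + k * (s * x * e)
    alg₁ = solve-∀
    split : ∀ r j → term (repl r w M) j ≡ term (repl r u M) j + c * term (repl r v M) j
    split zero    j = alg₀ (sign (toℕ j)) (u j) (v j) c (det n (minor j M))
    split (suc r) j = trans (cong (sign (toℕ j) * M zero j *_) minors)
                            (alg₁ (sign (toℕ j)) (M zero j) c _ _)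
      where
      minors : det n (minor j (repl (suc r) w M)) ≡
               det n (minor j (repl (suc r) u M)) + c * det n (minor j (repl (suc r) v M))
      minors = begin
        det n (minor j (repl (suc r) w M)) ≡⟨ det-cong (repl-∘ r w (M ∘ suc) (punchIn j)) ⟩
        det n (repl r (w ∘ punchIn j) (minor j M))
          ≡⟨ det-repl-linear r (u ∘ punchIn j) (v ∘ punchIn j) c (minor j M) ⟩
        det n (repl r (u ∘ punchIn j) (minor j M)) + c * det n (repl r (v ∘ punchIn j) (minor j M))
          ≡⟨ cong₂ (λ x y → x + c * y) (det-cong (repl-∘ r u (M ∘ suc) (punchIn j)))
                                       (det-cong (repl-∘ r v (M ∘ suc) (punchIn j))) ⟨
        det n (minor j (repl (suc r) u M)) + c * det n (minor j (repl (suc r) v M)) ∎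

  det-repl-zero : ∀ {n} (r : Fin n) (M : Mat n n) → det n (repl r (λ _ → 0ℤ) M) ≡ 0ℤ
  det-repl-zero {n} r M = begin
    -- The zero row computes to `0 + (-1) · 0`, so linearity applies with both vectors zero.
    Z ≡⟨ det-repl-linear r (λ _ → 0ℤ) (λ _ → 0ℤ) (- 1ℤ) M ⟩
    Z + - 1ℤ * Z                  ≡⟨ alg Z ⟩
    0ℤ ∎
    where
    open ≡-Reasoning
    Z = det n (repl r (λ _ → 0ℤ) M)
    alg : ∀ z → z + - 1ℤ * z ≡ 0ℤ
    alg = solve-∀

  det-repl-sum : ∀ {n m} (r : Fin n) (c : Fin m → ℤ) (V : Mat m n) (M : Mat n n) →
    det n (repl r (λ j → sum (λ k → c k * V k j)) M) ≡ sum (λ k → c k * det n (repl r (V k) M))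
  det-repl-sum {n} {zero}  r c V M = det-repl-zero r M
  det-repl-sum {n} {suc m} r c V M = begin
    det n (repl r (λ j → c zero * V zero j + rest j) M)
      ≡⟨ det-cong (repl-cong r (λ j → +-comm (c zero * V zero j) (rest j)) (λ _ _ → refl)) ⟩
    det n (repl r (λ j → rest j + c zero * V zero j) M)
      ≡⟨ det-repl-linear r rest (V zero) (c zero) M ⟩
    det n (repl r rest M) + c zero * det n (repl r (V zero) M)
      ≡⟨ +-comm (det n (repl r rest M)) _ ⟩
    c zero * det n (repl r (V zero) M) + det n (repl r rest M)
      ≡⟨ cong (c zero * det n (repl r (V zero) M) +_) (det-repl-sum r (c ∘ suc) (V ∘ suc) M) ⟩
    sum (λ k → c k * det n (repl r (V k) M)) ∎
    where
    open ≡-Reasoning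
    rest : Fin n → ℤ
    rest j = sum (λ k → c (suc k) * V (suc k) j)

  sign-suc : ∀ k → sign (suc k) ≡ - sign k
  sign-suc zero          = refl
  sign-suc (suc zero)    = refl
  sign-suc (suc (suc k)) = sign-suc k

  -- The two terms for an unordered pair of columns, removed in either order, carry opposite signs.
  sum-pairs : ∀ {n} (G : Fin (suc n) → Fin n → ℤ) →
    (∀ i l → toℕ i ℕ.≤ toℕ l → G (inject₁ i) l ≡ G (suc l) i) →
    sum (λ j → sum (λ l → sign (toℕ j) * sign (toℕ l) * G j l)) ≡ 0ℤ
  sum-pairs {zero}  G G-sym = refl
  sum-pairs {suc n} G G-sym = begin
    sum (λ l → 1ℤ * sgn l * G zero l) + sum (λ j → sgn (suc j) * 1ℤ * G (suc j) zero + inner j)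
      ≡⟨ cong (sum (λ l → 1ℤ * sgn l * G zero l) +_) (∑-distrib-+ (λ j → sgn (suc j) * 1ℤ * G (suc j) zero) inner) ⟩
    sum (λ l → 1ℤ * sgn l * G zero l) + (sum (λ j → sgn (suc j) * 1ℤ * G (suc j) zero) + sum inner)
      ≡⟨ +-assoc (sum (λ l → 1ℤ * sgn l * G zero l)) _ _ ⟨
    sum (λ l → 1ℤ * sgn l * G zero l) + sum (λ j → sgn (suc j) * 1ℤ * G (suc j) zero) + sum inner
      ≡⟨ cong (_+ sum inner) (∑-distrib-+ (λ l → 1ℤ * sgn l * G zero l) (λ j → sgn (suc j) * 1ℤ * G (suc j) zero)) ⟨
    sum (λ l → 1ℤ * sgn l * G zero l + sgn (suc l) * 1ℤ * G (suc l) zero) + sum inner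
      ≡⟨ cong₂ _+_ (sum-zero _ cancel) (trans (sum-cong-≗ (λ j → sum-cong-≗ (λ l → strip j l)))
          (sum-pairs (λ j l → G (suc j) (suc l)) (λ i l i≤l → G-sym (suc i) (suc l) (s≤s i≤l)))) ⟩
    0ℤ ∎
    where
    open ≡-Reasoning
    sgn : ∀ {m} → Fin m → ℤ
    sgn i = sign (toℕ i)
    inner : Fin (suc n) → ℤ
    inner j = sum (λ l → sgn (suc j) * sgn (suc l) * G (suc j) (suc l))
    alg₀ : ∀ s g → 1ℤ * s * g + - s * 1ℤ * g ≡ 0ℤ
    alg₀ = solve-∀
    alg₁ : ∀ s t g → - s * - t * g ≡ s * t * g
    alg₁ = solve-∀
    cancel : ∀ l → 1ℤ * sgn l * G zero l + sgn (suc l) * 1ℤ * G (suc l) zero ≡ 0ℤ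
    cancel l = trans (cong₂ (λ x y → 1ℤ * sgn l * x + y * 1ℤ * G (suc l) zero) (G-sym zero l z≤n) (sign-suc (toℕ l)))
                     (alg₀ (sgn l) (G (suc l) zero))
    strip : ∀ (j : Fin (suc n)) (l : Fin n) →
      sgn (suc j) * sgn (suc l) * G (suc j) (suc l) ≡ sgn j * sgn l * G (suc j) (suc l)
    strip j l = trans (cong₂ (λ x y → x * y * G (suc j) (suc l)) (sign-suc (toℕ j)) (sign-suc (toℕ l)))
                      (alg₁ (sgn j) (sgn l) (G (suc j) (suc l)))

  -- For `i ≤ l` the pair of columns is `inject₁ i` and `suc l`. Once one of them is removed, the
  -- other is called `l` or `i`, whence the indices in `sum-pairs`.
  punchIn-inject₁ : ∀ {n} (i l : Fin n) → toℕ i ℕ.≤ toℕ l → punchIn (inject₁ i) l ≡ suc l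
  punchIn-inject₁ zero    l       _         = refl
  punchIn-inject₁ (suc i) (suc l) (s≤s i≤l) = cong suc (punchIn-inject₁ i l i≤l)

  punchIn-suc : ∀ {n} (i l : Fin n) → toℕ i ℕ.≤ toℕ l → punchIn (suc l) i ≡ inject₁ i
  punchIn-suc zero    l       _         = refl
  punchIn-suc (suc i) (suc l) (s≤s i≤l) = cong suc (punchIn-suc i l i≤l)

  punchIn-swap : ∀ {n} (i l : Fin (suc n)) (b : Fin n) → toℕ i ℕ.≤ toℕ l →
    punchIn (inject₁ i) (punchIn l b) ≡ punchIn (suc l) (punchIn i b)
  punchIn-swap zero    l       b       _         = refl
  punchIn-swap (suc i) (suc l) zero    _         = refl
  punchIn-swap (suc i) (suc l) (suc b) (s≤s i≤l) = cong suc (punchIn-swap i l b i≤l)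

  -- Expanding along the first two rows gives a sum over ordered pairs of columns. When the rows
  -- agree, the product of the two entries and the remaining minor are independent of the order, so
  -- `sum-pairs` applies.
  det-rows₀₁ : ∀ {n} (M : Mat (suc (suc n)) (suc (suc n))) → (∀ j → M zero j ≡ M (suc zero) j) →
               det (suc (suc n)) M ≡ 0ℤ
  det-rows₀₁ {n} M eq = begin
    det (suc (suc n)) M ≡⟨ det-expand M ⟩
    sum (term M)        ≡⟨ sum-cong-≗ expand₂ ⟩
    sum (λ j → sum (λ l → sign (toℕ j) * sign (toℕ l) * G j l)) ≡⟨ sum-pairs G G-sym ⟩
    0ℤ ∎
    where
    open ≡-Reasoning
    G : Fin (suc (suc n)) → Fin (suc n) → ℤ
    G j l = M zero j * M zero (punchIn j l) * det n (minor l (minor j M))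
    G-sym : ∀ i l → toℕ i ℕ.≤ toℕ l → G (inject₁ i) l ≡ G (suc l) i
    G-sym i l i≤l = cong₂ _*_
      (trans (cong (λ x → M zero (inject₁ i) * M zero x) (punchIn-inject₁ i l i≤l))
        (trans (*-comm (M zero (inject₁ i)) (M zero (suc l)))
          (cong (λ x → M zero (suc l) * M zero x) (sym (punchIn-suc i l i≤l)))))
      (det-cong (λ a b → cong (M (suc (suc a))) (punchIn-swap i l b i≤l)))
    alg : ∀ s t x y d → s * x * (t * y * d) ≡ s * t * (x * y * d)
    alg = solve-∀
    expand₂ : ∀ j → term M j ≡ sum (λ l → sign (toℕ j) * sign (toℕ l) * G j l)
    expand₂ j = trans (cong (sign (toℕ j) * M zero j *_) (det-expand (minor j M)))
      (trans (*-distribˡ-sum (sign (toℕ j) * M zero j) (term (minor j M)))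
        (sum-cong-≗ λ l → trans
          (cong (λ x → sign (toℕ j) * M zero j * (sign (toℕ l) * x * det n (minor l (minor j M)))) (sym (eq (punchIn j l))))
          (alg (sign (toℕ j)) (sign (toℕ l)) (M zero j) (M zero (punchIn j l)) _)))

  -- Polarisation: `F` vanishes on the diagonal, so `F (u + v) (u + v) = 0` leaves
  -- `F u v + F v u = 0`. Vanishing is assumed for the rows `r` and `s` only, because `alternating₀`
  -- needs the swap before all pairs are settled.
  det-swap : ∀ {n} (r s : Fin n) → r ≢ s → (∀ (M : Mat n n) → (∀ j → M r j ≡ M s j) → det n M ≡ 0ℤ) →
    (u v : Fin n → ℤ) (M : Mat n n) → det n (repl r u (repl s v M)) ≡ - det n (repl r v (repl s u M))
  det-swap {n} r s r≢s alt u v M = begin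
    F u v                                  ≡⟨ alg (F u u) (F u v) (F v u) (F v v) ⟩
    F u u + F u v + (F v u + F v v) + - F u u + - F v v + - F v u
      ≡⟨ cong (λ x → x + - F u u + - F v v + - F v u) whole ⟩
    0ℤ + - F u u + - F v v + - F v u
      ≡⟨ cong₂ (λ x y → 0ℤ + - x + - y + - F v u) (diag u) (diag v) ⟩
    0ℤ + - F v u                           ≡⟨ +-identityˡ _ ⟩
    - F v u ∎
    where
    open ≡-Reasoning
    F : (Fin n → ℤ) → (Fin n → ℤ) → ℤ
    F x y = det n (repl r x (repl s y M))
    w : Fin n → ℤ
    w j = u j + 1ℤ * v j
    alg : ∀ a b c d → b ≡ a + b + (c + d) + - a + - d + - c
    alg = solve-∀
    diag : ∀ x → F x x ≡ 0ℤ
    diag x = alt _ (λ j → trans (repl-at r x (repl s x M) j)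
      (sym (trans (repl-off r s x (repl s x M) j r≢s) (repl-at s x M j))))
    lin : ∀ x → F x w ≡ F x u + F x v
    lin x = begin
      F x w ≡⟨ det-cong (repl-comm r s x w M r≢s) ⟩
      det n (repl s w (repl r x M)) ≡⟨ det-repl-linear s u v 1ℤ (repl r x M) ⟩
      det n (repl s u (repl r x M)) + 1ℤ * det n (repl s v (repl r x M))
        ≡⟨ cong₂ _+_ (det-cong (repl-comm r s x u M r≢s))
             (trans (sym (*-identityˡ _)) (cong (1ℤ *_) (det-cong (repl-comm r s x v M r≢s)))) ⟨
      F x u + F x v ∎
    whole : F u u + F u v + (F v u + F v v) ≡ 0ℤ
    whole = begin
      F u u + F u v + (F v u + F v v) ≡⟨ cong₂ _+_ (lin u) (lin v) ⟨
      F u w + F v w                   ≡⟨ cong (F u w +_) (*-identityˡ _) ⟨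
      F u w + 1ℤ * F v w              ≡⟨ det-repl-linear r u v 1ℤ (repl s w M) ⟨
      F w w                           ≡⟨ diag w ⟩
      0ℤ ∎

  det-alternating : ∀ {n} (M : Mat n n) (r s : Fin n) → r ≢ s → (∀ j → M r j ≡ M s j) → det n M ≡ 0ℤ
  alternating₊ : ∀ {n} (M : Mat (suc n) (suc n)) (r s : Fin n) → r ≢ s →
                 (∀ j → M (suc r) j ≡ M (suc s) j) → det (suc n) M ≡ 0ℤ
  alternating₀ : ∀ {n} (M : Mat (suc n) (suc n)) (s : Fin n) → (∀ j → M zero j ≡ M (suc s) j) → det (suc n) M ≡ 0ℤ

  alternating₊ {n} M r s r≢s eq = trans (det-expand M) (sum-zero (term M) λ j →
    trans (cong (sign (toℕ j) * M zero j *_) (det-alternating (minor j M) r s r≢s (λ b → eq (punchIn j b))))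
          (*-zeroʳ (sign (toℕ j) * M zero j)))

  alternating₀ {suc n} M zero    eq = det-rows₀₁ M eq
  -- Both exchanged rows lie below row 0, where `alternating₊` reduces to smaller matrices. After
  -- the exchange the equal rows are 0 and 1.
  alternating₀ {suc n} M (suc s) eq = begin
    det _ M                              ≡⟨ det-cong (repl-same (suc zero) M) ⟨
    det _ (repl (suc zero) x M)          ≡⟨ det-cong (repl-cong (suc zero) {x} {x} (λ _ → refl) (repl-same (suc (suc s)) M)) ⟨
    det _ (repl (suc zero) x (repl (suc (suc s)) y M))
      ≡⟨ det-swap (suc zero) (suc (suc s)) (λ ()) (λ M′ → alternating₊ M′ zero (suc s) (λ ())) x y M ⟩
    - det _ (repl (suc zero) y (repl (suc (suc s)) x M))
      ≡⟨ cong -_ (det-rows₀₁ (repl (suc zero) y (repl (suc (suc s)) x M)) eq) ⟩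
    0ℤ ∎
    where
    open ≡-Reasoning
    x = M (suc zero)
    y = M (suc (suc s))

  det-alternating M zero    zero    r≢s eq = ⊥-elim (r≢s refl)
  det-alternating M zero    (suc s) r≢s eq = alternating₀ M s eq
  det-alternating M (suc r) zero    r≢s eq = alternating₀ M r (λ j → sym (eq j))
  det-alternating M (suc r) (suc s) r≢s eq = alternating₊ M r s (r≢s ∘ cong suc) eq

  sum-single : ∀ {n} (r : Fin n) (f : Fin n → ℤ) → (∀ k → k ≢ r → f k ≡ 0ℤ) → sum f ≡ f r
  sum-single zero    f off = trans (cong (λ z → f zero + z) (sum-zero (f ∘ suc) (λ k → off (suc k) λ ()))) (+-identityʳ (f zero))
  sum-single (suc r) f off = trans (cong₂ _+_ (off zero λ ()) (sum-single r (f ∘ suc) (λ k k≢r → off (suc k) (k≢r ∘ suc-injective))))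
                                   (+-identityˡ (f (suc r)))

  -- The derivative of `det` at `M` in the direction `E`, written by multilinearity as a sum over
  -- the rows.
  deriv : ∀ {n} → Mat n n → Mat n n → ℤ
  deriv {n} M E = sum (λ r → det n (repl r (E r) M))

  deriv-expand : ∀ {n} (M E : Mat (suc n) (suc n)) → deriv M E ≡
    sum (λ j → sign (toℕ j) * (E zero j * det n (minor j M) + M zero j * deriv (minor j M) (minor j E)))
  deriv-expand {n} M E = begin
    det (suc n) (repl zero (E zero) M) + sum (λ r → det (suc n) (repl (suc r) (E (suc r)) M))
      ≡⟨ cong₂ _+_ (det-expand (repl zero (E zero) M)) (trans (sum-cong-≗ λ r → trans (det-expand (repl (suc r) (E (suc r)) M)) (sum-cong-≗ (below r)))
           (∑-comm (λ r j → S j * M zero j * det n (repl r (minor j E r) (minor j M))))) ⟩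
    sum (λ j → S j * E zero j * det n (minor j M)) +
    sum (λ j → sum (λ r → S j * M zero j * det n (repl r (minor j E r) (minor j M))))
      ≡⟨ ∑-distrib-+ (λ j → S j * E zero j * det n (minor j M)) (λ j → sum (λ r → S j * M zero j * det n (repl r (minor j E r) (minor j M)))) ⟨
    sum (λ j → S j * E zero j * det n (minor j M) + sum (λ r → S j * M zero j * det n (repl r (minor j E r) (minor j M))))
      ≡⟨ sum-cong-≗ (λ j → trans
           (cong (S j * E zero j * det n (minor j M) +_) (sym (*-distribˡ-sum (S j * M zero j) (λ r → det n (repl r (minor j E r) (minor j M))))))
           (alg (S j) (E zero j) (det n (minor j M)) (M zero j) (deriv (minor j M) (minor j E)))) ⟩
    sum (λ j → S j * (E zero j * det n (minor j M) + M zero j * deriv (minor j M) (minor j E))) ∎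
    where
    open ≡-Reasoning
    S : Fin (suc n) → ℤ
    S j = sign (toℕ j)
    below : ∀ r j → term (repl (suc r) (E (suc r)) M) j ≡ S j * M zero j * det n (repl r (minor j E r) (minor j M))
    below r j = cong (S j * M zero j *_) (det-cong (repl-∘ r (E (suc r)) (M ∘ suc) (punchIn j)))
    alg : ∀ s e d m x → s * e * d + s * m * x ≡ s * (e * d + m * x)
    alg = solve-∀

  -- Stands in for differentiation: all that matters about the remainder is that it is `h * h` times
  -- an integer, so after one `h` is cancelled it is still a multiple of `h`.
  det-perturb : ∀ {n} (M E : Mat n n) (h : ℤ) →
    ∃ λ R → det n (λ i j → M i j + h * E i j) ≡ det n M + h * deriv M E + h * h * R
  det-perturb {zero}  M E h = 0ℤ , alg h
    where
    alg : ∀ h → 1ℤ ≡ 1ℤ + h * 0ℤ + h * h * 0ℤ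
    alg = solve-∀
  det-perturb {suc n} M E h = sum R , (begin
    det (suc n) M+hE ≡⟨ det-expand M+hE ⟩
    sum (term M+hE)  ≡⟨ sum-cong-≗ split ⟩
    sum (λ j → term M j + h * T j + h * h * R j) ≡⟨ ∑-distrib-+ (λ j → term M j + h * T j) (λ j → h * h * R j) ⟩
    sum (λ j → term M j + h * T j) + sum (λ j → h * h * R j)
      ≡⟨ cong₂ _+_ (trans (∑-distrib-+ (term M) (λ j → h * T j))
          (cong₂ _+_ (sym (det-expand M)) (trans (sym (*-distribˡ-sum h T)) (cong (h *_) (sym (deriv-expand M E))))))
          (sym (*-distribˡ-sum (h * h) R)) ⟩
    det (suc n) M + h * deriv M E + h * h * sum R ∎)
    where
    open ≡-Reasoning
    M+hE : Mat (suc n) (suc n)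
    M+hE i j = M i j + h * E i j
    IH : ∀ j → ∃ λ R → det n (minor j M+hE) ≡ det n (minor j M) + h * deriv (minor j M) (minor j E) + h * h * R
    IH j = det-perturb (minor j M) (minor j E) h
    S T R : Fin (suc n) → ℤ
    S j = sign (toℕ j)
    T j = S j * (E zero j * det n (minor j M) + M zero j * deriv (minor j M) (minor j E))
    R j = S j * (M zero j * proj₁ (IH j) + E zero j * (deriv (minor j M) (minor j E) + h * proj₁ (IH j)))
    alg : ∀ s m e h d x r → s * (m + h * e) * (d + h * x + h * h * r) ≡
          s * m * d + h * (s * (e * d + m * x)) + h * h * (s * (m * r + e * (x + h * r)))
    alg = solve-∀
    split : ∀ j → term M+hE j ≡ term M j + h * T j + h * h * R j
    split j = trans (cong (S j * (M zero j + h * E zero j) *_) (proj₂ (IH j)))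
                    (alg (S j) (M zero j) (E zero j) h _ _ _)

  tr : ∀ {n} → Mat n n → ℤ
  tr M = sum (λ i → M i i)

  _·_ : ∀ {l m n} → Mat l m → Mat m n → Mat l n
  (X · Y) i j = sum (λ k → X i k * Y k j)

  -- Row `r` of `X · M` is a combination of the rows of `M`. Put in place of row `r`, each row other
  -- than the `r`-th occurs twice and contributes 0, so only the coefficient `X r r` survives.
  jacobi : ∀ {n} (M X : Mat n n) → deriv M (X · M) ≡ tr X * det n M
  jacobi {n} M X = trans (sum-cong-≗ row) (sym (*-distribʳ-sum (det n M) (λ r → X r r)))
    where
    row : ∀ r → det n (repl r ((X · M) r) M) ≡ X r r * det n M
    row r = trans (det-repl-sum r (X r) M M)
      (trans (sum-single r (λ k → X r k * det n (repl r (M k) M)) off)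
             (cong (X r r *_) (det-cong (repl-same r M))))
      where
      off : ∀ k → k ≢ r → X r k * det n (repl r (M k) M) ≡ 0ℤ
      off k k≢r = trans (cong (X r k *_) (det-alternating (repl r (M k) M) r k (k≢r ∘ sym)
        λ j → trans (repl-at r (M k) M j) (sym (repl-off r k (M k) M j (k≢r ∘ sym))))) (*-zeroʳ (X r k))

  deriv-linear : ∀ {n} (M E F : Mat n n) c → deriv M (λ i j → E i j + c * F i j) ≡ deriv M E + c * deriv M F
  deriv-linear {n} M E F c = trans (sum-cong-≗ (λ r → det-repl-linear r (E r) (F r) c M))
    (trans (∑-distrib-+ (λ r → det n (repl r (E r) M)) (λ r → c * det n (repl r (F r) M)))
           (cong (deriv M E +_) (sym (*-distribˡ-sum c (λ r → det n (repl r (F r) M))))))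

  deriv-cong : ∀ {n} (M : Mat n n) {E F : Mat n n} → E ≗₂ F → deriv M E ≡ deriv M F
  deriv-cong M E≗F = sum-cong-≗ (λ r → det-cong (repl-cong r (E≗F r) (λ _ _ → refl)))

  δ : ∀ {n} → Mat n n
  δ zero    zero    = 1ℤ
  δ zero    (suc j) = 0ℤ
  δ (suc i) zero    = 0ℤ
  δ (suc i) (suc j) = δ i j

  det-δ : ∀ n → det n δ ≡ 1ℤ
  det-δ zero    = refl
  det-δ (suc n) = trans (det-expand {n} δ) (trans (sum-single zero (term δ) off)
    (trans (*-identityˡ (det n δ)) (det-δ n)))
    where
    off : ∀ k → k ≢ zero → term δ k ≡ 0ℤ
    off zero    k≢0 = ⊥-elim (k≢0 refl)
    off (suc k) _   = trans (cong (_* det n (minor (suc k) δ)) (*-zeroʳ (sign (suc (toℕ k))))) (*-zeroˡ (det n (minor (suc k) δ)))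

  δ-off : ∀ {n} (i j : Fin n) → i ≢ j → δ i j ≡ 0ℤ
  δ-off zero    zero    i≢j = ⊥-elim (i≢j refl)
  δ-off zero    (suc j) i≢j = refl
  δ-off (suc i) zero    i≢j = refl
  δ-off (suc i) (suc j) i≢j = δ-off i j (i≢j ∘ cong suc)

  δ-diag : ∀ {n} (i : Fin n) → δ i i ≡ 1ℤ
  δ-diag zero    = refl
  δ-diag (suc i) = δ-diag i

  ·-identityʳ : ∀ {m n} (X : Mat m n) → X · δ ≗₂ X
  ·-identityʳ X i j = trans (sum-single j (λ k → X i k * δ k j) (λ k k≢j → trans (cong (X i k *_) (δ-off k j k≢j)) (*-zeroʳ (X i k))))
                            (trans (cong (X i j *_) (δ-diag j)) (*-identityʳ (X i j)))

  pow : ∀ {n} → Mat n n → ℕ → Mat n n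
  pow M zero    = δ
  pow M (suc k) = pow M k · M

  -- Homogeneous polynomials in two variables; they allow x ↦ det (xI - Q), known at integers only,
  -- to be evaluated at the reciprocal of an integer.
  hev : ∀ {n} → Vec ℤ (suc n) → ℤ → ℤ → ℤ
  hev {zero}  (c ∷ [])     a b = c
  hev {suc n} (c ∷ d ∷ cs) a b = c * b ^ suc n + a * hev (d ∷ cs) a b

  Homogeneous : ℕ → (ℤ → ℤ → ℤ) → Set
  Homogeneous n f = ∃ λ (cs : Vec ℤ (suc n)) → ∀ a b → f a b ≡ hev cs a b

  hev-+ : ∀ {n} (cs ds : Vec ℤ (suc n)) a b → hev (zipWith _+_ cs ds) a b ≡ hev cs a b + hev ds a b
  hev-+ {zero}  (c ∷ [])      (d ∷ [])      a b = refl
  hev-+ {suc n} (c ∷ c′ ∷ cs) (d ∷ d′ ∷ ds) a b =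
    trans (cong (λ z → (c + d) * b ^ suc n + a * z) (hev-+ (c′ ∷ cs) (d′ ∷ ds) a b)) (alg c d (b ^ suc n) a _ _)
    where
    alg : ∀ c d p a x y → (c + d) * p + a * (x + y) ≡ c * p + a * x + (d * p + a * y)
    alg = solve-∀

  hev-* : ∀ {n} k (cs : Vec ℤ (suc n)) a b → hev (map (k *_) cs) a b ≡ k * hev cs a b
  hev-* {zero}  k (c ∷ [])      a b = refl
  hev-* {suc n} k (c ∷ c′ ∷ cs) a b =
    trans (cong (λ z → k * c * b ^ suc n + a * z) (hev-* k (c′ ∷ cs) a b)) (alg k c (b ^ suc n) a _)
    where
    alg : ∀ k c p a x → k * c * p + a * (k * x) ≡ k * (c * p + a * x)
    alg = solve-∀

  hev-∷ʳ : ∀ {n} (cs : Vec ℤ (suc n)) a b → hev (cs ∷ʳ 0ℤ) a b ≡ b * hev cs a b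
  hev-∷ʳ {zero}  (c ∷ [])      a b = alg a b c
    where
    alg : ∀ a b c → c * (b * 1ℤ) + a * 0ℤ ≡ b * c
    alg = solve-∀
  hev-∷ʳ {suc n} (c ∷ c′ ∷ cs) a b =
    trans (cong (λ z → c * b ^ suc (suc n) + a * z) (hev-∷ʳ (c′ ∷ cs) a b)) (alg c (b ^ suc n) a b _)
    where
    alg : ∀ c p a b x → c * (b * p) + a * (b * x) ≡ b * (c * p + a * x)
    alg = solve-∀

  homogeneous-+ : ∀ {n f g} → Homogeneous n f → Homogeneous n g → Homogeneous n (λ a b → f a b + g a b)
  homogeneous-+ (cs , f≡) (ds , g≡) = zipWith _+_ cs ds , λ a b → trans (cong₂ _+_ (f≡ a b) (g≡ a b)) (sym (hev-+ cs ds a b))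

  homogeneous-* : ∀ {n f} k → Homogeneous n f → Homogeneous n (λ a b → k * f a b)
  homogeneous-* k (cs , f≡) = map (k *_) cs , λ a b → trans (cong (k *_) (f≡ a b)) (sym (hev-* k cs a b))

  homogeneous-a* : ∀ {n f} → Homogeneous n f → Homogeneous (suc n) (λ a b → a * f a b)
  homogeneous-a* {n} {f} (c ∷ cs , f≡) = 0ℤ ∷ c ∷ cs , λ a b →
    trans (cong (a *_) (f≡ a b)) (sym (trans (cong (_+ a * hev (c ∷ cs) a b) (*-zeroˡ (b ^ suc n))) (+-identityˡ (a * hev (c ∷ cs) a b))))

  homogeneous-b* : ∀ {n f} → Homogeneous n f → Homogeneous (suc n) (λ a b → b * f a b)
  homogeneous-b* (cs , f≡) = cs ∷ʳ 0ℤ , λ a b → trans (cong (b *_) (f≡ a b)) (sym (hev-∷ʳ cs a b))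

  homogeneous-cong : ∀ {n f g} → (∀ a b → f a b ≡ g a b) → Homogeneous n f → Homogeneous n g
  homogeneous-cong f≗g (cs , f≡) = cs , λ a b → trans (sym (f≗g a b)) (f≡ a b)

  homogeneous-sum : ∀ {n m} (f : Fin m → ℤ → ℤ → ℤ) → (∀ j → Homogeneous n (f j)) →
                    Homogeneous n (λ a b → sum (λ j → f j a b))
  homogeneous-sum {n} {zero}  f hf = replicate (suc n) 0ℤ , zeros n
    where
    zeros : ∀ n a b → 0ℤ ≡ hev (replicate (suc n) 0ℤ) a b
    zeros zero    a b = refl
    zeros (suc n) a b = trans (alg a (b ^ suc n)) (cong (λ z → 0ℤ * b ^ suc n + a * z) (zeros n a b))
      where
      alg : ∀ a p → 0ℤ ≡ 0ℤ * p + a * 0ℤ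
      alg = solve-∀
  homogeneous-sum {n} {suc m} f hf = homogeneous-+ (hf zero) (homogeneous-sum (f ∘ suc) (hf ∘ suc))

  pencil : ∀ {n} → Mat n n → Mat n n → ℤ → ℤ → Mat n n
  pencil α β a b i j = α i j * a + β i j * b

  homogeneous-det : ∀ n (α β : Mat n n) → Homogeneous n (λ a b → det n (pencil α β a b))
  homogeneous-det zero    α β = 1ℤ ∷ [] , λ _ _ → refl
  homogeneous-det (suc n) α β = homogeneous-cong (λ a b → sym (det-expand (pencil α β a b)))
    (homogeneous-sum (λ j a b → term (pencil α β a b) j) summand)
    where
    summand : ∀ j → Homogeneous (suc n) (λ a b → term (pencil α β a b) j)
    summand j = homogeneous-cong (λ a b → alg (sign (toℕ j)) (α zero j) (β zero j) a b (det n (minor j (pencil α β a b))))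
        (homogeneous-* (sign (toℕ j)) (homogeneous-+ (homogeneous-* (α zero j) (homogeneous-a* IH)) (homogeneous-* (β zero j) (homogeneous-b* IH))))
      where
      IH : Homogeneous n (λ a b → det n (minor j (pencil α β a b)))
      IH = homogeneous-det n (minor j α) (minor j β)
      alg : ∀ s x y a b d → s * (x * (a * d) + y * (b * d)) ≡ s * (x * a + y * b) * d
      alg = solve-∀

  -- The divisor `|z| + 1` leaves no cofactor but 0. This is the substitute for letting `h` or `u`
  -- tend to 0.
  infinitely-divisible : ∀ z → (∀ m → ∃ λ w → z ≡ pos (suc m) * w) → z ≡ 0ℤ
  infinitely-divisible z divs = case-on w ∣ w ∣ refl (proj₂ (divs ∣ z ∣))
    where
    w = proj₁ (divs ∣ z ∣)
    case-on : ∀ w k → ∣ w ∣ ≡ k → z ≡ pos (suc ∣ z ∣) * w → z ≡ 0ℤ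
    case-on w zero    ∣w∣≡0 z≡ = trans z≡ (trans (cong (pos (suc ∣ z ∣) *_) (∣i∣≡0⇒i≡0 {w} ∣w∣≡0)) (*-zeroʳ (pos (suc ∣ z ∣))))
    case-on w (suc k) ∣w∣≡k z≡ = ⊥-elim (ℕ.<-irrefl refl (ℕ.≤-trans (ℕ.m≤m*n (suc ∣ z ∣) (suc k))
      (ℕ.≤-reflexive (sym (trans (cong ∣_∣ z≡) (trans (abs-* (pos (suc ∣ z ∣)) w) (cong (suc ∣ z ∣ ℕ.*_) ∣w∣≡k)))))))

  -- The difference of the constant coefficients is divisible by every positive integer, hence 0.
  -- Cancelling these and one factor `a` leaves the tails, which again agree at all positive
  -- integers.
  hev-injective : ∀ {n} (cs ds : Vec ℤ (suc n)) → (∀ m → hev cs (pos (suc m)) 1ℤ ≡ hev ds (pos (suc m)) 1ℤ) → cs ≡ ds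
  hev-injective {zero}  (c ∷ [])      (d ∷ [])      eq = cong (_∷ []) (eq 0)
  hev-injective {suc n} (c ∷ c′ ∷ cs) (d ∷ d′ ∷ ds) eq = cong₂ _∷_ c≡d (hev-injective (c′ ∷ cs) (d′ ∷ ds) tails)
    where
    alg₁ : ∀ c d x p q o → c * o + x * p ≡ d * o + x * q → c * o - d * o ≡ x * (q - p)
    alg₁ c d x p q o e = trans (l c d x p o) (trans (cong (λ z → z - d * o - x * p) e) (r d x p q o))
      where
      l : ∀ c d x p o → c * o - d * o ≡ c * o + x * p - d * o - x * p
      l = solve-∀
      r : ∀ d x p q o → d * o + x * q - d * o - x * p ≡ x * (q - p)
      r = solve-∀
    one : 1ℤ ^ suc n ≡ 1ℤ
    one = ^-zeroˡ (suc n)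
    eq′ : ∀ m → c * 1ℤ + pos (suc m) * hev (c′ ∷ cs) (pos (suc m)) 1ℤ ≡ d * 1ℤ + pos (suc m) * hev (d′ ∷ ds) (pos (suc m)) 1ℤ
    eq′ m = subst (λ o → c * o + pos (suc m) * hev (c′ ∷ cs) (pos (suc m)) 1ℤ ≡ d * o + pos (suc m) * hev (d′ ∷ ds) (pos (suc m)) 1ℤ) one (eq m)
    c≡d : c ≡ d
    c≡d = i-j≡0⇒i≡j c d (infinitely-divisible (c - d) λ m → _ ,
      trans (cong₂ _-_ (sym (*-identityʳ c)) (sym (*-identityʳ d))) (alg₁ c d (pos (suc m)) _ _ 1ℤ (eq′ m)))
    tails : ∀ m → hev (c′ ∷ cs) (pos (suc m)) 1ℤ ≡ hev (d′ ∷ ds) (pos (suc m)) 1ℤ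
    tails m = *-cancelˡ-≡ (pos (suc m)) _ _ (∙-cancelˡ (c * 1ℤ) _ _ (trans (eq′ m) (cong (λ z → z * 1ℤ + _) (sym c≡d))))

  homogeneous-≡ : ∀ {n f g} → Homogeneous n f → Homogeneous n g → (∀ x → f x 1ℤ ≡ g x 1ℤ) → ∀ a b → f a b ≡ g a b
  homogeneous-≡ {f = f} {g} (cs , f≡) (ds , g≡) eq a b =
    trans (f≡ a b) (trans (cong (λ es → hev es a b) (hev-injective cs ds λ m →
      trans (sym (f≡ _ _)) (trans (eq (pos (suc m))) (g≡ _ _)))) (sym (g≡ a b)))

  -- Traces of powers from the characteristic polynomial

  module _ {n : ℕ} (A : Mat n n) where

    charpoly : ℤ → ℤ → ℤ
    charpoly a b = det n (pencil δ (λ i j → - A i j) a b)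

    geometric : ℤ → ℕ → Mat n n
    geometric u zero    i j = 0ℤ
    geometric u (suc K) i j = geometric u K i j + u ^ K * pow A K i j

    private
      I-uA : ℤ → Mat n n
      I-uA u = pencil δ (λ i j → - A i j) 1ℤ u

    geometric-telescopes : ∀ u K → geometric u K · I-uA u ≗₂ (λ i j → δ i j + - (u ^ K) * pow A K i j)
    geometric-telescopes u zero i j = trans (sum-zero _ (λ k → *-zeroˡ (I-uA u k j))) (alg (δ i j))
      where
      alg : ∀ d → 0ℤ ≡ d + - 1ℤ * d
      alg = solve-∀
    geometric-telescopes u (suc K) i j = begin
      sum (λ k → (geometric u K i k + u ^ K * pow A K i k) * I-uA u k j)
        ≡⟨ sum-cong-≗ (λ k → alg₁ (geometric u K i k) (u ^ K) (pow A K i k) (δ k j) (A k j) u) ⟩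
      sum (λ k → geometric u K i k * I-uA u k j + (u ^ K * (pow A K i k * δ k j) + - (u * u ^ K) * (pow A K i k * A k j)))
        ≡⟨ trans (∑-distrib-+ (λ k → geometric u K i k * I-uA u k j) _)
             (cong ((geometric u K · I-uA u) i j +_) (trans (∑-distrib-+ (λ k → u ^ K * (pow A K i k * δ k j)) _)
               (sym (cong₂ _+_ (*-distribˡ-sum (u ^ K) (λ k → pow A K i k * δ k j)) (*-distribˡ-sum (- (u * u ^ K)) (λ k → pow A K i k * A k j)))))) ⟩
      (geometric u K · I-uA u) i j + (u ^ K * (pow A K · δ) i j + - (u * u ^ K) * pow A (suc K) i j)
        ≡⟨ cong₂ (λ x y → x + (u ^ K * y + - (u * u ^ K) * pow A (suc K) i j)) (geometric-telescopes u K i j) (·-identityʳ (pow A K) i j) ⟩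
      δ i j + - (u ^ K) * pow A K i j + (u ^ K * pow A K i j + - (u * u ^ K) * pow A (suc K) i j)
        ≡⟨ alg₂ (δ i j) (u ^ K) (pow A K i j) (- (u * u ^ K) * pow A (suc K) i j) ⟩
      δ i j + - (u ^ suc K) * pow A (suc K) i j ∎
      where
      open ≡-Reasoning
      alg₁ : ∀ g p x d a u → (g + p * x) * (d * 1ℤ + - a * u) ≡ g * (d * 1ℤ + - a * u) + (p * (x * d) + - (u * p) * (x * a))
      alg₁ = solve-∀
      alg₂ : ∀ d p x z → d + - p * x + (p * x + z) ≡ d + z
      alg₂ = solve-∀

    -- The coefficient of `h` is the term `deriv (I-uA u) δ` of `newton`. Being determined by values
    -- of `charpoly`, it is shared by matrices with the same characteristic polynomial.
    charpoly-shift : ∀ u h → ∃ λ R → charpoly (1ℤ + h) u ≡ charpoly 1ℤ u + h * deriv (I-uA u) δ + h * h * R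
    charpoly-shift u h = proj₁ P , trans (det-cong (λ i j → alg (δ i j) (- A i j) u h)) (proj₂ P)
      where
      P = det-perturb (I-uA u) δ h
      alg : ∀ d a u h → d * (1ℤ + h) + a * u ≡ d * 1ℤ + a * u + h * d
      alg = solve-∀

    -- The value is 1 modulo `u`, so it can be removed as a factor from congruences modulo `u`.
    charpoly-near-1 : ∀ u → ∃ λ V → charpoly 1ℤ u ≡ 1ℤ + u * V
    charpoly-near-1 u = _ , trans (trans (det-cong (λ i j → alg₁ (δ i j) (A i j) u)) (proj₂ P))
        (trans (cong (λ z → z + u * deriv δ (λ i j → - A i j) + u * u * proj₁ P) (det-δ n)) (alg₂ u _ _))
      where
      P = det-perturb δ (λ i j → - A i j) u
      alg₁ : ∀ d a u → d * 1ℤ + - a * u ≡ d + u * - a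
      alg₁ = solve-∀
      alg₂ : ∀ u x r → 1ℤ + u * x + u * u * r ≡ 1ℤ + u * (x + u * r)
      alg₂ = solve-∀

    -- Jacobi's formula applied to X = Σ_{k<K} u^k A^k, an inverse of I - uA modulo u^K.
    newton : ∀ u K → tr (geometric u K) * charpoly 1ℤ u ≡ deriv (I-uA u) δ + - (u ^ K) * deriv (I-uA u) (pow A K)
    newton u K = begin
      tr (geometric u K) * charpoly 1ℤ u            ≡⟨ jacobi (I-uA u) (geometric u K) ⟨
      deriv (I-uA u) (geometric u K · I-uA u)       ≡⟨ deriv-cong (I-uA u) (geometric-telescopes u K) ⟩
      deriv (I-uA u) (λ i j → δ i j + - (u ^ K) * pow A K i j) ≡⟨ deriv-linear (I-uA u) δ (pow A K) (- (u ^ K)) ⟩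
      deriv (I-uA u) δ + - (u ^ K) * deriv (I-uA u) (pow A K) ∎
      where open ≡-Reasoning

    tr-geometric-suc : ∀ u K → tr (geometric u (suc K)) ≡ tr (geometric u K) + u ^ K * tr (pow A K)
    tr-geometric-suc u K = trans (∑-distrib-+ (λ i → geometric u K i i) (λ i → u ^ K * pow A K i i))
      (cong (tr (geometric u K) +_) (sym (*-distribˡ-sum (u ^ K) (λ i → pow A K i i))))

    traceDefect : ℤ → ℕ → ℤ
    traceDefect u K = deriv (I-uA u) (pow A K)

    linearCoefficient : ℤ → ℤ
    linearCoefficient u = deriv (I-uA u) δ

  -- Induction on the exponent. If the traces below `K` agree, subtracting the two instances of
  -- `newton` at `suc K` leaves `u ^ K` times the difference of the `K`-th traces times
  -- `charpoly 1ℤ u`, equal to a multiple of `u ^ suc K`. After cancelling `u ^ K`, the factor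
  -- `charpoly 1ℤ u` is 1 modulo `u`, so the difference is divisible by every positive `u`.
  charpoly⇒traces : ∀ {n} (A B : Mat n n) → (∀ x → charpoly A x 1ℤ ≡ charpoly B x 1ℤ) → ∀ k → tr (pow A k) ≡ tr (pow B k)
  charpoly⇒traces {n} A B eq = λ k → step k (geometrics k)
    where
    open ≡-Reasoning
    eq₂ : ∀ a b → charpoly A a b ≡ charpoly B a b
    eq₂ = homogeneous-≡ (homogeneous-det n δ (λ i j → - A i j)) (homogeneous-det n δ (λ i j → - B i j)) eq
    -- The values at `1ℤ + h` and at `1ℤ` agree, so the difference of the linear coefficients is a
    -- multiple of every positive `h`.
    linear≡ : ∀ u → linearCoefficient A u ≡ linearCoefficient B u
    linear≡ u = i-j≡0⇒i≡j _ _ (infinitely-divisible _ λ m → let h = pos (suc m) in _ ,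
      *-cancelˡ-≡ h _ _ (alg h (charpoly A 1ℤ u) (linearCoefficient A u) (linearCoefficient B u) _ _
        (begin
          charpoly A 1ℤ u + h * linearCoefficient A u + h * h * proj₁ (charpoly-shift A u h) ≡⟨ proj₂ (charpoly-shift A u h) ⟨
          charpoly A (1ℤ + h) u ≡⟨ eq₂ (1ℤ + h) u ⟩
          charpoly B (1ℤ + h) u ≡⟨ proj₂ (charpoly-shift B u h) ⟩
          charpoly B 1ℤ u + h * linearCoefficient B u + h * h * proj₁ (charpoly-shift B u h)
            ≡⟨ cong (λ z → z + h * linearCoefficient B u + h * h * proj₁ (charpoly-shift B u h)) (eq₂ 1ℤ u) ⟨
          charpoly A 1ℤ u + h * linearCoefficient B u + h * h * proj₁ (charpoly-shift B u h) ∎)))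
      where
      alg : ∀ h c x y r s → c + h * x + h * h * r ≡ c + h * y + h * h * s → h * (x - y) ≡ h * (h * (s - r))
      alg h c x y r s e = trans (l h c x y r) (trans (cong (λ z → z - c - h * y - h * h * r) e) (r′ h c y r s))
        where
        l : ∀ h c x y r → h * (x - y) ≡ c + h * x + h * h * r - c - h * y - h * h * r
        l = solve-∀
        r′ : ∀ h c y r s → c + h * y + h * h * s - c - h * y - h * h * r ≡ h * (h * (s - r))
        r′ = solve-∀
    step : ∀ K → (∀ u → tr (geometric A u K) ≡ tr (geometric B u K)) → tr (pow A K) ≡ tr (pow B K)
    step K eqK = i-j≡0⇒i≡j _ _ (infinitely-divisible _ λ m →
      let u = pos (suc m)
          instance _ = u^n≢0 m K
          p = charpoly A 1ℤ u
          V = proj₁ (charpoly-near-1 A u)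
          g = tr (geometric A u K)
      in _ , solved u _ _ V _ (*-cancelˡ-≡ (u ^ K) _ _
           (difference (u ^ K) u g (tr (pow A K)) (tr (pow B K)) p (linearCoefficient A u) (traceDefect A u (suc K)) (traceDefect B u (suc K))
             (trans (cong (_* p) (sym (tr-geometric-suc A u K))) (newton A u (suc K)))
             (begin
                (g + u ^ K * tr (pow B K)) * p ≡⟨ cong₂ (λ x y → (x + u ^ K * tr (pow B K)) * y) (eqK u) (eq₂ 1ℤ u) ⟩
                (tr (geometric B u K) + u ^ K * tr (pow B K)) * charpoly B 1ℤ u ≡⟨ cong (_* charpoly B 1ℤ u) (tr-geometric-suc B u K) ⟨
                tr (geometric B u (suc K)) * charpoly B 1ℤ u ≡⟨ newton B u (suc K) ⟩
                linearCoefficient B u + - (u ^ suc K) * traceDefect B u (suc K)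
                  ≡⟨ cong (λ z → z + - (u ^ suc K) * traceDefect B u (suc K)) (linear≡ u) ⟨
                linearCoefficient A u + - (u ^ suc K) * traceDefect B u (suc K) ∎)))
           (proj₂ (charpoly-near-1 A u)))
      where
      u^n≢0 : ∀ m K → NonZero (pos (suc m) ^ K)
      u^n≢0 m zero    = _
      u^n≢0 m (suc K) = i*j≢0 (pos (suc m)) (pos (suc m) ^ K) {{_}} {{u^n≢0 m K}}
      difference : ∀ q u g s t p l x y → (g + q * s) * p ≡ l + - (u * q) * x → (g + q * t) * p ≡ l + - (u * q) * y →
                   q * ((s - t) * p) ≡ q * (u * (y - x))
      difference q u g s t p l x y e f = trans (L q g s t p) (trans (cong₂ _-_ e f) (R q u l x y))
        where
        L : ∀ q g s t p → q * ((s - t) * p) ≡ (g + q * s) * p - (g + q * t) * p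
        L = solve-∀
        R : ∀ q u l x y → l + - (u * q) * x - (l + - (u * q) * y) ≡ q * (u * (y - x))
        R = solve-∀
      solved : ∀ u d w V p → d * p ≡ u * w → p ≡ 1ℤ + u * V → d ≡ u * (w - V * d)
      solved u d w V p e f = trans (L u d V) (trans (cong (λ z → d * z - u * (V * d)) (sym f)) (trans (cong (_- u * (V * d)) e) (R u w V d)))
        where
        L : ∀ u d V → d ≡ d * (1ℤ + u * V) - u * (V * d)
        L = solve-∀
        R : ∀ u w V d → u * w - u * (V * d) ≡ u * (w - V * d)
        R = solve-∀
    geometrics : ∀ K u → tr (geometric A u K) ≡ tr (geometric B u K)
    geometrics zero    u = refl
    geometrics (suc K) u = trans (tr-geometric-suc A u K)
      (trans (cong₂ (λ x y → x + u ^ K * y) (geometrics K u) (step K (geometrics K))) (sym (tr-geometric-suc B u K)))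

open import Data.Nat using (ℕ; zero; suc; _+_; _*_; _∸_; _^_; _%_; _≤_; _<_; z≤n; s≤s; >-nonZero)
import Data.Nat as ℕ
open import Data.Nat.DivMod using (_mod_; m%n<n; m%n%n≡m%n; [m+n]%n≡m%n; [m+kn]%n≡m%n; %-distribˡ-+; m<n⇒m%n≡m; n%n≡0)
open import Data.Nat.ListAction using () renaming (sum to total)
open import Data.Nat.ListAction.Properties using (sum-↭)
open import Data.Nat.Properties
open import Data.Nat.Tactic.RingSolver using (solve-∀)
open import Data.Fin using (Fin; zero; suc; toℕ; fromℕ<; punchIn; punchOut; splitAt; join; _↑ˡ_; _↑ʳ_)
open import Data.Fin.Permutation using (Permutation; Permutation′; _⟨$⟩ʳ_; _⟨$⟩ˡ_; inverseˡ; inverseʳ; insert; insert-punchIn; lift₀; transpose; ↔⇒≡)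
  renaming (id to idₚ)
open import Data.Fin.Properties using (+↔⊎; any?; join-splitAt; pigeonhole; punchIn-punchOut; punchOut-injective; splitAt-↑ˡ; splitAt-↑ʳ; toℕ-fromℕ<; toℕ-injective; toℕ<n)
  renaming (_≟_ to _≟ᶠ_; suc-injective to suc-injectiveᶠ)
open import Data.List using (List; []; _∷_; _++_; length; map; replicate)
open import Data.List.Membership.DecPropositional ℕ._≟_ using (_∈?_)
open import Data.List.Membership.Propositional using (_∈_)
open import Data.List.Membership.Propositional.Properties using (∈-∃++; ∈-++⁻)
open import Data.List.Relation.Binary.Permutation.Propositional as Perm using (_↭_; ↭-refl; ↭-sym; ↭-trans; prep)
open import Data.List.Relation.Binary.Permutation.Propositional.Properties using (All-resp-↭; map⁺; ↭-length) renaming (shift to ↭-shift)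
open import Data.List.Relation.Unary.All as Allˡ using ([]; _∷_) renaming (All to Allˡ)
open import Data.List.Relation.Unary.All.Properties using (++⁺; ++⁻ˡ; ++⁻ʳ; replicate⁺; ¬Any⇒All¬)
open import Data.List.Relation.Unary.Any using (here; there)
open import Data.Vec using (Vec; []; _∷_; toList)
open import Data.Vec.Relation.Unary.All using (All; []; _∷_)
open import Algebra.Properties.Semiring.Sum +-*-semiring
  using (sum; sum-cong-≗; ∑-distrib-+; ∑-comm; *-distribˡ-sum; *-distribʳ-sum; sum-replicate-zero; sum-permute)

-- Walks in a cone

ℕMat : ℕ → Set
ℕMat n = Fin n → Fin n → ℕ

𝟙 : ∀ {n} → ℕMat n
𝟙 zero    zero    = 1
𝟙 zero    (suc j) = 0
𝟙 (suc i) zero    = 0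
𝟙 (suc i) (suc j) = 𝟙 i j

𝟙-sym : ∀ {n} (i j : Fin n) → 𝟙 i j ≡ 𝟙 j i
𝟙-sym zero    zero    = refl
𝟙-sym zero    (suc j) = refl
𝟙-sym (suc i) zero    = refl
𝟙-sym (suc i) (suc j) = 𝟙-sym i j

sum-≡0 : ∀ {n} (f : Fin n → ℕ) → (∀ i → f i ≡ 0) → sum f ≡ 0
sum-≡0 {n} f f≗0 = trans (sum-cong-≗ f≗0) (sum-replicate-zero n)

sum-𝟙ˡ : ∀ {n} (i : Fin n) (f : Fin n → ℕ) → sum (λ l → 𝟙 i l * f l) ≡ f i
sum-𝟙ˡ {suc n} zero f = trans (cong₂ _+_ (+-identityʳ (f zero)) (sum-replicate-zero n)) (+-identityʳ (f zero))
sum-𝟙ˡ (suc i)      f = sum-𝟙ˡ i (f ∘ suc)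

sum-𝟙ʳ : ∀ {n} (j : Fin n) (f : Fin n → ℕ) → sum (λ l → f l * 𝟙 l j) ≡ f j
sum-𝟙ʳ j f = trans (sum-cong-≗ λ l → trans (*-comm (f l) (𝟙 l j)) (cong (_* f l) (𝟙-sym l j))) (sum-𝟙ˡ j f)

sum-mono : ∀ {n} {f g : Fin n → ℕ} → (∀ i → f i ≤ g i) → sum f ≤ sum g
sum-mono {zero}  f≤g = z≤n
sum-mono {suc n} f≤g = +-mono-≤ (f≤g zero) (sum-mono (f≤g ∘ suc))

sum-const : ∀ n c → sum {n} (λ _ → c) ≡ n * c
sum-const zero    c = refl
sum-const (suc n) c = cong (c +_) (sum-const n c)

mpow : ∀ {n} → ℕMat n → ℕ → ℕMat n
mpow M zero    i j = 𝟙 i j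
mpow M (suc k) i j = sum (λ l → M i l * mpow M k l j)

trace : ∀ {n} → ℕMat n → ℕ
trace M = sum (λ i → M i i)

Symmetric : ∀ {n} → ℕMat n → Set
Symmetric M = ∀ i j → M i j ≡ M j i

mpow-cong : ∀ {n} {M M′ : ℕMat n} → (∀ i j → M i j ≡ M′ i j) → ∀ k i j → mpow M k i j ≡ mpow M′ k i j
mpow-cong M≗ zero    i j = refl
mpow-cong M≗ (suc k) i j = sum-cong-≗ λ l → cong₂ _*_ (M≗ i l) (mpow-cong M≗ k l j)

mpow-suc : ∀ {n} (M : ℕMat n) k i j → mpow M (suc k) i j ≡ sum (λ l → mpow M k i l * M l j)
mpow-suc M zero    i j = trans (sum-𝟙ʳ j (M i)) (sym (sum-𝟙ˡ i (λ l → M l j)))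
mpow-suc M (suc k) i j = begin
  sum (λ l → M i l * mpow M (suc k) l j)
    ≡⟨ sum-cong-≗ (λ l → trans (cong (M i l *_) (mpow-suc M k l j)) (*-distribˡ-sum (M i l) (λ r → mpow M k l r * M r j))) ⟩
  sum (λ l → sum (λ r → M i l * (mpow M k l r * M r j)))
    ≡⟨ ∑-comm (λ l r → M i l * (mpow M k l r * M r j)) ⟩
  sum (λ r → sum (λ l → M i l * (mpow M k l r * M r j)))
    ≡⟨ sum-cong-≗ (λ r → trans (sum-cong-≗ (λ l → sym (*-assoc (M i l) (mpow M k l r) (M r j))))
                               (sym (*-distribʳ-sum (M r j) (λ l → M i l * mpow M k l r)))) ⟩
  sum (λ r → mpow M (suc k) i r * M r j) ∎
  where open ≡-Reasoning

mpow-sym : ∀ {n} {M : ℕMat n} → Symmetric M → ∀ k → Symmetric (mpow M k)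
mpow-sym         M-sym zero    i j = 𝟙-sym i j
mpow-sym {M = M} M-sym (suc k) i j = trans
  (sum-cong-≗ λ l → trans (cong₂ _*_ (M-sym i l) (mpow-sym M-sym k l j)) (*-comm (M l i) (mpow M k j l)))
  (sym (mpow-suc M k j i))

-- cv f g k = Σ f a * g b over a + b = k - 1
cv : (ℕ → ℕ) → (ℕ → ℕ) → ℕ → ℕ
cv f g zero    = 0
cv f g (suc k) = f k * g 0 + cv f (g ∘ suc) k

-- cv₂ d m k = Σ d c * m a b over a + b + c = k - 2
cv₂ : (ℕ → ℕ) → (ℕ → ℕ → ℕ) → ℕ → ℕ
cv₂ d m zero    = 0
cv₂ d m (suc k) = cv d (m 0) k + cv₂ d (m ∘ suc) k

cv-cong : ∀ {f f′ g g′ : ℕ → ℕ} → (∀ j → f j ≡ f′ j) → (∀ j → g j ≡ g′ j) → ∀ k → cv f g k ≡ cv f′ g′ k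
cv-cong f≗ g≗ zero    = refl
cv-cong f≗ g≗ (suc k) = cong₂ _+_ (cong₂ _*_ (f≗ k) (g≗ 0)) (cv-cong f≗ (g≗ ∘ suc) k)

cv-mono : ∀ {f f′ g g′ : ℕ → ℕ} k → (∀ j → j < k → f j ≤ f′ j) → (∀ j → g j ≤ g′ j) → cv f g k ≤ cv f′ g′ k
cv-mono zero    f≤ g≤ = z≤n
cv-mono (suc k) f≤ g≤ = +-mono-≤ (*-mono-≤ (f≤ k ≤-refl) (g≤ 0)) (cv-mono k (λ j j<k → f≤ j (m<n⇒m<1+n j<k)) (g≤ ∘ suc))

cv₂-cong : ∀ {d d′ : ℕ → ℕ} {m m′ : ℕ → ℕ → ℕ} → (∀ j → d j ≡ d′ j) → (∀ a j → m a j ≡ m′ a j) → ∀ k → cv₂ d m k ≡ cv₂ d′ m′ k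
cv₂-cong d≗ m≗ zero    = refl
cv₂-cong d≗ m≗ (suc k) = cong₂ _+_ (cv-cong d≗ (m≗ 0) k) (cv₂-cong d≗ (m≗ ∘ suc) k)

cv₂-mono : ∀ {d d′ : ℕ → ℕ} {m m′ : ℕ → ℕ → ℕ} → (∀ j → d j ≤ d′ j) → (∀ a j → m a j ≤ m′ a j) → ∀ k → cv₂ d m k ≤ cv₂ d′ m′ k
cv₂-mono d≤ m≤ zero    = z≤n
cv₂-mono d≤ m≤ (suc k) = +-mono-≤ (cv-mono k (λ j _ → d≤ j) (m≤ 0)) (cv₂-mono d≤ (m≤ ∘ suc) k)

cv-sum : ∀ {n} (d : ℕ → ℕ) (a : Fin n → ℕ) (g : Fin n → ℕ → ℕ) k →
         sum (λ l → a l * cv d (g l) k) ≡ cv d (λ j → sum (λ l → a l * g l j)) k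
cv-sum d a g zero    = sum-≡0 _ (λ l → *-zeroʳ (a l))
cv-sum d a g (suc k) = begin
  sum (λ l → a l * (d k * g l 0 + cv d (g l ∘ suc) k))
    ≡⟨ sum-cong-≗ (λ l → alg (a l) (d k) (g l 0) (cv d (g l ∘ suc) k)) ⟩
  sum (λ l → d k * (a l * g l 0) + a l * cv d (g l ∘ suc) k)
    ≡⟨ ∑-distrib-+ (λ l → d k * (a l * g l 0)) (λ l → a l * cv d (g l ∘ suc) k) ⟩
  sum (λ l → d k * (a l * g l 0)) + sum (λ l → a l * cv d (g l ∘ suc) k)
    ≡⟨ cong₂ _+_ (sym (*-distribˡ-sum (d k) (λ l → a l * g l 0))) (cv-sum d a (λ l → g l ∘ suc) k) ⟩
  cv d (λ j → sum (λ l → a l * g l j)) (suc k) ∎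
  where
  open ≡-Reasoning
  alg : ∀ a d g z → a * (d * g + z) ≡ d * (a * g) + a * z
  alg = solve-∀

sum-cv-cv : ∀ {n} (d : ℕ → ℕ) (x y : Fin n → ℕ → ℕ) k →
  sum (λ i → cv (cv d (x i)) (y i) k) ≡ cv₂ d (λ a b → sum (λ i → y i a * x i b)) k
sum-cv-cv {n} d x y zero    = sum-replicate-zero n
sum-cv-cv d x y (suc k) = begin
  sum (λ i → cv d (x i) k * y i 0 + cv (cv d (x i)) (y i ∘ suc) k)
    ≡⟨ ∑-distrib-+ (λ i → cv d (x i) k * y i 0) (λ i → cv (cv d (x i)) (y i ∘ suc) k) ⟩
  sum (λ i → cv d (x i) k * y i 0) + sum (λ i → cv (cv d (x i)) (y i ∘ suc) k)
    ≡⟨ cong₂ _+_ (trans (sum-cong-≗ (λ i → *-comm (cv d (x i) k) (y i 0))) (cv-sum d (λ i → y i 0) x k))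
                 (sum-cv-cv d x (λ i → y i ∘ suc) k) ⟩
  cv₂ d (λ a b → sum (λ i → y i a * x i b)) (suc k) ∎
  where open ≡-Reasoning

walks : ∀ {n} → ℕMat n → ℕ → Fin n → ℕ
walks P zero    i = 1
walks P (suc j) i = sum (λ l → P i l * walks P j l)

totalWalks : ∀ {n} → ℕMat n → ℕ → ℕ
totalWalks P j = sum (walks P j)

-- With `walks P j` read as the vector `P^j 1`, symmetry moves a factor `P` from one side of the
-- product to the other, so only `a + b` matters.
walks-dot : ∀ {n} {P : ℕMat n} → Symmetric P → ∀ a b → sum (λ i → walks P a i * walks P b i) ≡ totalWalks P (b + a)
walks-dot {P = P} P-sym zero    b = trans (sum-cong-≗ λ i → *-identityˡ (walks P b i)) (cong (totalWalks P) (sym (+-identityʳ b)))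
walks-dot {P = P} P-sym (suc a) b = begin
  sum (λ i → sum (λ l → P i l * walks P a l) * walks P b i)
    ≡⟨ sum-cong-≗ (λ i → *-distribʳ-sum (walks P b i) (λ l → P i l * walks P a l)) ⟩
  sum (λ i → sum (λ l → P i l * walks P a l * walks P b i)) ≡⟨ ∑-comm (λ i l → P i l * walks P a l * walks P b i) ⟩
  sum (λ l → sum (λ i → P i l * walks P a l * walks P b i))
    ≡⟨ sum-cong-≗ (λ l → trans (sum-cong-≗ λ i → trans (cong (λ z → z * walks P a l * walks P b i) (P-sym i l)) (alg (P l i) (walks P a l) (walks P b i)))
                               (sym (*-distribˡ-sum (walks P a l) (λ i → P l i * walks P b i)))) ⟩
  sum (λ l → walks P a l * walks P (suc b) l) ≡⟨ walks-dot P-sym a (suc b) ⟩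
  totalWalks P (suc b + a) ≡⟨ cong (totalWalks P) (sym (+-suc b a)) ⟩
  totalWalks P (b + suc a) ∎
  where
  open ≡-Reasoning
  alg : ∀ p x y → p * x * y ≡ x * (p * y)
  alg = solve-∀

-- For `P = coned X` this is the signless Laplacian of the cone over `X`, with the apex at `zero`.
bordered : ∀ {n} → ℕMat n → ℕMat (suc n)
bordered {n} P zero    zero    = n
bordered     P zero    (suc j) = 1
bordered     P (suc i) zero    = 1
bordered     P (suc i) (suc j) = P i j

module _ {n : ℕ} (P : ℕMat n) (P-sym : Symmetric P) where

  private
    B = bordered P

    B-sym : Symmetric B
    B-sym zero    zero    = refl
    B-sym zero    (suc j) = refl
    B-sym (suc i) zero    = refl
    B-sym (suc i) (suc j) = P-sym i j

  apexWalks : ℕ → ℕ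
  apexWalks k = mpow B k zero zero

  private
    -- Cut at the first arrival: some steps inside the base, one step to the apex, then a closed
    -- walk there.
    toApex : ∀ k i → mpow B k (suc i) zero ≡ cv apexWalks (λ j → walks P j i) k
    toApex zero    i = refl
    toApex (suc k) i = cong₂ _+_ (*-comm 1 (apexWalks k))
      (trans (sum-cong-≗ (λ l → cong (P i l *_) (toApex k l))) (cv-sum apexWalks (P i) (λ l j → walks P j l) k))

    -- The first summand counts the walks that never meet the apex. The others are cut at their
    -- first visit, and symmetry reverses what follows, so that `toApex` can later cut it at the
    -- last visit.
    avoidApex : ∀ k i i′ → mpow B k (suc i) (suc i′) ≡ mpow P k i i′ + cv (λ b → mpow B b (suc i′) zero) (λ a → walks P a i) k
    avoidApex zero    i i′ = sym (+-identityʳ (𝟙 i i′))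
    avoidApex (suc k) i i′ = begin
      1 * mpow B k zero (suc i′) + sum (λ l → P i l * mpow B k (suc l) (suc i′))
        ≡⟨ cong₂ _+_ (trans (*-comm 1 (mpow B k zero (suc i′))) (cong (_* 1) (mpow-sym B-sym k zero (suc i′))))
             (trans (sum-cong-≗ λ l → trans (cong (P i l *_) (avoidApex k l i′)) (*-distribˡ-+ (P i l) (mpow P k l i′) _))
                    (∑-distrib-+ (λ l → P i l * mpow P k l i′) (λ l → P i l * cv c (λ a → walks P a l) k))) ⟩
      c k * 1 + (mpow P (suc k) i i′ + sum (λ l → P i l * cv c (λ a → walks P a l) k))
        ≡⟨ cong (λ z → c k * 1 + (mpow P (suc k) i i′ + z)) (cv-sum c (P i) (λ l a → walks P a l) k) ⟩
      c k * 1 + (mpow P (suc k) i i′ + cv c (λ a → walks P (suc a) i) k)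
        ≡⟨ alg (c k * 1) (mpow P (suc k) i i′) _ ⟩
      mpow P (suc k) i i′ + (c k * 1 + cv c (λ a → walks P (suc a) i) k) ∎
      where
      open ≡-Reasoning
      c : ℕ → ℕ
      c b = mpow B b (suc i′) zero
      alg : ∀ x y z → x + (y + z) ≡ y + (x + z)
      alg = solve-∀

  -- The first step is one of the `n` loops at the apex, or it opens an excursion into the base that
  -- lasts until the next return. So `totalWalks P` alone determines these numbers.
  apexWalks-suc : ∀ k → apexWalks (suc k) ≡ n * apexWalks k + cv apexWalks (totalWalks P) k
  apexWalks-suc k = cong (n * apexWalks k +_) (trans (sum-cong-≗ (λ l → cong (1 *_) (toApex k l)))
    (trans (cv-sum apexWalks (λ _ → 1) (λ l j → walks P j l) k)
           (cv-cong (λ _ → refl) (λ j → sum-cong-≗ (λ l → *-identityˡ (walks P j l))) k)))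

  -- A closed walk that starts in the base and meets the apex is cut at its first and last visits.
  -- Summing over the starting vertex joins the two outer pieces by `walks-dot`, so besides
  -- `trace (mpow P k)` only `totalWalks P` enters.
  trace-bordered : ∀ k → trace (mpow B k) ≡
    apexWalks k + (trace (mpow P k) + cv₂ apexWalks (λ a b → totalWalks P (b + a)) k)
  trace-bordered k = cong (apexWalks k +_) (begin
    sum (λ i → mpow B k (suc i) (suc i)) ≡⟨ sum-cong-≗ (λ i → avoidApex k i i) ⟩
    sum (λ i → mpow P k i i + cv (λ b → mpow B b (suc i) zero) (λ a → walks P a i) k)
      ≡⟨ ∑-distrib-+ (λ i → mpow P k i i) _ ⟩
    trace (mpow P k) + sum (λ i → cv (λ b → mpow B b (suc i) zero) (λ a → walks P a i) k)
      ≡⟨ cong (trace (mpow P k) +_) (trans (sum-cong-≗ (λ i → cv-cong (λ b → toApex b i) (λ _ → refl) k))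
           (sum-cv-cv apexWalks (λ i j → walks P j i) (λ i j → walks P j i) k)) ⟩
    trace (mpow P k) + cv₂ apexWalks (λ a b → sum (λ i → walks P a i * walks P b i)) k
      ≡⟨ cong (trace (mpow P k) +_) (cv₂-cong (λ _ → refl) (walks-dot P-sym) k) ⟩
    trace (mpow P k) + cv₂ apexWalks (λ a b → totalWalks P (b + a)) k ∎)
    where open ≡-Reasoning

module _ {n : ℕ} (P P′ : ℕMat n) (P-sym : Symmetric P) (P′-sym : Symmetric P′)
         (μ≤μ′ : ∀ j → totalWalks P j ≤ totalWalks P′ j) where

  private
    d  = apexWalks P P-sym
    d′ = apexWalks P′ P′-sym

  apexWalks-mono : ∀ k → d k ≤ d′ k
  apexWalks-mono k = upTo k k ≤-refl
    where
    upTo : ∀ k j → j ≤ k → d j ≤ d′ j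
    upTo k       zero    _         = ≤-refl
    upTo (suc k) (suc j) (s≤s j≤k) = begin
      d (suc j)                           ≡⟨ apexWalks-suc P P-sym j ⟩
      n * d j + cv d (totalWalks P) j     ≤⟨ +-mono-≤ (*-monoʳ-≤ n (upTo k j j≤k)) (cv-mono j (λ l l<j → upTo k l (≤-trans (<⇒≤ l<j) j≤k)) μ≤μ′) ⟩
      n * d′ j + cv d′ (totalWalks P′) j  ≡⟨ apexWalks-suc P′ P′-sym j ⟨
      d′ (suc j) ∎
      where open ≤-Reasoning

  private
    E≤E′ : ∀ k → cv₂ d (λ a b → totalWalks P (b + a)) k ≤ cv₂ d′ (λ a b → totalWalks P′ (b + a)) k
    E≤E′ = cv₂-mono apexWalks-mono (λ a b → μ≤μ′ (b + a))

  -- An excursion of length 3 takes 5 steps together with its two edges at the apex. So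
  -- `totalWalks P 3` first enters in `d 5`, with coefficient `d 0 = 1`, and afterwards the `n`
  -- loops at the apex multiply the gap by `n` at each step.
  apexWalks-gap : totalWalks P 3 + 4 ≤ totalWalks P′ 3 → ∀ k → d (5 + k) + 4 * n ^ k ≤ d′ (5 + k)
  apexWalks-gap gap zero = begin
    d 5 + 4 ≡⟨ cong (_+ 4) (apexWalks-suc P P-sym 4) ⟩
    n * d 4 + (d 3 * μ 0 + (d 2 * μ 1 + (d 1 * μ 2 + (1 * μ 3 + 0)))) + 4 ≡⟨ alg (n * d 4) (d 3 * μ 0) (d 2 * μ 1) (d 1 * μ 2) (μ 3) ⟩
    n * d 4 + (d 3 * μ 0 + (d 2 * μ 1 + (d 1 * μ 2 + (1 * (μ 3 + 4) + 0))))
      ≤⟨ +-mono-≤ (*-monoʳ-≤ n (D 4)) (+-mono-≤ (*-mono-≤ (D 3) (μ≤μ′ 0)) (+-mono-≤ (*-mono-≤ (D 2) (μ≤μ′ 1))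
           (+-mono-≤ (*-mono-≤ (D 1) (μ≤μ′ 2)) (+-monoˡ-≤ 0 (*-monoʳ-≤ 1 gap))))) ⟩
    n * d′ 4 + (d′ 3 * μ′ 0 + (d′ 2 * μ′ 1 + (d′ 1 * μ′ 2 + (1 * μ′ 3 + 0)))) ≡⟨ apexWalks-suc P′ P′-sym 4 ⟨
    d′ 5 ∎
    where
    open ≤-Reasoning
    μ  = totalWalks P
    μ′ = totalWalks P′
    D = apexWalks-mono
    alg : ∀ a b c e m → a + (b + (c + (e + (1 * m + 0)))) + 4 ≡ a + (b + (c + (e + (1 * (m + 4) + 0))))
    alg = solve-∀
  apexWalks-gap gap (suc k) = begin
    d (6 + k) + 4 * n ^ suc k ≡⟨ cong (_+ 4 * n ^ suc k) (apexWalks-suc P P-sym (5 + k)) ⟩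
    n * d (5 + k) + cv d (totalWalks P) (5 + k) + 4 * (n * n ^ k) ≡⟨ alg n (d (5 + k)) (cv d (totalWalks P) (5 + k)) (n ^ k) ⟩
    n * (d (5 + k) + 4 * n ^ k) + cv d (totalWalks P) (5 + k)
      ≤⟨ +-mono-≤ (*-monoʳ-≤ n (apexWalks-gap gap k)) (cv-mono (5 + k) (λ j _ → apexWalks-mono j) μ≤μ′) ⟩
    n * d′ (5 + k) + cv d′ (totalWalks P′) (5 + k) ≡⟨ apexWalks-suc P′ P′-sym (5 + k) ⟨
    d′ (6 + k) ∎
    where
    open ≤-Reasoning
    alg : ∀ n x y z → n * x + y + 4 * (n * z) ≡ n * (x + 4 * z) + y
    alg = solve-∀

  -- The full traces agree, so fewer walks through the apex must be balanced by more closed walks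
  -- that avoid it.
  trace-bordered-mono : ∀ k → trace (mpow (bordered P) k) ≡ trace (mpow (bordered P′) k) →
                        trace (mpow P′ k) ≤ trace (mpow P k)
  trace-bordered-mono k eq = +-cancelʳ-≤ (d k + E) _ _ (begin
    t′ + (d k + E)  ≤⟨ +-monoʳ-≤ t′ (+-mono-≤ (apexWalks-mono k) (E≤E′ k)) ⟩
    t′ + (d′ k + E′) ≡⟨ alg t′ (d′ k) E′ ⟩
    d′ k + (t′ + E′) ≡⟨ trace-bordered P′ P′-sym k ⟨
    trace (mpow (bordered P′) k) ≡⟨ eq ⟨
    trace (mpow (bordered P) k) ≡⟨ trace-bordered P P-sym k ⟩
    d k + (t + E) ≡⟨ alg t (d k) E ⟨
    t + (d k + E) ∎)
    where
    open ≤-Reasoning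
    t  = trace (mpow P k)
    t′ = trace (mpow P′ k)
    E  = cv₂ d (λ a b → totalWalks P (b + a)) k
    E′ = cv₂ d′ (λ a b → totalWalks P′ (b + a)) k
    alg : ∀ t d e → t + (d + e) ≡ d + (t + e)
    alg = solve-∀

  -- The deficit at the apex has to be made up by closed walks of `P` alone.
  trace-bordered-gap : totalWalks P 3 + 4 ≤ totalWalks P′ 3 → ∀ k →
    trace (mpow (bordered P) (5 + k)) ≡ trace (mpow (bordered P′) (5 + k)) → 4 * n ^ k ≤ trace (mpow P (5 + k))
  trace-bordered-gap gap k eq = +-cancelʳ-≤ (d (5 + k) + E) _ _ (begin
    4 * n ^ k + (d (5 + k) + E)  ≡⟨ alg₁ (4 * n ^ k) (d (5 + k)) E ⟩
    d (5 + k) + 4 * n ^ k + E ≤⟨ +-mono-≤ (apexWalks-gap gap k) (E≤E′ (5 + k)) ⟩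
    d′ (5 + k) + E′          ≤⟨ +-monoʳ-≤ (d′ (5 + k)) (m≤n+m E′ t′) ⟩
    d′ (5 + k) + (t′ + E′) ≡⟨ trace-bordered P′ P′-sym (5 + k) ⟨
    trace (mpow (bordered P′) (5 + k)) ≡⟨ eq ⟨
    trace (mpow (bordered P) (5 + k)) ≡⟨ trace-bordered P P-sym (5 + k) ⟩
    d (5 + k) + (t + E) ≡⟨ alg t (d (5 + k)) E ⟨
    t + (d (5 + k) + E) ∎)
    where
    open ≤-Reasoning
    t  = trace (mpow P (5 + k))
    t′ = trace (mpow P′ (5 + k))
    E  = cv₂ d (λ a b → totalWalks P (b + a)) (5 + k)
    E′ = cv₂ d′ (λ a b → totalWalks P′ (b + a)) (5 + k)
    alg : ∀ t d e → t + (d + e) ≡ d + (t + e)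
    alg = solve-∀
    alg₁ : ∀ x d e → x + (d + e) ≡ d + x + e
    alg₁ = solve-∀

-- Walk counts in graphs with all degrees 1 or 2

bit : Bool → ℕ
bit true  = 1
bit false = 0

deg : ∀ {n} → Graph n → Fin n → ℕ
deg X i = sum (λ j → bit (X i j))

signless : ∀ {n} → Graph n → ℕMat n
signless X i j = 𝟙 i j * deg X i + bit (X i j)

-- The block of the signless Laplacian of K₁ ∨ X that belongs to X.
coned : ∀ {n} → Graph n → ℕMat n
coned X i j = 𝟙 i j + signless X i j

cone : ∀ {n} → Graph n → Graph (suc n)
cone X zero    zero    = false
cone X zero    (suc j) = true
cone X (suc i) zero    = true
cone X (suc i) (suc j) = X i j

signless-cone : ∀ {n} (X : Graph n) i j → signless (cone X) i j ≡ bordered (coned X) i j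
signless-cone {n} X zero zero = trans (+-identityʳ (1 * deg (cone X) zero)) (trans (*-identityˡ (deg (cone X) zero))
  (trans (sum-const n 1) (*-identityʳ n)))
signless-cone X zero    (suc j) = refl
signless-cone X (suc i) zero    = refl
signless-cone X (suc i) (suc j) = alg (𝟙 i j) (deg X i) (bit (X i j))
  where
  alg : ∀ d g b → d * suc g + b ≡ d + (d * g + b)
  alg = solve-∀

𝟙-diag : ∀ {n} (i : Fin n) → 𝟙 i i ≡ 1
𝟙-diag zero    = refl
𝟙-diag (suc i) = 𝟙-diag i

𝟙-off : ∀ {n} {i j : Fin n} → i ≢ j → 𝟙 i j ≡ 0
𝟙-off {i = zero}  {zero}  i≢j = ⊥-elim (i≢j refl)
𝟙-off {i = zero}  {suc j} i≢j = refl
𝟙-off {i = suc i} {zero}  i≢j = refl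
𝟙-off {i = suc i} {suc j} i≢j = 𝟙-off (i≢j ∘ cong suc)

𝟙-*-comm : ∀ {n} (f : Fin n → ℕ) (i j : Fin n) → 𝟙 i j * f i ≡ 𝟙 j i * f j
𝟙-*-comm f zero    zero    = refl
𝟙-*-comm f zero    (suc j) = refl
𝟙-*-comm f (suc i) zero    = refl
𝟙-*-comm f (suc i) (suc j) = 𝟙-*-comm (f ∘ suc) i j

coned-sym : ∀ {n} {X : Graph n} → IsSimple X → Symmetric (coned X)
coned-sym {X = X} (X-sym , _) i j = cong₂ _+_ (𝟙-sym i j) (cong₂ _+_ (𝟙-*-comm (deg X) i j) (cong bit (X-sym i j)))

sum-signless : ∀ {n} (X : Graph n) (f : Fin n → ℕ) i →
               sum (λ j → signless X i j * f j) ≡ deg X i * f i + sum (λ j → bit (X i j) * f j)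
sum-signless X f i = begin
  sum (λ j → (𝟙 i j * deg X i + bit (X i j)) * f j)
    ≡⟨ sum-cong-≗ (λ j → alg (𝟙 i j) (deg X i) (bit (X i j)) (f j)) ⟩
  sum (λ j → 𝟙 i j * (deg X i * f j) + bit (X i j) * f j)
    ≡⟨ ∑-distrib-+ (λ j → 𝟙 i j * (deg X i * f j)) (λ j → bit (X i j) * f j) ⟩
  sum (λ j → 𝟙 i j * (deg X i * f j)) + sum (λ j → bit (X i j) * f j)
    ≡⟨ cong (_+ sum (λ j → bit (X i j) * f j)) (sum-𝟙ˡ i (λ j → deg X i * f j)) ⟩
  deg X i * f i + sum (λ j → bit (X i j) * f j) ∎
  where
  open ≡-Reasoning
  alg : ∀ d g b f → (d * g + b) * f ≡ d * (g * f) + b * f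
  alg = solve-∀

sum-coned : ∀ {n} (X : Graph n) (f : Fin n → ℕ) i →
            sum (λ j → coned X i j * f j) ≡ f i + (deg X i * f i + sum (λ j → bit (X i j) * f j))
sum-coned X f i = trans (sum-cong-≗ (λ j → *-distribʳ-+ (f j) (𝟙 i j) (signless X i j)))
  (trans (∑-distrib-+ (λ j → 𝟙 i j * f j) (λ j → signless X i j * f j)) (cong₂ _+_ (sum-𝟙ˡ i f) (sum-signless X f i)))

Degrees₁₂ : ∀ {n} → Graph n → Set
Degrees₁₂ X = ∀ i → deg X i ≡ 1 ⊎ deg X i ≡ 2

-- Under `Degrees₁₂` this is the number of vertices of degree 1, in a form that is linear in the
-- degrees.
ends : ∀ {n} → Graph n → ℕ
ends X = sum (λ i → 2 ∸ deg X i)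

-- For a simple graph, a vertex of degree 1 and its neighbour then form a component K₂. Under
-- `Degrees₁₂` this excludes the paths with at least 3 vertices.
Matched : ∀ {n} → Graph n → Set
Matched X = ∀ i j → deg X i ≡ 1 → X i j ≡ true → deg X j ≡ 1

module Degrees {n : ℕ} (X : Graph n) (X-simple : IsSimple X) (X-degrees : Degrees₁₂ X) where

  private
    P = coned X
    e : Fin n → ℕ
    e i = 2 ∸ deg X i

  coned-row : ∀ i → sum (P i) ≡ 1 + 2 * deg X i
  coned-row i = trans (sum-cong-≗ λ j → sym (*-identityʳ (P i j))) (trans (sum-coned X (λ _ → 1) i)
    (trans (cong (λ z → 1 + (deg X i * 1 + z)) (sum-cong-≗ λ j → *-identityʳ (bit (X i j)))) (alg (deg X i))))
    where
    alg : ∀ d → 1 + (d * 1 + d) ≡ 1 + 2 * d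
    alg = solve-∀

  private
    row+ends : ∀ i → sum (P i) + 2 * e i ≡ 5
    row+ends i with coned-row i | X-degrees i
    ... | row | inj₁ d≡1 rewrite row | d≡1 = refl
    ... | row | inj₂ d≡2 rewrite row | d≡2 = refl

    3≤row : ∀ i → 3 ≤ sum (P i)
    3≤row i with coned-row i | X-degrees i
    ... | row | inj₁ d≡1 rewrite row | d≡1 = ≤-refl
    ... | row | inj₂ d≡2 rewrite row | d≡2 = m≤n+m 3 2

    row≤5 : ∀ i → sum (P i) ≤ 5
    row≤5 i = ≤-trans (m≤m+n (sum (P i)) (2 * e i)) (≤-reflexive (row+ends i))

  -- The columns of the symmetric `P` sum to 5, less 2 at an end: `1ᵀP = 5 · 1ᵀ - 2eᵀ`, applied to
  -- the vector `P^j 1`.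
  totalWalks-suc : ∀ j → totalWalks P (suc j) + 2 * sum (λ i → e i * walks P j i) ≡ 5 * totalWalks P j
  totalWalks-suc j = begin
    sum (λ i → sum (λ l → P i l * w l)) + 2 * sum (λ i → e i * w i)
      ≡⟨ cong₂ _+_ (∑-comm (λ i l → P i l * w l)) (*-distribˡ-sum 2 (λ i → e i * w i)) ⟩
    sum (λ l → sum (λ i → P i l * w l)) + sum (λ i → 2 * (e i * w i))
      ≡⟨ ∑-distrib-+ (λ l → sum (λ i → P i l * w l)) (λ i → 2 * (e i * w i)) ⟨
    sum (λ l → sum (λ i → P i l * w l) + 2 * (e l * w l)) ≡⟨ sum-cong-≗ col ⟩
    sum (λ l → 5 * w l) ≡⟨ *-distribˡ-sum 5 w ⟨
    5 * sum w ∎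
    where
    open ≡-Reasoning
    w = walks P j
    col : ∀ l → sum (λ i → P i l * w l) + 2 * (e l * w l) ≡ 5 * w l
    col l = begin
      sum (λ i → P i l * w l) + 2 * (e l * w l) ≡⟨ cong₂ _+_ (sym (*-distribʳ-sum (w l) (λ i → P i l))) (sym (*-assoc 2 (e l) (w l))) ⟩
      sum (λ i → P i l) * w l + 2 * e l * w l ≡⟨ *-distribʳ-+ (w l) (sum (λ i → P i l)) (2 * e l) ⟨
      (sum (λ i → P i l) + 2 * e l) * w l
        ≡⟨ cong (_* w l) (trans (cong (_+ 2 * e l) (sum-cong-≗ λ i → coned-sym X-simple i l)) (row+ends l)) ⟩
      5 * w l ∎

  3^j≤walks : ∀ j i → 3 ^ j ≤ walks P j i
  3^j≤walks zero    i = ≤-refl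
  3^j≤walks (suc j) i = begin
    3 * 3 ^ j                  ≤⟨ *-monoˡ-≤ (3 ^ j) (3≤row i) ⟩
    sum (P i) * 3 ^ j          ≡⟨ *-distribʳ-sum (3 ^ j) (P i) ⟩
    sum (λ l → P i l * 3 ^ j)  ≤⟨ sum-mono (λ l → *-monoʳ-≤ (P i l) (3^j≤walks j l)) ⟩
    walks P (suc j) i ∎
    where open ≤-Reasoning

  walks≤5^j : ∀ j i → walks P j i ≤ 5 ^ j
  walks≤5^j zero    i = ≤-refl
  walks≤5^j (suc j) i = begin
    walks P (suc j) i ≤⟨ sum-mono (λ l → *-monoʳ-≤ (P i l) (walks≤5^j j l)) ⟩
    sum (λ l → P i l * 5 ^ j)  ≡⟨ *-distribʳ-sum (5 ^ j) (P i) ⟨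
    sum (P i) * 5 ^ j          ≤⟨ *-monoˡ-≤ (5 ^ j) (row≤5 i) ⟩
    5 * 5 ^ j                  ∎
    where open ≤-Reasoning

  trace≤ : ∀ k → trace (mpow P k) ≤ n * 5 ^ k
  trace≤ k = begin
    trace (mpow P k)          ≤⟨ sum-mono (λ i → ≤-trans (entry≤sum i (mpow P k i)) (≤-reflexive (mpow-row k i))) ⟩
    sum (walks P k)           ≤⟨ sum-mono (walks≤5^j k) ⟩
    sum {n} (λ _ → 5 ^ k)     ≡⟨ sum-const n (5 ^ k) ⟩
    n * 5 ^ k                 ∎
    where
    open ≤-Reasoning
    entry≤sum : ∀ {m} (i : Fin m) (f : Fin m → ℕ) → f i ≤ sum f
    entry≤sum zero    f = m≤m+n (f zero) _
    entry≤sum (suc i) f = ≤-trans (entry≤sum i (f ∘ suc)) (m≤n+m _ (f zero))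
    mpow-row : ∀ k i → sum (mpow P k i) ≡ walks P k i
    mpow-row zero    i = trans (sum-cong-≗ λ j → sym (*-identityʳ (𝟙 i j))) (sum-𝟙ˡ i (λ _ → 1))
    mpow-row (suc k) i = trans (∑-comm (λ j l → P i l * mpow P k l j))
      (sum-cong-≗ λ l → trans (sym (*-distribˡ-sum (P i l) (mpow P k l))) (cong (P i l *_) (mpow-row k l)))

  endWalks≥ : ∀ j → ends X * 3 ^ j ≤ sum (λ i → e i * walks P j i)
  endWalks≥ j = ≤-trans (≤-reflexive (*-distribʳ-sum (3 ^ j) e)) (sum-mono λ i → *-monoʳ-≤ (e i) (3^j≤walks j i))

  -- A walk from an end stays in its K₂, where both rows of `P` sum to 3. So the lower bound
  -- `endWalks≥` is attained.
  matched⇒endWalks : Matched X → ∀ j → sum (λ i → e i * walks P j i) ≡ ends X * 3 ^ j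
  matched⇒endWalks matched j = trans (sum-cong-≗ entry) (sym (*-distribʳ-sum (3 ^ j) e))
    where
    walks-end : ∀ j i → deg X i ≡ 1 → walks P j i ≡ 3 ^ j
    walks-end zero    i d≡1 = refl
    walks-end (suc j) i d≡1 = begin
      walks P (suc j) i ≡⟨ sum-coned X (walks P j) i ⟩
      walks P j i + (deg X i * walks P j i + sum (λ l → bit (X i l) * walks P j l))
        ≡⟨ cong₂ (λ x y → x + (deg X i * x + y)) (walks-end j i d≡1) (trans (sum-cong-≗ nbr) (sym (*-distribʳ-sum (3 ^ j) (λ l → bit (X i l))))) ⟩
      3 ^ j + (deg X i * 3 ^ j + deg X i * 3 ^ j) ≡⟨ cong (λ d → 3 ^ j + (d * 3 ^ j + d * 3 ^ j)) d≡1 ⟩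
      3 ^ j + (1 * 3 ^ j + 1 * 3 ^ j) ≡⟨ alg (3 ^ j) ⟩
      3 * 3 ^ j ∎
      where
      open ≡-Reasoning
      alg : ∀ x → x + (1 * x + 1 * x) ≡ 3 * x
      alg = solve-∀
      nbr : ∀ l → bit (X i l) * walks P j l ≡ bit (X i l) * 3 ^ j
      nbr l with X i l in Xil
      ... | true  = cong (1 *_) (walks-end j l (matched i l d≡1 Xil))
      ... | false = refl
    entry : ∀ i → e i * walks P j i ≡ e i * 3 ^ j
    entry i with X-degrees i
    ... | inj₁ d≡1 = cong (e i *_) (walks-end j i d≡1)
    ... | inj₂ d≡2 rewrite d≡2 = refl

  -- The row of the neighbour sums to 5 instead of 3, so at least `9 + 2` walks of length 2 start at
  -- this end.
  unmatched⇒endWalks : ∀ i j → deg X i ≡ 1 → X i j ≡ true → deg X j ≡ 2 → ends X * 9 + 2 ≤ sum (λ i → e i * walks P 2 i)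
  unmatched⇒endWalks i₀ j₀ d≡1 Xij d≡2 = begin
    ends X * 9 + 2 ≡⟨ cong₂ _+_ (*-distribʳ-sum 9 e) (sym (sum-𝟙ˡ i₀ (λ _ → 2))) ⟩
    sum (λ i → e i * 9) + sum (λ i → 𝟙 i₀ i * 2) ≡⟨ ∑-distrib-+ (λ i → e i * 9) (λ i → 𝟙 i₀ i * 2) ⟨
    sum (λ i → e i * 9 + 𝟙 i₀ i * 2) ≤⟨ sum-mono entry ⟩
    sum (λ i → e i * walks P 2 i) ∎
    where
    open ≤-Reasoning
    walks₁ : ∀ l → 3 + 𝟙 j₀ l * 2 ≤ walks P 1 l
    walks₁ l with j₀ ≟ᶠ l
    ... | no j₀≢l rewrite 𝟙-off j₀≢l = 3^j≤walks 1 l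
    ... | yes refl rewrite 𝟙-diag j₀ = ≤-reflexive (sym (trans (sum-cong-≗ (λ j → *-identityʳ (P j₀ j))) (trans (coned-row j₀) (cong (λ d → 1 + 2 * d) d≡2))))
    walks₂ : 11 ≤ walks P 2 i₀
    walks₂ = begin
      11                                        ≤⟨ +-mono-≤ {9} (≤-reflexive (sym (trans (cong (_* 3) (coned-row i₀)) (cong (λ d → (1 + 2 * d) * 3) d≡1)))) (*-monoˡ-≤ 2 edge) ⟩
      sum (P i₀) * 3 + P i₀ j₀ * 2              ≡⟨ cong₂ _+_ (*-distribʳ-sum 3 (P i₀)) (sym (sum-𝟙ˡ j₀ (λ l → P i₀ l * 2))) ⟩
      sum (λ l → P i₀ l * 3) + sum (λ l → 𝟙 j₀ l * (P i₀ l * 2)) ≡⟨ ∑-distrib-+ (λ l → P i₀ l * 3) (λ l → 𝟙 j₀ l * (P i₀ l * 2)) ⟨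
      sum (λ l → P i₀ l * 3 + 𝟙 j₀ l * (P i₀ l * 2)) ≡⟨ sum-cong-≗ (λ l → alg (P i₀ l) (𝟙 j₀ l)) ⟩
      sum (λ l → P i₀ l * (3 + 𝟙 j₀ l * 2)) ≤⟨ sum-mono (λ l → *-monoʳ-≤ (P i₀ l) (walks₁ l)) ⟩
      walks P 2 i₀ ∎
      where
      edge : 1 ≤ P i₀ j₀
      edge rewrite Xij = ≤-trans (m≤n+m 1 (𝟙 i₀ j₀ * deg X i₀)) (m≤n+m _ (𝟙 i₀ j₀))
      alg : ∀ p d → p * 3 + d * (p * 2) ≡ p * (3 + d * 2)
      alg = solve-∀
    entry : ∀ i → e i * 9 + 𝟙 i₀ i * 2 ≤ e i * walks P 2 i
    entry i with i₀ ≟ᶠ i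
    ... | no i₀≢i rewrite 𝟙-off i₀≢i | +-identityʳ (e i * 9) = *-monoʳ-≤ (e i) (3^j≤walks 2 i)
    ... | yes refl = ≤-trans (≤-reflexive (cong₂ (λ a b → a * 9 + b * 2) e≡1 (𝟙-diag i₀)))
            (≤-trans walks₂ (≤-reflexive (sym (trans (cong (_* walks P 2 i₀) e≡1) (*-identityˡ (walks P 2 i₀))))))
      where
      e≡1 : e i₀ ≡ 1
      e≡1 = cong (2 ∸_) d≡1

module Compare {n : ℕ} (X Y : Graph n) (X-simple : IsSimple X) (Y-simple : IsSimple Y)
               (X-degrees : Degrees₁₂ X) (Y-degrees : Degrees₁₂ Y)
               (Y-matched : Matched Y) (ends≡ : ends X ≡ ends Y) where

  private
    module X = Degrees X X-simple X-degrees
    module Y = Degrees Y Y-simple Y-degrees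
    μX = totalWalks (coned X)
    μY = totalWalks (coned Y)

    -- Both graphs obey the recursion `totalWalks-suc`. In `Y` the end walks have the least possible
    -- number, and the excess `c` of those in `X` is subtracted twice.
    step : ∀ j {c} → ends X * 3 ^ j + c ≤ sum (λ i → (2 ∸ deg X i) * walks (coned X) j i) → μX j ≤ μY j → μX (suc j) + 2 * c ≤ μY (suc j)
    step j {c} endWalks μ≤ = +-cancelʳ-≤ (2 * (ends X * 3 ^ j)) _ _ (begin
      μX (suc j) + 2 * c + 2 * (ends X * 3 ^ j) ≡⟨ alg (μX (suc j)) c (ends X * 3 ^ j) ⟩
      μX (suc j) + 2 * (ends X * 3 ^ j + c) ≤⟨ +-monoʳ-≤ (μX (suc j)) (*-monoʳ-≤ 2 endWalks) ⟩
      μX (suc j) + 2 * sum (λ i → (2 ∸ deg X i) * walks (coned X) j i) ≡⟨ X.totalWalks-suc j ⟩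
      5 * μX j ≤⟨ *-monoʳ-≤ 5 μ≤ ⟩
      5 * μY j ≡⟨ Y.totalWalks-suc j ⟨
      μY (suc j) + 2 * sum (λ i → (2 ∸ deg Y i) * walks (coned Y) j i)
        ≡⟨ cong (λ z → μY (suc j) + 2 * z) (trans (Y.matched⇒endWalks Y-matched j) (cong (_* 3 ^ j) (sym ends≡))) ⟩
      μY (suc j) + 2 * (ends X * 3 ^ j) ∎)
      where
      open ≤-Reasoning
      alg : ∀ m c x → m + 2 * c + 2 * x ≡ m + 2 * (x + c)
      alg = solve-∀

  totalWalks-≤ : ∀ j → μX j ≤ μY j
  totalWalks-≤ zero    = ≤-refl
  totalWalks-≤ (suc j) = ≤-trans (m≤m+n (μX (suc j)) (2 * 0))
    (step j {0} (≤-trans (≤-reflexive (+-identityʳ _)) (X.endWalks≥ j)) (totalWalks-≤ j))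

  -- An end joined to a vertex of degree 2 loses at least 4 walks of length 3, which costs 4 n⁵ of the
  -- trace of the tenth power, more than the contribution of the walks that avoid the apex.
  traces⇒matched : 51 ≤ n → trace (mpow (bordered (coned X)) 10) ≡ trace (mpow (bordered (coned Y)) 10) → Matched X
  traces⇒matched 51≤n tr≡ i j d≡1 Xij with X-degrees j
  ... | inj₁ dⱼ≡1 = dⱼ≡1
  ... | inj₂ dⱼ≡2 = ⊥-elim (<-irrefl refl (begin-strict
    -- The gap yields `4 * n ^ (k - 5) ≤ n * 5 ^ k`; at `n = 51` the exponent `k = 10` is the least
    -- one for which this fails.
    5 ^ 10       <⟨ ≤ᵇ⇒≤ (suc (5 ^ 10)) (4 * 51 ^ 4) tt ⟩
    4 * 51 ^ 4   ≤⟨ *-monoʳ-≤ 4 (^-monoˡ-≤ 4 51≤n) ⟩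
    4 * n ^ 4    ≤⟨ *-cancelˡ-≤ n {{>-nonZero (≤-trans (s≤s z≤n) 51≤n)}} (≤-trans (≤-reflexive (alg n (n ^ 4))) (≤-trans gap (X.trace≤ 10))) ⟩
    5 ^ 10 ∎))
    where
    open ≤-Reasoning
    alg : ∀ n x → n * (4 * x) ≡ 4 * (n * x)
    alg = solve-∀
    gap : 4 * n ^ 5 ≤ trace (mpow (coned X) 10)
    gap = trace-bordered-gap (coned X) (coned Y) (coned-sym X-simple) (coned-sym Y-simple) totalWalks-≤
      (step 2 (X.unmatched⇒endWalks i j d≡1 Xij dⱼ≡2) (totalWalks-≤ 2)) 5 tr≡

-- Two matched graphs with equally many ends bound each other's walk counts, so
-- `trace-bordered-mono` applies in both directions.
coned-traces : ∀ {n} (X Y : Graph n) → IsSimple X → IsSimple Y → Degrees₁₂ X → Degrees₁₂ Y → Matched X → Matched Y → ends X ≡ ends Y →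
  (∀ k → trace (mpow (bordered (coned X)) k) ≡ trace (mpow (bordered (coned Y)) k)) →
  ∀ k → trace (mpow (coned X) k) ≡ trace (mpow (coned Y) k)
coned-traces X Y X-simple Y-simple X-deg Y-deg X-mat Y-mat ends≡ tr≡ k = ≤-antisym
  (trace-bordered-mono (coned Y) (coned X) (coned-sym Y-simple) (coned-sym X-simple)
    (Compare.totalWalks-≤ Y X Y-simple X-simple Y-deg X-deg X-mat (sym ends≡)) k (sym (tr≡ k)))
  (trace-bordered-mono (coned X) (coned Y) (coned-sym X-simple) (coned-sym Y-simple)
    (Compare.totalWalks-≤ X Y X-simple Y-simple X-deg Y-deg Y-mat ends≡) k (tr≡ k))

-- The spectrum determines the traces of the powers of the signless Laplacian

module Cospectral where

  open Determinants
  open import Data.Integer as ℤ using (ℤ; 0ℤ; 1ℤ) renaming (+_ to pos)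
  import Data.Integer.Properties as ℤ
  import Algebra.Properties.Semiring.Sum ℤ.+-*-semiring as ℤΣ

  sum-pos : ∀ {n} (f : Fin n → ℕ) → ℤΣ.sum (λ i → pos (f i)) ≡ pos (sum f)
  sum-pos {zero}  f = refl
  sum-pos {suc n} f = trans (cong (λ z → pos (f zero) ℤ.+ z) (sum-pos (f ∘ suc))) (sym (ℤ.pos-+ (f zero) (sum (f ∘ suc))))

  b2z-bit : ∀ b → b2z b ≡ pos (bit b)
  b2z-bit true  = refl
  b2z-bit false = refl

  degree-deg : ∀ {n} (G : Graph n) i → degree G i ≡ pos (deg G i)
  degree-deg {n} G i = trans (sumFin-sum n (λ j → b2z (G i j))) (trans (ℤΣ.sum-cong-≗ λ j → b2z-bit (G i j)) (sum-pos (λ j → bit (G i j))))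

  Q-signless : ∀ {n} (G : Graph n) i j → Q G i j ≡ pos (signless G i j)
  Q-signless G i j with i ≟ᶠ j
  ... | yes refl = trans (cong₂ ℤ._+_ (degree-deg G i) (b2z-bit (G i i))) (trans (sym (ℤ.pos-+ (deg G i) (bit (G i i))))
    (cong (λ d → pos (d + bit (G i i))) (sym (trans (cong (_* deg G i) (𝟙-diag i)) (*-identityˡ (deg G i))))))
  ... | no i≢j   = trans (b2z-bit (G i j)) (cong (λ d → pos (d * deg G i + bit (G i j))) (sym (𝟙-off i≢j)))

  δ-if : ∀ {n} (i j : Fin n) x → (if ⌊ i ≟ᶠ j ⌋ then x else 0ℤ) ≡ δ i j ℤ.* x
  δ-if i j x with i ≟ᶠ j
  ... | yes refl = trans (sym (ℤ.*-identityˡ x)) (cong (ℤ._* x) (sym (δ-diag i)))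
  ... | no i≢j   = sym (cong (ℤ._* x) (δ-off i j i≢j))

  posMat : ∀ {n} → ℕMat n → Mat n n
  posMat A i j = pos (A i j)

  charQ-charpoly : ∀ {n} (G : Graph n) x → charQ G x ≡ charpoly (posMat (signless G)) x 1ℤ
  charQ-charpoly G x = det-cong λ i j → cong₂ ℤ._+_ (δ-if i j x)
    (trans (cong ℤ.-_ (Q-signless G i j)) (sym (ℤ.*-identityʳ (ℤ.- pos (signless G i j)))))

  δ-𝟙 : ∀ {n} (i j : Fin n) → δ i j ≡ pos (𝟙 i j)
  δ-𝟙 zero    zero    = refl
  δ-𝟙 zero    (suc j) = refl
  δ-𝟙 (suc i) zero    = refl
  δ-𝟙 (suc i) (suc j) = δ-𝟙 i j

  pow-mpow : ∀ {n} (A : ℕMat n) k → pow (posMat A) k ≗₂ posMat (mpow A k)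
  pow-mpow A zero    i j = δ-𝟙 i j
  pow-mpow A (suc k) i j = trans (ℤΣ.sum-cong-≗ λ l → trans (cong (ℤ._* pos (A l j)) (pow-mpow A k i l)) (sym (ℤ.pos-* (mpow A k i l) (A l j))))
    (trans (sum-pos (λ l → mpow A k i l * A l j)) (cong pos (sym (mpow-suc A k i j))))

  tr-trace : ∀ {n} (A : ℕMat n) k → tr (pow (posMat A) k) ≡ pos (trace (mpow A k))
  tr-trace A k = trans (ℤΣ.sum-cong-≗ λ i → pow-mpow A k i i) (sum-pos (λ i → mpow A k i i))

  cospectral⇒traces : ∀ {n} (H G : Graph n) → QCospectral H G → ∀ k → trace (mpow (signless H) k) ≡ trace (mpow (signless G) k)
  cospectral⇒traces H G H~G k = ℤ.+-injective (trans (sym (tr-trace (signless H) k)) (trans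
    (charpoly⇒traces (posMat (signless H)) (posMat (signless G)) (λ x → trans (sym (charQ-charpoly H x)) (trans (H~G x) (charQ-charpoly G x))) k)
    (tr-trace (signless G) k)))

open Cospectral using (cospectral⇒traces)

-- The degrees of a cospectral graph

sum-+-* : ∀ {n} (f g : Fin n → ℕ) c → sum f + c * sum g ≡ sum (λ i → f i + c * g i)
sum-+-* f g c = trans (cong (sum f +_) (*-distribˡ-sum c g)) (sym (∑-distrib-+ f (λ i → c * g i)))

sum-≤-≡ : ∀ {n} {f g : Fin n → ℕ} → (∀ i → f i ≤ g i) → sum g ≤ sum f → ∀ i → f i ≡ g i
sum-≤-≡ {suc n} {f} {g} f≤g g≤f = λ where
    zero    → ≤-antisym (f≤g zero) (+-cancelʳ-≤ (sum (f ∘ suc)) _ _ (≤-trans (+-monoʳ-≤ (g zero) (sum-mono (f≤g ∘ suc))) g≤f))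
    (suc i) → sum-≤-≡ (f≤g ∘ suc) (+-cancelˡ-≤ (f zero) _ _ (≤-trans (+-monoˡ-≤ (sum (g ∘ suc)) (f≤g zero)) g≤f)) i

bit-idem : ∀ b → bit b * bit b ≡ bit b
bit-idem true  = refl
bit-idem false = refl

bit≤1 : ∀ b → bit b ≤ 1
bit≤1 true  = ≤-refl
bit≤1 false = z≤n

powerSum : ∀ {n} → ℕ → Graph n → ℕ
powerSum k X = sum (λ i → deg X i ^ k)

-- A diagonal entry of the cube of the adjacency matrix: in a simple graph, twice the number of
-- triangles at `i`.
closed₃ : ∀ {n} → Graph n → Fin n → ℕ
closed₃ X i = sum (λ j → bit (X i j) * sum (λ k → bit (X j k) * bit (X k i)))

module _ {n : ℕ} (X : Graph n) (X-simple : IsSimple X) where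
  private
    S = signless X
    A : ℕMat n
    A i j = bit (X i j)
    A-sym : ∀ i j → A i j ≡ A j i
    A-sym i j = cong bit (proj₁ X-simple i j)
    A-diag : ∀ i → A i i ≡ 0
    A-diag i = cong bit (proj₂ X-simple i)
    d = deg X

    mpow₁ : ∀ i j → mpow S 1 i j ≡ 𝟙 i j * d i + A i j
    mpow₁ i j = sum-𝟙ʳ j (S i)

    mpow₁-diag : ∀ i → mpow S 1 i i ≡ d i
    mpow₁-diag i = trans (mpow₁ i i) (trans (cong₂ (λ x y → x * d i + y) (𝟙-diag i) (A-diag i)) (alg (d i)))
      where
      alg : ∀ x → 1 * x + 0 ≡ x
      alg = solve-∀

    A² : ℕMat n
    A² i j = sum (λ k → A i k * A k j)

    A²-diag : ∀ i → A² i i ≡ d i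
    A²-diag i = sum-cong-≗ λ k → trans (cong (A i k *_) (A-sym k i)) (bit-idem (X i k))

    A-Q : ∀ i j → sum (λ l → A i l * mpow S 1 l j) ≡ A i j * d j + A² i j
    A-Q i j = begin
      sum (λ l → A i l * mpow S 1 l j) ≡⟨ sum-cong-≗ (λ l → trans (cong (A i l *_) (mpow₁ l j)) (alg (A i l) (𝟙 l j) (d l) (A l j))) ⟩
      sum (λ l → A i l * d l * 𝟙 l j + A i l * A l j) ≡⟨ ∑-distrib-+ (λ l → A i l * d l * 𝟙 l j) (λ l → A i l * A l j) ⟩
      sum (λ l → A i l * d l * 𝟙 l j) + A² i j ≡⟨ cong (_+ A² i j) (sum-𝟙ʳ j (λ l → A i l * d l)) ⟩
      A i j * d j + A² i j ∎
      where
      open ≡-Reasoning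
      alg : ∀ a o x b → a * (o * x + b) ≡ a * x * o + a * b
      alg = solve-∀

    mpow₂ : ∀ i j → mpow S 2 i j ≡ d i * (𝟙 i j * d i + A i j) + (A i j * d j + A² i j)
    mpow₂ i j = trans (sum-signless X (λ l → mpow S 1 l j) i) (cong₂ (λ x y → d i * x + y) (mpow₁ i j) (A-Q i j))

    mpow₂-diag : ∀ i → mpow S 2 i i ≡ d i ^ 2 + d i
    mpow₂-diag i = trans (mpow₂ i i) (trans (cong₂ (λ x y → d i * (x * d i + y) + (y * d i + A² i i)) (𝟙-diag i) (A-diag i))
      (trans (cong (λ z → d i * (1 * d i + 0) + (0 * d i + z)) (A²-diag i)) (alg (d i))))
      where
      alg : ∀ x → x * (1 * x + 0) + (0 * x + x) ≡ x * (x * 1) + x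
      alg = solve-∀

    mpow₃-diag : ∀ i → mpow S 3 i i ≡ d i ^ 3 + 2 * d i ^ 2 + sum (λ j → A i j * d j) + closed₃ X i
    mpow₃-diag i = begin
      mpow S 3 i i ≡⟨ sum-signless X (λ l → mpow S 2 l i) i ⟩
      d i * mpow S 2 i i + sum (λ j → A i j * mpow S 2 j i)
        ≡⟨ cong₂ (λ x y → d i * x + y) (mpow₂-diag i) (trans (sum-cong-≗ entry)
             (trans (∑-distrib-+ (λ j → A i j * d j + A i j * d i) (λ j → A i j * A² j i))
               (cong (_+ closed₃ X i) (trans (∑-distrib-+ (λ j → A i j * d j) (λ j → A i j * d i))
                 (cong (sum (λ j → A i j * d j) +_) (sym (*-distribʳ-sum (d i) (A i)))))))) ⟩
      d i * (d i ^ 2 + d i) + (sum (λ j → A i j * d j) + d i * d i + closed₃ X i)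
        ≡⟨ alg (d i) (sum (λ j → A i j * d j)) (closed₃ X i) ⟩
      d i ^ 3 + 2 * d i ^ 2 + sum (λ j → A i j * d j) + closed₃ X i ∎
      where
      open ≡-Reasoning
      alg : ∀ x s t → x * (x * (x * 1) + x) + (s + x * x + t) ≡ x * (x * (x * 1)) + 2 * (x * (x * 1)) + s + t
      alg = solve-∀
      alg₀ : ∀ o a x y z → a * (x * (o * x + a) + (a * y + z)) ≡ a * o * (x * x) + (a * a * x + a * a * y) + a * z
      alg₀ = solve-∀
      loop : ∀ j → A i j * 𝟙 j i ≡ 0
      loop j with j ≟ᶠ i
      ... | yes refl = cong (_* 𝟙 j j) (A-diag j)
      ... | no j≢i   = trans (cong (A i j *_) (𝟙-off j≢i)) (*-zeroʳ (A i j))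
      entry : ∀ j → A i j * mpow S 2 j i ≡ A i j * d j + A i j * d i + A i j * A² j i
      entry j = trans (cong (A i j *_) (trans (mpow₂ j i) (cong (λ a → d j * (𝟙 j i * d j + a) + (a * d i + A² j i)) (A-sym j i))))
        (trans (alg₀ (𝟙 j i) (A i j) (d j) (d i) (A² j i))
          (cong₂ (λ x y → x * (d j * d j) + (y * d j + y * d i) + A i j * A² j i) (loop j) (bit-idem (X i j))))

  trace₁ : trace (mpow S 1) ≡ powerSum 1 X
  trace₁ = sum-cong-≗ λ i → trans (mpow₁-diag i) (sym (*-identityʳ (d i)))

  trace₂ : trace (mpow S 2) ≡ powerSum 2 X + powerSum 1 X
  trace₂ = trans (sum-cong-≗ λ i → trans (mpow₂-diag i) (cong (d i ^ 2 +_) (sym (*-identityʳ (d i)))))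
    (∑-distrib-+ (λ i → d i ^ 2) (λ i → d i ^ 1))

  -- The expansion of `tr (D + A)³`: the products with one factor `A` have trace 0, and each of the
  -- three with two factors `A` has trace `Σ d²`.
  trace₃ : trace (mpow S 3) ≡ powerSum 3 X + 3 * powerSum 2 X + sum (closed₃ X)
  trace₃ = begin
    trace (mpow S 3) ≡⟨ sum-cong-≗ mpow₃-diag ⟩
    sum (λ i → d i ^ 3 + 2 * d i ^ 2 + sum (λ j → A i j * d j) + closed₃ X i)
      ≡⟨ trans (∑-distrib-+ (λ i → d i ^ 3 + 2 * d i ^ 2 + sum (λ j → A i j * d j)) (closed₃ X))
           (cong (_+ sum (closed₃ X)) (trans (∑-distrib-+ (λ i → d i ^ 3 + 2 * d i ^ 2) (λ i → sum (λ j → A i j * d j)))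
             (cong₂ _+_ (sym (sum-+-* (λ i → d i ^ 3) (λ i → d i ^ 2) 2)) neighbours))) ⟩
    powerSum 3 X + 2 * powerSum 2 X + powerSum 2 X + sum (closed₃ X) ≡⟨ alg (powerSum 3 X) (powerSum 2 X) (sum (closed₃ X)) ⟩
    powerSum 3 X + 3 * powerSum 2 X + sum (closed₃ X) ∎
    where
    open ≡-Reasoning
    alg : ∀ x y t → x + 2 * y + y + t ≡ x + 3 * y + t
    alg = solve-∀
    neighbours : sum (λ i → sum (λ j → A i j * d j)) ≡ powerSum 2 X
    neighbours = trans (∑-comm (λ i j → A i j * d j)) (sum-cong-≗ λ j →
      trans (sym (*-distribʳ-sum (d j) (λ i → A i j))) (trans (cong (_* d j) (sum-cong-≗ λ i → A-sym i j)) (cong (d j *_) (sym (*-identityʳ (d j))))))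

  -- After the first step to `j`, the walk is determined by its third vertex, a neighbour of `i`
  -- other than `j`. That leaves at most `d i - 1` choices for each `j`.
  closed₃≤ : ∀ i → closed₃ X i + d i ≤ d i ^ 2
  closed₃≤ i = begin
    closed₃ X i + d i ≡⟨ ∑-distrib-+ (λ j → A i j * sum (λ k → A j k * A k i)) (A i) ⟨
    sum (λ j → A i j * sum (λ k → A j k * A k i) + A i j) ≤⟨ sum-mono through ⟩
    sum (λ j → A i j * d i) ≡⟨ *-distribʳ-sum (d i) (A i) ⟨
    d i * d i ≡⟨ cong (d i *_) (*-identityʳ (d i)) ⟨
    d i ^ 2 ∎
    where
    open ≤-Reasoning
    through : ∀ j → A i j * sum (λ k → A j k * A k i) + A i j ≤ A i j * d i
    through j with X i j in Xij
    ... | false = z≤n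
    ... | true  = begin
      1 * sum (λ k → A j k * A k i) + 1 ≡⟨ cong₂ _+_ (*-identityˡ _) (sym (sum-𝟙ˡ j (λ _ → 1))) ⟩
      sum (λ k → A j k * A k i) + sum (λ k → 𝟙 j k * 1) ≡⟨ ∑-distrib-+ (λ k → A j k * A k i) (λ k → 𝟙 j k * 1) ⟨
      sum (λ k → A j k * A k i + 𝟙 j k * 1) ≤⟨ sum-mono excludes ⟩
      d i ≡⟨ *-identityˡ (d i) ⟨
      1 * d i ∎
      where
      excludes : ∀ k → A j k * A k i + 𝟙 j k * 1 ≤ A i k
      excludes k with j ≟ᶠ k
      ... | yes refl rewrite A-diag j | 𝟙-diag j | Xij = ≤-refl
      ... | no j≢k = begin
        A j k * A k i + 𝟙 j k * 1 ≡⟨ cong (λ z → A j k * A k i + z * 1) (𝟙-off j≢k) ⟩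
        A j k * A k i + 0         ≡⟨ +-identityʳ _ ⟩
        A j k * A k i             ≤⟨ *-monoˡ-≤ (A k i) (bit≤1 (X j k)) ⟩
        1 * A k i                 ≡⟨ trans (*-identityˡ (A k i)) (A-sym k i) ⟩
        A i k ∎

base : ∀ {n} → Graph (suc n) → Graph n
base H i j = H (suc i) (suc j)

arcs : ∀ {n} → Graph n → ℕ
arcs X = sum (deg X)

-- The middle edge of the walk is an arc of the base and determines the walk. At the vertex of
-- maximal degree the quadratic bound `closed₃≤` would be too weak.
closed₃-zero≤ : ∀ {n} (H : Graph (suc n)) → H zero zero ≡ false → closed₃ H zero ≤ arcs (base H)
closed₃-zero≤ H H₀₀ rewrite H₀₀ = sum-mono λ j → begin
  bit (H zero (suc j)) * (bit (H (suc j) zero) * 0 + sum (λ k → bit (H (suc j) (suc k)) * bit (H (suc k) zero)))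
    ≤⟨ *-monoˡ-≤ _ (bit≤1 (H zero (suc j))) ⟩
  1 * (bit (H (suc j) zero) * 0 + sum (λ k → bit (H (suc j) (suc k)) * bit (H (suc k) zero)))
    ≡⟨ trans (*-identityˡ (bit (H (suc j) zero) * 0 + rest j)) (cong (_+ rest j) (*-zeroʳ (bit (H (suc j) zero)))) ⟩
  sum (λ k → bit (H (suc j) (suc k)) * bit (H (suc k) zero))
    ≤⟨ sum-mono (λ k → ≤-trans (*-monoʳ-≤ (bit (H (suc j) (suc k))) (bit≤1 (H (suc k) zero))) (≤-reflexive (*-identityʳ _))) ⟩
  deg (base H) j ∎
  where
  open ≤-Reasoning
  rest = λ j → sum (λ k → bit (H (suc j) (suc k)) * bit (H (suc k) zero))

cone-simple : ∀ {n} {Y : Graph n} → IsSimple Y → IsSimple (cone Y)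
cone-simple {Y = Y} (Y-sym , Y-irr) = symm , irr
  where
  symm : ∀ i j → cone Y i j ≡ cone Y j i
  symm zero    zero    = refl
  symm zero    (suc j) = refl
  symm (suc i) zero    = refl
  symm (suc i) (suc j) = Y-sym i j
  irr : ∀ i → cone Y i i ≡ false
  irr zero    = refl
  irr (suc i) = Y-irr i

-- Each arc of `Y` closes up with the apex, giving one closed walk for each of the three positions
-- of the apex. Triangles inside `Y` are dropped, as only a lower bound is wanted.
closed₃-cone : ∀ {n} (Y : Graph n) → IsSimple Y → 3 * arcs Y ≤ sum (closed₃ (cone Y))
closed₃-cone Y (Y-sym , _) = begin
  3 * arcs Y ≡⟨ alg (arcs Y) ⟩
  arcs Y + (arcs Y + arcs Y) ≡⟨ cong (arcs Y +_) (sym (∑-distrib-+ (deg Y) (deg Y))) ⟩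
  arcs Y + sum (λ i → deg Y i + deg Y i)
    ≤⟨ +-mono-≤ (≤-reflexive (sum-cong-≗ λ j → sym (trans (*-identityˡ _) (sum-cong-≗ λ k → *-identityʳ (bit (Y j k))))))
         (sum-mono λ i → +-mono-≤ (≤-reflexive (sym (trans (*-identityˡ _) (sum-cong-≗ λ k → trans (*-identityˡ _) (cong bit (Y-sym k i))))))
           (sum-mono λ j → ≤-trans (≤-reflexive (sym (*-identityʳ (bit (Y i j))))) (*-monoʳ-≤ (bit (Y i j)) (s≤s z≤n)))) ⟩
  sum (closed₃ (cone Y)) ∎
  where
  open ≤-Reasoning
  alg : ∀ x → 3 * x ≡ x + (x + x)
  alg = solve-∀

module ConeMoments {n : ℕ} (Y : Graph n) (Y-degrees : Degrees₁₂ Y) where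

  deg-apex : deg (cone Y) zero ≡ n
  deg-apex = trans (sum-const n 1) (*-identityʳ n)

  private
    -- The constants solve `2^k + c = 3^k = b`, since the vertices of `Y` have degree 2 or 3 in the
    -- cone. Hence 1, 5, 19 and 3, 9, 27 below.
    moment : ∀ k c b → (∀ m → m ≡ 1 ⊎ m ≡ 2 → suc m ^ k + c * (2 ∸ m) ≡ b) →
             powerSum k (cone Y) + c * ends Y ≡ n ^ k + n * b
    moment k c b pointwise = begin
      deg (cone Y) zero ^ k + sum (λ i → suc (deg Y i) ^ k) + c * ends Y ≡⟨ +-assoc (deg (cone Y) zero ^ k) _ _ ⟩
      deg (cone Y) zero ^ k + (sum (λ i → suc (deg Y i) ^ k) + c * ends Y)
        ≡⟨ cong₂ (λ x y → x ^ k + y) deg-apex (trans (sum-+-* (λ i → suc (deg Y i) ^ k) (λ i → 2 ∸ deg Y i) c)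
             (trans (sum-cong-≗ λ i → pointwise (deg Y i) (Y-degrees i)) (sum-const n b))) ⟩
      n ^ k + n * b ∎
      where open ≡-Reasoning

  moment₁ : powerSum 1 (cone Y) + 1 * ends Y ≡ n ^ 1 + n * 3
  moment₁ = moment 1 1 3 λ { _ (inj₁ refl) → refl ; _ (inj₂ refl) → refl }

  moment₂ : powerSum 2 (cone Y) + 5 * ends Y ≡ n ^ 2 + n * 9
  moment₂ = moment 2 5 9 λ { _ (inj₁ refl) → refl ; _ (inj₂ refl) → refl }

  moment₃ : powerSum 3 (cone Y) + 19 * ends Y ≡ n ^ 3 + n * 27
  moment₃ = moment 3 19 27 λ { _ (inj₁ refl) → refl ; _ (inj₂ refl) → refl }

  arcs+ends : arcs Y + ends Y ≡ n * 2
  arcs+ends = trans (sym (∑-distrib-+ (deg Y) (λ i → 2 ∸ deg Y i)))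
    (trans (sum-cong-≗ λ i → pointwise (deg Y i) (Y-degrees i)) (sum-const n 2))
    where
    pointwise : ∀ m → m ≡ 1 ⊎ m ≡ 2 → m + (2 ∸ m) ≡ 2
    pointwise _ (inj₁ refl) = refl
    pointwise _ (inj₂ refl) = refl

-- This is `(m - 2)(m - 3) ≥ 0`, which holds because no integer lies strictly between 2 and 3.
5m≤m²+6 : ∀ m → 5 * m ≤ m ^ 2 + 6
5m≤m²+6 0 = z≤n
5m≤m²+6 1 = ≤ᵇ⇒≤ 5 7 tt
5m≤m²+6 2 = ≤-refl
5m≤m²+6 3 = ≤-refl
5m≤m²+6 (suc (suc (suc (suc m)))) = ≤-trans (m≤m+n (5 * (4 + m)) (m * m + 3 * m + 2)) (≤-reflexive (alg m))
  where
  alg : ∀ m → 5 * (4 + m) + (m * m + 3 * m + 2) ≡ (4 + m) * ((4 + m) * 1) + 6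
  alg = solve-∀

5m≡m²+6 : ∀ m → 5 * m ≡ m ^ 2 + 6 → m ≡ 2 ⊎ m ≡ 3
5m≡m²+6 2 _ = inj₁ refl
5m≡m²+6 3 _ = inj₂ refl
5m≡m²+6 (suc (suc (suc (suc m)))) eq = ⊥-elim (m+1+n≢m (5 * (4 + m)) (trans (alg m) (sym eq)))
  where
  alg : ∀ m → 5 * (4 + m) + suc (m * m + 3 * m + 1) ≡ (4 + m) * ((4 + m) * 1) + 6
  alg = solve-∀

-- (m - 2)(m - 3)(D - m) ≥ 0 without subtraction
cubic-bound : ∀ D m → m ≤ D → m ^ 3 + (5 * D + 6) * m ^ 1 ≤ (D + 5) * m ^ 2 + 6 * D
cubic-bound D m m≤D with m≤n⇒∃[o]m+o≡n m≤D
... | c , refl = begin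
  m ^ 3 + (5 * (m + c) + 6) * m ^ 1 ≡⟨ alg₁ m c ⟩
  m ^ 3 + 5 * m ^ 2 + 6 * m + c * (5 * m) ≤⟨ +-monoʳ-≤ (m ^ 3 + 5 * m ^ 2 + 6 * m) (*-monoʳ-≤ c (5m≤m²+6 m)) ⟩
  m ^ 3 + 5 * m ^ 2 + 6 * m + c * (m ^ 2 + 6) ≡⟨ alg₂ m c ⟩
  (m + c + 5) * m ^ 2 + 6 * (m + c) ∎
  where
  open ≤-Reasoning
  alg₁ : ∀ m c → m * (m * (m * 1)) + (5 * (m + c) + 6) * (m * 1) ≡ m * (m * (m * 1)) + 5 * (m * (m * 1)) + 6 * m + c * (5 * m)
  alg₁ = solve-∀
  alg₂ : ∀ m c → m * (m * (m * 1)) + 5 * (m * (m * 1)) + 6 * m + c * (m * (m * 1) + 6) ≡ (m + c + 5) * (m * (m * 1)) + 6 * (m + c)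
  alg₂ = solve-∀

-- N is the number of vertices other than the one of maximal degree D, sₖ is the sum of the k-th powers
-- of their degrees, E = 2q, and τ, τ′ count the closed 3-walks of H and G.
full-degree : ∀ N D E s₁ s₂ s₃ τ τ′ → 51 ≤ N → D ≤ N →
  D ^ 1 + s₁ + 1 * E ≡ N ^ 1 + N * 3 →
  D ^ 2 + s₂ + 5 * E ≡ N ^ 2 + N * 9 →
  D ^ 3 + s₃ + τ + 19 * E ≡ N ^ 3 + N * 27 + τ′ →
  6 * N ≤ τ′ + 3 * E →
  τ + D ≤ s₂ →
  s₃ + (5 * D + 6) * s₁ ≤ (D + 5) * s₂ + N * (6 * D) → D ≡ N
full-degree M D E s₁ s₂ s₃ τ τ′ 51≤N D≤N e₁ e₂ e₃ τ′≥ τ≤ cubic = decide (M ∸ D) (sym (m+[n∸m]≡n D≤N))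
  where
  open ≤-Reasoning
  L R : ℕ
  L = M ^ 3 + 33 * M + D + (5 * D + 6) * (4 * M) + (D + 6) * (D ^ 2 + 5 * E)
  R = D ^ 3 + 22 * E + (D + 6) * (M ^ 2 + 9 * M) + 6 * M * D + (5 * D + 6) * (E + D)
  -- Eliminates the triangle counts: `τ′` by its lower bound, `τ` by its upper bound.
  cubes : M ^ 3 + 33 * M + D ≤ D ^ 3 + s₃ + s₂ + 22 * E
  cubes = begin
    M ^ 3 + 33 * M + D ≡⟨ a₁ (M ^ 3) M D ⟩
    M ^ 3 + M * 27 + 6 * M + D ≤⟨ +-monoˡ-≤ D (+-monoʳ-≤ (M ^ 3 + M * 27) τ′≥) ⟩
    M ^ 3 + M * 27 + (τ′ + 3 * E) + D ≡⟨ a₂ (M ^ 3 + M * 27) τ′ E D ⟩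
    M ^ 3 + M * 27 + τ′ + 3 * E + D ≡⟨ cong (λ z → z + 3 * E + D) e₃ ⟨
    D ^ 3 + s₃ + τ + 19 * E + 3 * E + D ≡⟨ a₃ (D ^ 3) s₃ τ E D ⟩
    D ^ 3 + s₃ + (τ + D) + 22 * E ≤⟨ +-monoˡ-≤ (22 * E) (+-monoʳ-≤ (D ^ 3 + s₃) τ≤) ⟩
    D ^ 3 + s₃ + s₂ + 22 * E ∎
    where
    a₁ : ∀ c m d → c + 33 * m + d ≡ c + m * 27 + 6 * m + d
    a₁ = solve-∀
    a₂ : ∀ c t e d → c + (t + 3 * e) + d ≡ c + t + 3 * e + d
    a₂ = solve-∀
    a₃ : ∀ c x t e d → c + x + t + 19 * e + 3 * e + d ≡ c + x + (t + d) + 22 * e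
    a₃ = solve-∀
  -- Adds `cubes`, `cubic`, `5 * D + 6` times `e₁` and `D + 6` times `e₂`. The multipliers are
  -- chosen to cancel `s₁`, `s₂` and `s₃`: `D + 6` is the `D + 5` of `cubic` plus the 1 of `cubes`.
  L≤R : L ≤ R
  L≤R = +-cancelʳ-≤ (s₃ + (5 * D + 6) * s₁ + (D + 6) * s₂) L R (begin
    L + (s₃ + (5 * D + 6) * s₁ + (D + 6) * s₂)
      ≡⟨ b₁ (M ^ 3) M D E (D ^ 2) s₁ s₂ s₃ ⟩
    (M ^ 3 + 33 * M + D) + (s₃ + (5 * D + 6) * s₁) + (5 * D + 6) * (M ^ 1 + M * 3) + (D + 6) * (D ^ 2 + s₂ + 5 * E)
      ≤⟨ +-mono-≤ (+-monoˡ-≤ ((5 * D + 6) * (M ^ 1 + M * 3)) (+-mono-≤ cubes cubic)) (*-monoʳ-≤ (D + 6) (≤-reflexive e₂)) ⟩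
    (D ^ 3 + s₃ + s₂ + 22 * E) + ((D + 5) * s₂ + M * (6 * D)) + (5 * D + 6) * (M ^ 1 + M * 3) + (D + 6) * (M ^ 2 + M * 9)
      ≡⟨ cong (λ z → (D ^ 3 + s₃ + s₂ + 22 * E) + ((D + 5) * s₂ + M * (6 * D)) + (5 * D + 6) * z + (D + 6) * (M ^ 2 + M * 9)) e₁ ⟨
    (D ^ 3 + s₃ + s₂ + 22 * E) + ((D + 5) * s₂ + M * (6 * D)) + (5 * D + 6) * (D ^ 1 + s₁ + 1 * E) + (D + 6) * (M ^ 2 + M * 9)
      ≡⟨ b₂ (D ^ 3) (M ^ 2) M D E s₁ s₂ s₃ ⟩
    R + (s₃ + (5 * D + 6) * s₁ + (D + 6) * s₂) ∎)
    where
    b₁ : ∀ c m d e q x y z → c + 33 * m + d + (5 * d + 6) * (4 * m) + (d + 6) * (q + 5 * e) + (z + (5 * d + 6) * x + (d + 6) * y)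
      ≡ (c + 33 * m + d) + (z + (5 * d + 6) * x) + (5 * d + 6) * (m * 1 + m * 3) + (d + 6) * (q + y + 5 * e)
    b₁ = solve-∀
    b₂ : ∀ c q m d e x y z → (c + z + y + 22 * e) + ((d + 5) * y + m * (6 * d)) + (5 * d + 6) * (d * 1 + x + 1 * e) + (d + 6) * (q + m * 9)
      ≡ c + 22 * e + (d + 6) * (q + 9 * m) + 6 * m * d + (5 * d + 6) * (e + d) + (z + (5 * d + 6) * x + (d + 6) * y)
    b₂ = solve-∀
  -- For `M = D + s` the difference `R - L` is `s(6M + D) + 5D - sM² - 3M - 2E`. If `s ≥ 1`, its
  -- positive part is at most `12sM`, which is less than `sM²`.
  final : ∀ s → M ≡ D + s → s * (M * M) + (3 * M + 2 * E) ≤ s * (6 * M + D) + 5 * D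
  final s M≡ = +-cancelˡ-≤ R _ _ (begin
    R + (s * (M * M) + (3 * M + 2 * E)) ≡⟨ c M≡ ⟩
    L + (s * (6 * M + D) + 5 * D) ≤⟨ +-monoˡ-≤ (s * (6 * M + D) + 5 * D) L≤R ⟩
    R + (s * (6 * M + D) + 5 * D) ∎)
    where
    c₀ : ∀ d s e → d * (d * (d * 1)) + 22 * e + (d + 6) * ((d + s) * ((d + s) * 1) + 9 * (d + s)) + 6 * (d + s) * d + (5 * d + 6) * (e + d)
          + (s * ((d + s) * (d + s)) + (3 * (d + s) + 2 * e))
      ≡ (d + s) * ((d + s) * ((d + s) * 1)) + 33 * (d + s) + d + (5 * d + 6) * (4 * (d + s)) + (d + 6) * (d * (d * 1) + 5 * e)
          + (s * (6 * (d + s) + d) + 5 * d)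
    c₀ = solve-∀
    c : ∀ {m} → m ≡ D + s → D ^ 3 + 22 * E + (D + 6) * (m ^ 2 + 9 * m) + 6 * m * D + (5 * D + 6) * (E + D) + (s * (m * m) + (3 * m + 2 * E))
          ≡ m ^ 3 + 33 * m + D + (5 * D + 6) * (4 * m) + (D + 6) * (D ^ 2 + 5 * E) + (s * (6 * m + D) + 5 * D)
    c refl = c₀ D s E
  decide : ∀ s → M ≡ D + s → D ≡ M
  decide zero    M≡ = sym (trans M≡ (+-identityʳ D))
  decide (suc t) M≡ = ⊥-elim (bound (suc t) (s≤s z≤n) (final (suc t) M≡))
    where
    alg₀ : ∀ s m → s * (6 * m + m) + s * (5 * m) ≡ s * (12 * m)
    alg₀ = solve-∀
    bound : ∀ s → 1 ≤ s → s * (M * M) + (3 * M + 2 * E) ≤ s * (6 * M + D) + 5 * D → ⊥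
    bound s 1≤s ineq = <-irrefl refl (begin-strict
      s * (12 * M)                    <⟨ *-monoʳ-< s {{>-nonZero 1≤s}} (*-monoˡ-< M {{>-nonZero (≤-trans (s≤s z≤n) 51≤N)}} {12} {51} (≤ᵇ⇒≤ 13 51 tt)) ⟩
      s * (51 * M)                    ≤⟨ *-monoʳ-≤ s (*-monoˡ-≤ M 51≤N) ⟩
      s * (M * M)                     ≤⟨ m≤m+n (s * (M * M)) (3 * M + 2 * E) ⟩
      s * (M * M) + (3 * M + 2 * E)   ≤⟨ ineq ⟩
      s * (6 * M + D) + 5 * D         ≤⟨ +-mono-≤ (*-monoʳ-≤ s (+-monoʳ-≤ (6 * M) D≤N)) (≤-trans (*-monoʳ-≤ 5 D≤N) (≤-trans (≤-reflexive (sym (*-identityˡ (5 * M)))) (*-monoˡ-≤ (5 * M) 1≤s))) ⟩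
      s * (6 * M + M) + s * (5 * M)   ≡⟨ alg₀ s M ⟩
      s * (12 * M) ∎)

module Structure {n : ℕ} (H : Graph (suc n)) (H-simple : IsSimple H) (Y : Graph n) (Y-simple : IsSimple Y)
                 (Y-degrees : Degrees₁₂ Y) (51≤n : 51 ≤ n)
                 (zero-max : ∀ i → deg H (suc i) ≤ deg H zero)
                 (tr≡ : ∀ k → trace (mpow (signless H) k) ≡ trace (mpow (signless (cone Y)) k)) where

  private
    module Y = ConeMoments Y Y-degrees
    G = cone Y
    E = ends Y
    D = deg H zero
    d : Fin n → ℕ
    d i = deg H (suc i)
    s : ℕ → ℕ
    s k = sum (λ i → d i ^ k)

    p₁ : powerSum 1 H ≡ powerSum 1 G
    p₁ = trans (sym (trace₁ H H-simple)) (trans (tr≡ 1) (trace₁ G (cone-simple Y-simple)))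

    p₂ : powerSum 2 H ≡ powerSum 2 G
    p₂ = +-cancelʳ-≡ (powerSum 1 H) (powerSum 2 H) (powerSum 2 G) (trans (sym (trace₂ H H-simple)) (trans (tr≡ 2)
      (trans (trace₂ G (cone-simple Y-simple)) (cong (powerSum 2 G +_) (sym p₁)))))

    p₃ : powerSum 3 H + sum (closed₃ H) ≡ powerSum 3 G + sum (closed₃ G)
    p₃ = +-cancelʳ-≡ (3 * powerSum 2 H) (powerSum 3 H + sum (closed₃ H)) (powerSum 3 G + sum (closed₃ G)) (trans (alg (powerSum 3 H) (sum (closed₃ H)) (powerSum 2 H)) (trans (sym (trace₃ H H-simple)) (trans (tr≡ 3)
      (trans (trace₃ G (cone-simple Y-simple)) (trans (sym (alg (powerSum 3 G) (sum (closed₃ G)) (powerSum 2 G))) (cong (λ z → powerSum 3 G + sum (closed₃ G) + 3 * z) (sym p₂)))))))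
      where
      alg : ∀ x t y → x + t + 3 * y ≡ x + 3 * y + t
      alg = solve-∀

    e₁ : D ^ 1 + s 1 + 1 * E ≡ n ^ 1 + n * 3
    e₁ = trans (cong (_+ 1 * E) p₁) Y.moment₁

    e₂ : D ^ 2 + s 2 + 5 * E ≡ n ^ 2 + n * 9
    e₂ = trans (cong (_+ 5 * E) p₂) Y.moment₂

    e₃ : D ^ 3 + s 3 + sum (closed₃ H) + 19 * E ≡ n ^ 3 + n * 27 + sum (closed₃ G)
    e₃ = trans (cong (_+ 19 * E) p₃) (trans (alg (powerSum 3 G) (sum (closed₃ G)) (19 * E)) (cong (_+ sum (closed₃ G)) Y.moment₃))
      where
      alg : ∀ x t y → x + t + y ≡ x + y + t
      alg = solve-∀

    H₀₀ : bit (H zero zero) ≡ 0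
    H₀₀ = cong bit (proj₂ H-simple zero)

    D≡ : D ≡ sum (λ i → bit (H zero (suc i)))
    D≡ = cong (_+ sum (λ i → bit (H zero (suc i)))) H₀₀

    D≤n : D ≤ n
    D≤n = ≤-trans (≤-reflexive D≡) (≤-trans (sum-mono (λ i → bit≤1 (H zero (suc i)))) (≤-reflexive (trans (sum-const n 1) (*-identityʳ n))))

    τ′≥ : 6 * n ≤ sum (closed₃ G) + 3 * E
    τ′≥ = ≤-trans (≤-reflexive (trans (alg n) (trans (cong (3 *_) (sym Y.arcs+ends)) (*-distribˡ-+ 3 (arcs Y) E)))) (+-monoˡ-≤ (3 * E) (closed₃-cone Y Y-simple))
      where
      alg : ∀ n → 6 * n ≡ 3 * (n * 2)
      alg = solve-∀

    -- Vertex `zero` is bounded by the arcs of the base. These arcs and the `D` edges at `zero` add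
    -- up to the degree sum of the other vertices, which is just the slack in `closed₃≤`.
    τ≤ : sum (closed₃ H) + D ≤ s 2
    τ≤ = begin
      closed₃ H zero + sum (closed₃ H ∘ suc) + D ≤⟨ +-monoˡ-≤ D (+-monoˡ-≤ (sum (closed₃ H ∘ suc)) (closed₃-zero≤ H (proj₂ H-simple zero))) ⟩
      arcs (base H) + sum (closed₃ H ∘ suc) + D ≡⟨ alg (arcs (base H)) (sum (closed₃ H ∘ suc)) D ⟩
      sum (closed₃ H ∘ suc) + (D + arcs (base H))
        ≡⟨ cong (λ z → sum (closed₃ H ∘ suc) + (z + arcs (base H))) (trans D≡ (sum-cong-≗ λ i → cong bit (proj₁ H-simple zero (suc i)))) ⟩
      sum (closed₃ H ∘ suc) + (sum (λ i → bit (H (suc i) zero)) + arcs (base H))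
        ≡⟨ cong (sum (closed₃ H ∘ suc) +_) (∑-distrib-+ (λ i → bit (H (suc i) zero)) (deg (base H))) ⟨
      sum (closed₃ H ∘ suc) + sum d ≡⟨ ∑-distrib-+ (closed₃ H ∘ suc) d ⟨
      sum (λ i → closed₃ H (suc i) + d i) ≤⟨ sum-mono (λ i → closed₃≤ H H-simple (suc i)) ⟩
      s 2 ∎
      where
      open ≤-Reasoning
      alg : ∀ a b c → a + b + c ≡ b + (c + a)
      alg = solve-∀

    cubic : s 3 + (5 * D + 6) * s 1 ≤ (D + 5) * s 2 + n * (6 * D)
    cubic = begin
      s 3 + (5 * D + 6) * s 1 ≡⟨ sum-+-* (λ i → d i ^ 3) (λ i → d i ^ 1) (5 * D + 6) ⟩
      sum (λ i → d i ^ 3 + (5 * D + 6) * d i ^ 1) ≤⟨ sum-mono (λ i → cubic-bound D (d i) (zero-max i)) ⟩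
      sum (λ i → (D + 5) * d i ^ 2 + 6 * D) ≡⟨ ∑-distrib-+ (λ i → (D + 5) * d i ^ 2) (λ _ → 6 * D) ⟩
      sum (λ i → (D + 5) * d i ^ 2) + sum {n} (λ _ → 6 * D) ≡⟨ cong₂ _+_ (sym (*-distribˡ-sum (D + 5) (λ i → d i ^ 2))) (sum-const n (6 * D)) ⟩
      (D + 5) * s 2 + n * (6 * D) ∎
      where open ≤-Reasoning

    D≡n : D ≡ n
    D≡n = full-degree n D E (s 1) (s 2) (s 3) (sum (closed₃ H)) (sum (closed₃ G)) 51≤n D≤n e₁ e₂ e₃ τ′≥ τ≤ cubic

    s₁+E : s 1 + 1 * E ≡ n * 3
    s₁+E = +-cancelˡ-≡ (n ^ 1) (s 1 + 1 * E) (n * 3) (trans (sym (+-assoc (n ^ 1) (s 1) (1 * E))) (subst (λ z → z ^ 1 + s 1 + 1 * E ≡ n ^ 1 + n * 3) D≡n e₁))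

    s₂+5E : s 2 + 5 * E ≡ n * 9
    s₂+5E = +-cancelˡ-≡ (n ^ 2) (s 2 + 5 * E) (n * 9) (trans (sym (+-assoc (n ^ 2) (s 2) (5 * E))) (subst (λ z → z ^ 2 + s 2 + 5 * E ≡ n ^ 2 + n * 9) D≡n e₂))

    -- With `D = n` the first two moments say that `Σ (d - 2)(d - 3) = 0`, and no summand is
    -- negative.
    d∈ : ∀ i → d i ≡ 2 ⊎ d i ≡ 3
    d∈ i = 5m≡m²+6 (d i) (sum-≤-≡ (λ i → 5m≤m²+6 (d i)) (≤-reflexive (+-cancelʳ-≡ (5 * E) _ _ (begin
      sum (λ i → d i ^ 2 + 6) + 5 * E ≡⟨ cong (_+ 5 * E) (∑-distrib-+ (λ i → d i ^ 2) (λ _ → 6)) ⟩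
      s 2 + sum {n} (λ _ → 6) + 5 * E ≡⟨ cong (λ z → s 2 + z + 5 * E) (sum-const n 6) ⟩
      s 2 + n * 6 + 5 * E ≡⟨ alg₁ (s 2) n E ⟩
      s 2 + 5 * E + n * 6 ≡⟨ cong (_+ n * 6) s₂+5E ⟩
      n * 9 + n * 6 ≡⟨ alg₂ n ⟩
      5 * (n * 3) ≡⟨ cong (5 *_) s₁+E ⟨
      5 * (s 1 + 1 * E) ≡⟨ alg₃ (s 1) E ⟩
      5 * s 1 + 5 * E ≡⟨ cong (_+ 5 * E) (trans (*-distribˡ-sum 5 (λ i → d i ^ 1)) (sum-cong-≗ λ i → cong (5 *_) (*-identityʳ (d i)))) ⟩
      sum (λ i → 5 * d i) + 5 * E ∎))) i)
      where
      open ≡-Reasoning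
      alg₁ : ∀ x n e → x + n * 6 + 5 * e ≡ x + 5 * e + n * 6
      alg₁ = solve-∀
      alg₂ : ∀ n → n * 9 + n * 6 ≡ 5 * (n * 3)
      alg₂ = solve-∀
      alg₃ : ∀ x e → 5 * (x + 1 * e) ≡ 5 * x + 5 * e
      alg₃ = solve-∀

    joined : ∀ i → H zero (suc i) ≡ true
    joined i = bit≡1 (H zero (suc i)) (sum-≤-≡ {n} {λ i → bit (H zero (suc i))} {λ _ → 1} (λ i → bit≤1 (H zero (suc i))) (≤-reflexive (trans (trans (sum-const n 1) (*-identityʳ n)) (trans (sym D≡n) D≡))) i)
      where
      bit≡1 : ∀ b → bit b ≡ 1 → b ≡ true
      bit≡1 true _ = refl

    d≡ : ∀ i → d i ≡ suc (deg (base H) i)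
    d≡ i = cong (λ b → bit b + deg (base H) i) (trans (proj₁ H-simple (suc i) zero) (joined i))

  H≗cone : ∀ i j → H i j ≡ cone (base H) i j
  H≗cone zero    zero    = proj₂ H-simple zero
  H≗cone zero    (suc j) = joined j
  H≗cone (suc i) zero    = trans (proj₁ H-simple (suc i) zero) (joined i)
  H≗cone (suc i) (suc j) = refl

  base-degrees : Degrees₁₂ (base H)
  base-degrees i = Sum.map (λ d≡2 → suc-injective (trans (sym (d≡ i)) d≡2)) (λ d≡3 → suc-injective (trans (sym (d≡ i)) d≡3)) (d∈ i)

  base-ends : ends (base H) ≡ ends Y
  base-ends = +-cancelˡ-≡ (s 1) (ends (base H)) E (begin
    s 1 + ends (base H) ≡⟨ ∑-distrib-+ (λ i → d i ^ 1) (λ i → 2 ∸ deg (base H) i) ⟨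
    sum (λ i → d i ^ 1 + (2 ∸ deg (base H) i)) ≡⟨ sum-cong-≗ (λ i → trans (cong (λ z → z ^ 1 + (2 ∸ deg (base H) i)) (d≡ i)) (pointwise (deg (base H) i) (base-degrees i))) ⟩
    sum {n} (λ _ → 3) ≡⟨ sum-const n 3 ⟩
    n * 3 ≡⟨ s₁+E ⟨
    s 1 + 1 * E ≡⟨ cong (s 1 +_) (*-identityˡ E) ⟩
    s 1 + E ∎)
    where
    open ≡-Reasoning
    pointwise : ∀ m → m ≡ 1 ⊎ m ≡ 2 → suc m ^ 1 + (2 ∸ m) ≡ 3
    pointwise _ (inj₁ refl) = refl
    pointwise _ (inj₂ refl) = refl

-- Isomorphisms and disjoint unions

-- Arbitrary vertex types allow the laws of disjoint union to be checked by cases on `⊎`, and allow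
-- graphs to be compared whose orders are only propositionally equal.
Adj : Set → Set
Adj V = V → V → Bool

infix 4 _≃_
record _≃_ {V W : Set} (X : Adj V) (Y : Adj W) : Set where
  constructor iso
  field
    bijection : V ↔ W
    adjacency : ∀ i j → X i j ≡ Y (Inverse.to bijection i) (Inverse.to bijection j)

≃-pointwise : ∀ {V : Set} {X Y : Adj V} → (∀ i j → X i j ≡ Y i j) → X ≃ Y
≃-pointwise X≗Y = iso ↔-refl X≗Y

≃-refl : ∀ {V : Set} (X : Adj V) → X ≃ X
≃-refl X = ≃-pointwise λ _ _ → refl

≃-sym : ∀ {V W : Set} {X : Adj V} {Y : Adj W} → X ≃ Y → Y ≃ X
≃-sym {Y = Y} (iso π X≡Y) = iso (↔-sym π) λ i j →
  trans (cong₂ Y (sym (Inverse.inverseˡ π refl)) (sym (Inverse.inverseˡ π refl))) (sym (X≡Y _ _))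

≃-trans : ∀ {U V W : Set} {X : Adj U} {Y : Adj V} {Z : Adj W} → X ≃ Y → Y ≃ Z → X ≃ Z
≃-trans (iso π X≡Y) (iso ρ Y≡Z) = iso (↔-trans π ρ) λ i j → trans (X≡Y i j) (Y≡Z _ _)

cone-cong : ∀ {m n} {X : Graph m} {Y : Graph n} → X ≃ Y → cone X ≃ cone Y
cone-cong {X = X} {Y} (iso π X≡Y) = iso (lift₀ π) eq
  where
  eq : ∀ i j → cone X i j ≡ cone Y (lift₀ π ⟨$⟩ʳ i) (lift₀ π ⟨$⟩ʳ j)
  eq zero    zero    = refl
  eq zero    (suc j) = refl
  eq (suc i) zero    = refl
  eq (suc i) (suc j) = X≡Y i j

infixr 5 _⊎ᵍ_
_⊎ᵍ_ : ∀ {V W : Set} → Adj V → Adj W → Adj (V ⊎ W)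
(X ⊎ᵍ Y) (inj₁ a) (inj₁ b) = X a b
(X ⊎ᵍ Y) (inj₂ a) (inj₂ b) = Y a b
(X ⊎ᵍ Y) (inj₁ a) (inj₂ b) = false
(X ⊎ᵍ Y) (inj₂ a) (inj₁ b) = false

⊕-splitAt : ∀ {m n} (X : Graph m) (Y : Graph n) i j → (X ⊕ Y) i j ≡ (X ⊎ᵍ Y) (splitAt m i) (splitAt m j)
⊕-splitAt {m} X Y i j with splitAt m i | splitAt m j
... | inj₁ a | inj₁ b = refl
... | inj₁ a | inj₂ b = refl
... | inj₂ a | inj₁ b = refl
... | inj₂ a | inj₂ b = refl

⊕≃⊎ : ∀ {m n} (X : Graph m) (Y : Graph n) → X ⊕ Y ≃ X ⊎ᵍ Y
⊕≃⊎ X Y = iso +↔⊎ (⊕-splitAt X Y)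

⊎-cong : ∀ {U V U′ V′ : Set} {X : Adj U} {Y : Adj V} {X′ : Adj U′} {Y′ : Adj V′} → X ≃ X′ → Y ≃ Y′ → X ⊎ᵍ Y ≃ X′ ⊎ᵍ Y′
⊎-cong {X = X} {Y} {X′} {Y′} (iso π X≡) (iso ρ Y≡) = iso (π ⊎-↔ ρ) eq
  where
  eq : ∀ i j → (X ⊎ᵍ Y) i j ≡ (X′ ⊎ᵍ Y′) (Inverse.to (π ⊎-↔ ρ) i) (Inverse.to (π ⊎-↔ ρ) j)
  eq (inj₁ a) (inj₁ b) = X≡ a b
  eq (inj₁ a) (inj₂ b) = refl
  eq (inj₂ a) (inj₁ b) = refl
  eq (inj₂ a) (inj₂ b) = Y≡ a b

⊎-exchange : ∀ {U V W : Set} (X : Adj U) (Y : Adj V) (Z : Adj W) → X ⊎ᵍ Y ⊎ᵍ Z ≃ Y ⊎ᵍ X ⊎ᵍ Z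
⊎-exchange X Y Z = iso (mk↔ₛ′ exchange exchange involutive involutive) eq
  where
  exchange : ∀ {A B C : Set} → A ⊎ B ⊎ C → B ⊎ A ⊎ C
  exchange (inj₁ a)        = inj₂ (inj₁ a)
  exchange (inj₂ (inj₁ b)) = inj₁ b
  exchange (inj₂ (inj₂ c)) = inj₂ (inj₂ c)
  involutive : ∀ {A B C : Set} (x : A ⊎ B ⊎ C) → exchange (exchange x) ≡ x
  involutive (inj₁ a)        = refl
  involutive (inj₂ (inj₁ b)) = refl
  involutive (inj₂ (inj₂ c)) = refl
  eq : ∀ i j → (X ⊎ᵍ Y ⊎ᵍ Z) i j ≡ (Y ⊎ᵍ X ⊎ᵍ Z) (exchange i) (exchange j)
  eq (inj₁ a)        (inj₁ b)        = refl
  eq (inj₁ a)        (inj₂ (inj₁ b)) = refl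
  eq (inj₁ a)        (inj₂ (inj₂ b)) = refl
  eq (inj₂ (inj₁ a)) (inj₁ b)        = refl
  eq (inj₂ (inj₁ a)) (inj₂ (inj₁ b)) = refl
  eq (inj₂ (inj₁ a)) (inj₂ (inj₂ b)) = refl
  eq (inj₂ (inj₂ a)) (inj₁ b)        = refl
  eq (inj₂ (inj₂ a)) (inj₂ (inj₁ b)) = refl
  eq (inj₂ (inj₂ a)) (inj₂ (inj₂ b)) = refl

⊎-assoc : ∀ {U V W : Set} (X : Adj U) (Y : Adj V) (Z : Adj W) → (X ⊎ᵍ Y) ⊎ᵍ Z ≃ X ⊎ᵍ Y ⊎ᵍ Z
⊎-assoc X Y Z = iso (mk↔ₛ′ Sum.assocʳ Sum.assocˡ invˡ invʳ) eq
  where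
  invˡ : ∀ x → Sum.assocʳ (Sum.assocˡ x) ≡ x
  invˡ (inj₁ a)        = refl
  invˡ (inj₂ (inj₁ b)) = refl
  invˡ (inj₂ (inj₂ c)) = refl
  invʳ : ∀ x → Sum.assocˡ (Sum.assocʳ x) ≡ x
  invʳ (inj₁ (inj₁ a)) = refl
  invʳ (inj₁ (inj₂ b)) = refl
  invʳ (inj₂ c)        = refl
  eq : ∀ i j → ((X ⊎ᵍ Y) ⊎ᵍ Z) i j ≡ (X ⊎ᵍ Y ⊎ᵍ Z) (Sum.assocʳ i) (Sum.assocʳ j)
  eq (inj₁ (inj₁ a)) (inj₁ (inj₁ b)) = refl
  eq (inj₁ (inj₁ a)) (inj₁ (inj₂ b)) = refl
  eq (inj₁ (inj₁ a)) (inj₂ b)        = refl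
  eq (inj₁ (inj₂ a)) (inj₁ (inj₁ b)) = refl
  eq (inj₁ (inj₂ a)) (inj₁ (inj₂ b)) = refl
  eq (inj₁ (inj₂ a)) (inj₂ b)        = refl
  eq (inj₂ a)        (inj₁ (inj₁ b)) = refl
  eq (inj₂ a)        (inj₁ (inj₂ b)) = refl
  eq (inj₂ a)        (inj₂ b)        = refl

⊕-cong : ∀ {m n m′ n′} {X : Graph m} {Y : Graph n} {X′ : Graph m′} {Y′ : Graph n′} → X ≃ X′ → Y ≃ Y′ → X ⊕ Y ≃ X′ ⊕ Y′
⊕-cong {X = X} {Y} {X′} {Y′} X≃ Y≃ = ≃-trans (⊕≃⊎ X Y) (≃-trans (⊎-cong X≃ Y≃) (≃-sym (⊕≃⊎ X′ Y′)))

⊕-assoc : ∀ {l m n} (X : Graph l) (Y : Graph m) (Z : Graph n) → (X ⊕ Y) ⊕ Z ≃ X ⊕ (Y ⊕ Z)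
⊕-assoc X Y Z = ≃-trans (⊕≃⊎ (X ⊕ Y) Z) (≃-trans (⊎-cong (⊕≃⊎ X Y) (≃-refl Z)) (≃-trans (⊎-assoc X Y Z)
  (≃-trans (⊎-cong (≃-refl X) (≃-sym (⊕≃⊎ Y Z))) (≃-sym (⊕≃⊎ X (Y ⊕ Z))))))

⊕-exchange : ∀ {l m n} (X : Graph l) (Y : Graph m) (Z : Graph n) → X ⊕ (Y ⊕ Z) ≃ Y ⊕ (X ⊕ Z)
⊕-exchange X Y Z = ≃-trans (⊕≃⊎ X (Y ⊕ Z)) (≃-trans (⊎-cong (≃-refl X) (⊕≃⊎ Y Z)) (≃-trans (⊎-exchange X Y Z)
  (≃-trans (⊎-cong (≃-refl Y) (≃-sym (⊕≃⊎ X Z))) (≃-sym (⊕≃⊎ Y (X ⊕ Z))))))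

-- C 2 is K₂, so that the list of lengths describes all components.
union : (xs : List ℕ) → Graph (total xs)
union []       = K₀
union (x ∷ xs) = C x ⊕ union xs

union-↭ : ∀ {xs ys} → xs ↭ ys → union xs ≃ union ys
union-↭ Perm.refl = ≃-refl _
union-↭ (Perm.prep x p) = ⊕-cong (≃-refl (C x)) (union-↭ p)
union-↭ (Perm.swap {xs} x y p) = ≃-trans (⊕-exchange (C x) (C y) (union xs))
  (⊕-cong (≃-refl (C y)) (⊕-cong (≃-refl (C x)) (union-↭ p)))
union-↭ (Perm.trans p q) = ≃-trans (union-↭ p) (union-↭ q)

K₂≗C₂ : ∀ i j → K₂ i j ≡ C 2 i j
K₂≗C₂ zero       zero       = refl
K₂≗C₂ zero       (suc zero) = refl
K₂≗C₂ (suc zero) zero       = refl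
K₂≗C₂ (suc zero) (suc zero) = refl

components : ∀ {t} → Vec ℕ t → ℕ → List ℕ
components s q = toList s ++ replicate q 2

copiesK₂≃union : ∀ q → copiesK₂ q ≃ union (replicate q 2)
copiesK₂≃union zero    = ≃-pointwise λ ()
copiesK₂≃union (suc q) = ⊕-cong (≃-pointwise K₂≗C₂) (copiesK₂≃union q)

cycles⊕copiesK₂≃union : ∀ {t} (s : Vec ℕ t) q → cycles s ⊕ copiesK₂ q ≃ union (components s q)
cycles⊕copiesK₂≃union []      q = copiesK₂≃union q
cycles⊕copiesK₂≃union (x ∷ s) q = ≃-trans (⊕-assoc (C x) (cycles s) (copiesK₂ q))
  (⊕-cong (≃-refl (C x)) (cycles⊕copiesK₂≃union s q))

K₁⋁≗cone : ∀ {n} (X : Graph n) i j → (K₁ ⋁ X) i j ≡ cone X i j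
K₁⋁≗cone X zero    zero    = refl
K₁⋁≗cone X zero    (suc j) = refl
K₁⋁≗cone X (suc i) zero    = refl
K₁⋁≗cone X (suc i) (suc j) = refl

theGraph≃cone : ∀ {t} (s : Vec ℕ t) q → theGraph s q ≃ cone (union (components s q))
theGraph≃cone s q = ≃-trans (≃-pointwise (K₁⋁≗cone (cycles s ⊕ copiesK₂ q))) (cone-cong (cycles⊕copiesK₂≃union s q))

-- Traces under isomorphism and disjoint union

𝟙-permute : ∀ {m n} (π : Permutation m n) i j → 𝟙 i j ≡ 𝟙 (π ⟨$⟩ʳ i) (π ⟨$⟩ʳ j)
𝟙-permute π i j with i ≟ᶠ j
... | yes refl = trans (𝟙-diag i) (sym (𝟙-diag (π ⟨$⟩ʳ i)))
... | no i≢j   = trans (𝟙-off i≢j) (sym (𝟙-off (i≢j ∘ λ eq → trans (sym (inverseˡ π)) (trans (cong (π ⟨$⟩ˡ_) eq) (inverseˡ π)))))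

mpow-permute : ∀ {m n} (π : Permutation m n) {A : ℕMat m} {B : ℕMat n} → (∀ i j → A i j ≡ B (π ⟨$⟩ʳ i) (π ⟨$⟩ʳ j)) →
               ∀ k i j → mpow A k i j ≡ mpow B k (π ⟨$⟩ʳ i) (π ⟨$⟩ʳ j)
mpow-permute π A≡B zero    i j = 𝟙-permute π i j
mpow-permute π {A} {B} A≡B (suc k) i j = trans (sum-cong-≗ λ l → cong₂ _*_ (A≡B i l) (mpow-permute π A≡B k l j))
  (sym (sum-permute (λ l → B (π ⟨$⟩ʳ i) l * mpow B k l (π ⟨$⟩ʳ j)) π))

trace-permute : ∀ {m n} (π : Permutation m n) {A : ℕMat m} {B : ℕMat n} → (∀ i j → A i j ≡ B (π ⟨$⟩ʳ i) (π ⟨$⟩ʳ j)) →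
                ∀ k → trace (mpow A k) ≡ trace (mpow B k)
trace-permute π {A} {B} A≡B k = trans (sum-cong-≗ λ i → mpow-permute π A≡B k i i) (sym (sum-permute (λ i → mpow B k i i) π))

module _ {m n : ℕ} {X : Graph m} {Y : Graph n} (X≃Y : X ≃ Y) where
  open _≃_ X≃Y renaming (bijection to π)

  deg-≃ : ∀ i → deg X i ≡ deg Y (π ⟨$⟩ʳ i)
  deg-≃ i = trans (sum-cong-≗ λ j → cong bit (adjacency i j)) (sym (sum-permute (λ j → bit (Y (π ⟨$⟩ʳ i) j)) π))

  signless-≃ : ∀ i j → signless X i j ≡ signless Y (π ⟨$⟩ʳ i) (π ⟨$⟩ʳ j)
  signless-≃ i j = cong₂ _+_ (cong₂ _*_ (𝟙-permute π i j) (deg-≃ i)) (cong bit (adjacency i j))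

  trace-signless-≃ : ∀ k → trace (mpow (signless X) k) ≡ trace (mpow (signless Y) k)
  trace-signless-≃ = trace-permute π signless-≃

  trace-coned-≃ : ∀ k → trace (mpow (coned X) k) ≡ trace (mpow (coned Y) k)
  trace-coned-≃ = trace-permute π λ i j → cong₂ _+_ (𝟙-permute π i j) (signless-≃ i j)

sum-split : ∀ m {n} (f : Fin (m + n) → ℕ) → sum f ≡ sum (λ i → f (i ↑ˡ n)) + sum (λ j → f (m ↑ʳ j))
sum-split zero    f = refl
sum-split (suc m) f = trans (cong (f zero +_) (sum-split m (f ∘ suc))) (sym (+-assoc (f zero) _ _))

↑-elim : ∀ m {n} (P : Fin (m + n) → Set) → (∀ i → P (i ↑ˡ n)) → (∀ j → P (m ↑ʳ j)) → ∀ k → P k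
↑-elim m {n} P left right k = subst P (join-splitAt m n k) (cases (splitAt m k))
  where
  cases : ∀ x → P (join m n x)
  cases (inj₁ i) = left i
  cases (inj₂ j) = right j

module _ {m n : ℕ} (X : Graph m) (Y : Graph n) where

  ⊕-ˡˡ : ∀ i j → (X ⊕ Y) (i ↑ˡ n) (j ↑ˡ n) ≡ X i j
  ⊕-ˡˡ i j = trans (⊕-splitAt X Y _ _) (cong₂ (X ⊎ᵍ Y) (splitAt-↑ˡ m i n) (splitAt-↑ˡ m j n))

  ⊕-ˡʳ : ∀ i j → (X ⊕ Y) (i ↑ˡ n) (m ↑ʳ j) ≡ false
  ⊕-ˡʳ i j = trans (⊕-splitAt X Y _ _) (cong₂ (X ⊎ᵍ Y) (splitAt-↑ˡ m i n) (splitAt-↑ʳ m n j))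

  ⊕-ʳˡ : ∀ i j → (X ⊕ Y) (m ↑ʳ i) (j ↑ˡ n) ≡ false
  ⊕-ʳˡ i j = trans (⊕-splitAt X Y _ _) (cong₂ (X ⊎ᵍ Y) (splitAt-↑ʳ m n i) (splitAt-↑ˡ m j n))

  ⊕-ʳʳ : ∀ i j → (X ⊕ Y) (m ↑ʳ i) (m ↑ʳ j) ≡ Y i j
  ⊕-ʳʳ i j = trans (⊕-splitAt X Y _ _) (cong₂ (X ⊎ᵍ Y) (splitAt-↑ʳ m n i) (splitAt-↑ʳ m n j))

  deg-⊕ˡ : ∀ i → deg (X ⊕ Y) (i ↑ˡ n) ≡ deg X i
  deg-⊕ˡ i = trans (sum-split m (λ j → bit ((X ⊕ Y) (i ↑ˡ n) j)))
    (trans (cong₂ _+_ (sum-cong-≗ λ j → cong bit (⊕-ˡˡ i j)) (sum-≡0 (λ j → bit ((X ⊕ Y) (i ↑ˡ n) (m ↑ʳ j))) λ j → cong bit (⊕-ˡʳ i j)))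
           (+-identityʳ (deg X i)))

  deg-⊕ʳ : ∀ i → deg (X ⊕ Y) (m ↑ʳ i) ≡ deg Y i
  deg-⊕ʳ i = trans (sum-split m (λ j → bit ((X ⊕ Y) (m ↑ʳ i) j)))
    (cong₂ _+_ (sum-≡0 (λ j → bit ((X ⊕ Y) (m ↑ʳ i) (j ↑ˡ n))) λ j → cong bit (⊕-ʳˡ i j)) (sum-cong-≗ λ j → cong bit (⊕-ʳʳ i j)))

  ⊕-simple : IsSimple X → IsSimple Y → IsSimple (X ⊕ Y)
  ⊕-simple (X-sym , X-irr) (Y-sym , Y-irr) =
    (λ i j → trans (⊕-splitAt X Y i j) (trans (symm (splitAt m i) (splitAt m j)) (sym (⊕-splitAt X Y j i)))) ,
    (λ i → trans (⊕-splitAt X Y i i) (irr (splitAt m i)))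
    where
    symm : ∀ i j → (X ⊎ᵍ Y) i j ≡ (X ⊎ᵍ Y) j i
    symm (inj₁ a) (inj₁ b) = X-sym a b
    symm (inj₁ a) (inj₂ b) = refl
    symm (inj₂ a) (inj₁ b) = refl
    symm (inj₂ a) (inj₂ b) = Y-sym a b
    irr : ∀ i → (X ⊎ᵍ Y) i i ≡ false
    irr (inj₁ a) = X-irr a
    irr (inj₂ a) = Y-irr a

  ⊕-degrees : Degrees₁₂ X → Degrees₁₂ Y → Degrees₁₂ (X ⊕ Y)
  ⊕-degrees X-deg Y-deg = ↑-elim m _
    (λ i → subst (λ d → d ≡ 1 ⊎ d ≡ 2) (sym (deg-⊕ˡ i)) (X-deg i))
    (λ i → subst (λ d → d ≡ 1 ⊎ d ≡ 2) (sym (deg-⊕ʳ i)) (Y-deg i))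

  ⊕-matched : Matched X → Matched Y → Matched (X ⊕ Y)
  ⊕-matched X-mat Y-mat = ↑-elim m _
    (λ i → ↑-elim m _ (λ j d≡1 ij → trans (deg-⊕ˡ j) (X-mat i j (trans (sym (deg-⊕ˡ i)) d≡1) (trans (sym (⊕-ˡˡ i j)) ij)))
                      (λ j d≡1 ij → impossible (trans (sym (⊕-ˡʳ i j)) ij)))
    (λ i → ↑-elim m _ (λ j d≡1 ij → impossible (trans (sym (⊕-ʳˡ i j)) ij))
                      (λ j d≡1 ij → trans (deg-⊕ʳ j) (Y-mat i j (trans (sym (deg-⊕ʳ i)) d≡1) (trans (sym (⊕-ʳʳ i j)) ij))))
    where
    impossible : ∀ {A : Set} → false ≡ true → A
    impossible ()

𝟙-↑ˡˡ : ∀ {m} n (i j : Fin m) → 𝟙 (i ↑ˡ n) (j ↑ˡ n) ≡ 𝟙 i j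
𝟙-↑ˡˡ n zero    zero    = refl
𝟙-↑ˡˡ n zero    (suc j) = refl
𝟙-↑ˡˡ n (suc i) zero    = refl
𝟙-↑ˡˡ n (suc i) (suc j) = 𝟙-↑ˡˡ n i j

𝟙-↑ʳʳ : ∀ m {n} (i j : Fin n) → 𝟙 (m ↑ʳ i) (m ↑ʳ j) ≡ 𝟙 i j
𝟙-↑ʳʳ zero    i j = refl
𝟙-↑ʳʳ (suc m) i j = 𝟙-↑ʳʳ m i j

𝟙-↑ˡʳ : ∀ {m n} (i : Fin m) (j : Fin n) → 𝟙 (i ↑ˡ n) (m ↑ʳ j) ≡ 0
𝟙-↑ˡʳ zero    j = refl
𝟙-↑ˡʳ (suc i) j = 𝟙-↑ˡʳ i j

module _ {m n : ℕ} {M : ℕMat (m + n)} {A : ℕMat m} {B : ℕMat n}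
         (ll : ∀ i j → M (i ↑ˡ n) (j ↑ˡ n) ≡ A i j) (lr : ∀ i j → M (i ↑ˡ n) (m ↑ʳ j) ≡ 0)
         (rl : ∀ i j → M (m ↑ʳ i) (j ↑ˡ n) ≡ 0) (rr : ∀ i j → M (m ↑ʳ i) (m ↑ʳ j) ≡ B i j) where

  mpow-blockˡ : ∀ k i j → mpow M k (i ↑ˡ n) (j ↑ˡ n) ≡ mpow A k i j
  mpow-blockˡ zero    i j = 𝟙-↑ˡˡ n i j
  mpow-blockˡ (suc k) i j = trans (sum-split m (λ l → M (i ↑ˡ n) l * mpow M k l (j ↑ˡ n)))
    (trans (cong₂ _+_ (sum-cong-≗ λ l → cong₂ _*_ (ll i l) (mpow-blockˡ k l j))
             (sum-≡0 (λ l → M (i ↑ˡ n) (m ↑ʳ l) * mpow M k (m ↑ʳ l) (j ↑ˡ n)) λ l → cong (_* mpow M k (m ↑ʳ l) (j ↑ˡ n)) (lr i l)))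
           (+-identityʳ (mpow A (suc k) i j)))

  mpow-blockʳ : ∀ k i j → mpow M k (m ↑ʳ i) (m ↑ʳ j) ≡ mpow B k i j
  mpow-blockʳ zero    i j = 𝟙-↑ʳʳ m i j
  mpow-blockʳ (suc k) i j = trans (sum-split m (λ l → M (m ↑ʳ i) l * mpow M k l (m ↑ʳ j)))
    (cong₂ _+_ (sum-≡0 (λ l → M (m ↑ʳ i) (l ↑ˡ n) * mpow M k (l ↑ˡ n) (m ↑ʳ j)) λ l → cong (_* mpow M k (l ↑ˡ n) (m ↑ʳ j)) (rl i l))
               (sum-cong-≗ λ l → cong₂ _*_ (rr i l) (mpow-blockʳ k l j)))

  trace-block : ∀ k → trace (mpow M k) ≡ trace (mpow A k) + trace (mpow B k)
  trace-block k = trans (sum-split m (λ i → mpow M k i i)) (cong₂ _+_ (sum-cong-≗ λ i → mpow-blockˡ k i i) (sum-cong-≗ λ i → mpow-blockʳ k i i))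

trace-coned-⊕ : ∀ {m n} (X : Graph m) (Y : Graph n) k →
  trace (mpow (coned (X ⊕ Y)) k) ≡ trace (mpow (coned X) k) + trace (mpow (coned Y) k)
trace-coned-⊕ {m} {n} X Y = trace-block
  (λ i j → cong₂ _+_ (𝟙-↑ˡˡ n i j) (cong₂ _+_ (cong₂ _*_ (𝟙-↑ˡˡ n i j) (deg-⊕ˡ X Y i)) (cong bit (⊕-ˡˡ X Y i j))))
  (λ i j → cong₂ _+_ (𝟙-↑ˡʳ i j) (cong₂ _+_ (cong (_* deg (X ⊕ Y) (i ↑ˡ n)) (𝟙-↑ˡʳ i j)) (cong bit (⊕-ˡʳ X Y i j))))
  (λ i j → cong₂ _+_ (𝟙-↑ʳˡ i j) (cong₂ _+_ (cong (_* deg (X ⊕ Y) (m ↑ʳ i)) (𝟙-↑ʳˡ i j)) (cong bit (⊕-ʳˡ X Y i j))))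
  (λ i j → cong₂ _+_ (𝟙-↑ʳʳ m i j) (cong₂ _+_ (cong₂ _*_ (𝟙-↑ʳʳ m i j) (deg-⊕ʳ X Y i)) (cong bit (⊕-ʳʳ X Y i j))))
  where
  𝟙-↑ʳˡ : ∀ (i : Fin n) (j : Fin m) → 𝟙 (m ↑ʳ i) (j ↑ˡ n) ≡ 0
  𝟙-↑ʳˡ i j = trans (𝟙-sym (m ↑ʳ i) (j ↑ˡ n)) (𝟙-↑ˡʳ j i)

-- Closed walks in cycles

dirac : ℕ → ℕ → ℕ
dirac zero    zero    = 1
dirac zero    (suc l) = 0
dirac (suc k) zero    = 0
dirac (suc k) (suc l) = dirac k l

dirac-diag : ∀ k → dirac k k ≡ 1
dirac-diag zero    = refl
dirac-diag (suc k) = dirac-diag k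

dirac-off : ∀ {k l} → k ≢ l → dirac k l ≡ 0
dirac-off {zero}  {zero}  k≢l = ⊥-elim (k≢l refl)
dirac-off {zero}  {suc l} k≢l = refl
dirac-off {suc k} {zero}  k≢l = refl
dirac-off {suc k} {suc l} k≢l = dirac-off (k≢l ∘ cong suc)

-- lineWalks k h sums h over the endpoints of the walks of length k from the point k of the line,
-- every point of which carries three loops.
lineWalks : ℕ → (ℕ → ℕ) → ℕ
lineWalks zero    h = h 0
lineWalks (suc k) h = lineWalks k h + 3 * lineWalks k (h ∘ suc) + lineWalks k (λ l → h (suc (suc l)))

-- Only the points 0 to `2k` can be reached. The bound is essential for `diagonal-short`, where the
-- two functions differ farther out.
lineWalks-cong : ∀ k {h h′ : ℕ → ℕ} → (∀ l → l ≤ k + k → h l ≡ h′ l) → lineWalks k h ≡ lineWalks k h′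
lineWalks-cong zero    h≗ = h≗ 0 z≤n
lineWalks-cong (suc k) {h} {h′} h≗ = cong₂ _+_
  (cong₂ (λ x y → x + 3 * y) (lineWalks-cong k {h} {h′} λ l l≤ → h≗ l (widen (≤-trans l≤ (n≤1+n (k + k)))))
                             (lineWalks-cong k {h ∘ suc} {h′ ∘ suc} λ l l≤ → h≗ (suc l) (widen (s≤s l≤))))
  (lineWalks-cong k {λ l → h (suc (suc l))} {λ l → h′ (suc (suc l))} λ l l≤ →
    h≗ (suc (suc l)) (≤-trans (s≤s (s≤s l≤)) (≤-reflexive (cong suc (sym (+-suc k k))))))
  where
  widen : ∀ {l} → l ≤ suc (k + k) → l ≤ suc k + suc k
  widen l≤ = ≤-trans l≤ (≤-trans (n≤1+n (suc (k + k))) (≤-reflexive (cong suc (sym (+-suc k k)))))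

lineWalks-mono : ∀ k {h h′ : ℕ → ℕ} → (∀ l → h l ≤ h′ l) → lineWalks k h ≤ lineWalks k h′
lineWalks-mono zero    h≤ = h≤ 0
lineWalks-mono (suc k) {h} {h′} h≤ = +-mono-≤
  (+-mono-≤ (lineWalks-mono k {h} {h′} h≤) (*-monoʳ-≤ 3 (lineWalks-mono k {h ∘ suc} {h′ ∘ suc} (h≤ ∘ suc))))
  (lineWalks-mono k {λ l → h (suc (suc l))} {λ l → h′ (suc (suc l))} (λ l → h≤ (suc (suc l))))

lineWalks-+ : ∀ k (h h′ : ℕ → ℕ) → lineWalks k (λ l → h l + h′ l) ≡ lineWalks k h + lineWalks k h′
lineWalks-+ zero    h h′ = refl
lineWalks-+ (suc k) h h′ = trans (cong₂ _+_ (cong₂ (λ x y → x + 3 * y) (lineWalks-+ k h h′) (lineWalks-+ k (h ∘ suc) (h′ ∘ suc))) (lineWalks-+ k (λ l → h (suc (suc l))) (λ l → h′ (suc (suc l)))))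
  (alg (lineWalks k h) (lineWalks k h′) (lineWalks k (h ∘ suc)) (lineWalks k (h′ ∘ suc)) (lineWalks k (λ l → h (suc (suc l)))) (lineWalks k (λ l → h′ (suc (suc l)))))
  where
  alg : ∀ a a′ b b′ c c′ → a + a′ + 3 * (b + b′) + (c + c′) ≡ a + 3 * b + c + (a′ + 3 * b′ + c′)
  alg = solve-∀

lineWalks-first : ∀ k (h : ℕ → ℕ) → h 0 ≤ lineWalks k h
lineWalks-first zero    h = ≤-refl
lineWalks-first (suc k) h = ≤-trans (lineWalks-first k h) (≤-trans (m≤m+n (lineWalks k h) (3 * lineWalks k (h ∘ suc))) (m≤m+n (lineWalks k h + 3 * lineWalks k (h ∘ suc)) (lineWalks k (λ l → h (suc (suc l))))))

closedLineWalks : ℕ → ℕ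
closedLineWalks k = lineWalks k (dirac k)

module Mod (k : ℕ) where

  x : ℕ
  x = suc k

  rep : ℕ → Fin x
  rep a = a mod x

  toℕ-rep : ∀ a → toℕ (rep a) ≡ a % x
  toℕ-rep a = toℕ-fromℕ< (m%n<n a x)

  rep-cong : ∀ a b → a % x ≡ b % x → rep a ≡ rep b
  rep-cong a b eq = toℕ-injective (trans (toℕ-rep a) (trans eq (sym (toℕ-rep b))))

  rep-toℕ : ∀ i → rep (toℕ i) ≡ i
  rep-toℕ i = toℕ-injective (trans (toℕ-rep (toℕ i)) (m<n⇒m%n≡m (toℕ<n i)))

  %-+ : ∀ a b → (a % x + b) % x ≡ (a + b) % x
  %-+ a b = trans (%-distribˡ-+ (a % x) b x) (trans (cong (λ z → (z + b % x) % x) (m%n%n≡m%n a x)) (sym (%-distribˡ-+ a b x)))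

  no-short-period : ∀ a r → 0 < r → r < x → (a + r) % x ≢ a % x
  no-short-period a r 0<r r<x eq = cases ((b + r) ℕ.<? x)
    where
    b = a % x
    eq′ : (b + r) % x ≡ b
    eq′ = trans (%-+ a r) eq
    cases : Dec (b + r < x) → ⊥
    cases (yes b+r<x) = <-irrefl (sym (+-cancelˡ-≡ b r 0 (trans (sym (m<n⇒m%n≡m b+r<x)) (trans eq′ (sym (+-identityʳ b)))))) 0<r
    cases (no b+r≮x) = <-irrefl r≡x r<x
      where
      c = (b + r) ∸ x
      c+x : c + x ≡ b + r
      c+x = m∸n+n≡m (≮⇒≥ b+r≮x)
      c<x : c < x
      c<x = +-cancelʳ-< x c x (subst (_< x + x) (sym c+x) (+-mono-< (m%n<n a x) r<x))
      c≡b : c ≡ b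
      c≡b = trans (sym (m<n⇒m%n≡m c<x)) (trans (sym ([m+n]%n≡m%n c x)) (trans (cong (_% x) c+x) eq′))
      r≡x : r ≡ x
      r≡x = +-cancelˡ-≡ b r x (trans (sym c+x) (cong (_+ x) c≡b))

  nxt prv : Fin x → Fin x
  nxt i = rep (suc (toℕ i))
  -- Since `k = x - 1`, adding it is a step back modulo `x`.
  prv i = rep (toℕ i + k)

  nxt-rep : ∀ a → nxt (rep a) ≡ rep (suc a)
  nxt-rep a = rep-cong (suc (toℕ (rep a))) (suc a) (trans (cong (λ z → suc z % x) (toℕ-rep a)) (trans (cong (_% x) (+-comm 1 (a % x))) (trans (%-+ a 1) (cong (_% x) (+-comm a 1)))))

  prv-rep : ∀ a → prv (rep (suc a)) ≡ rep a
  prv-rep a = rep-cong (toℕ (rep (suc a)) + k) a (trans (cong (λ z → (z + k) % x) (toℕ-rep (suc a))) (trans (%-+ (suc a) k)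
    (trans (cong (_% x) (sym (+-suc a k))) ([m+n]%n≡m%n a x))))

  prv-nxt : ∀ i → prv (nxt i) ≡ i
  prv-nxt i = trans (prv-rep (toℕ i)) (rep-toℕ i)

  nxt-prv : ∀ i → nxt (prv i) ≡ i
  nxt-prv i = trans (nxt-rep (toℕ i + k)) (trans (rep-cong (suc (toℕ i + k)) (toℕ i) (trans (cong (_% x) (sym (+-suc (toℕ i) k))) ([m+n]%n≡m%n (toℕ i) x))) (rep-toℕ i))

  C-sym : ∀ i j → C x i j ≡ C x j i
  C-sym i j = ∨-comm ⌊ (suc (toℕ i) % x) ℕ.≟ toℕ j ⌋ ⌊ (suc (toℕ j) % x) ℕ.≟ toℕ i ⌋

  next? : Fin x → Fin x → Bool
  next? i j = ⌊ (suc (toℕ i) % x) ℕ.≟ toℕ j ⌋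

  next?-yes : ∀ {i j} → nxt i ≡ j → next? i j ≡ true
  next?-yes {i} {j} eq with (suc (toℕ i) % x) ℕ.≟ toℕ j
  ... | yes _ = refl
  ... | no ¬p = ⊥-elim (¬p (trans (sym (toℕ-rep (suc (toℕ i)))) (cong toℕ eq)))

  next?-no : ∀ {i j} → nxt i ≢ j → next? i j ≡ false
  next?-no {i} {j} neq with (suc (toℕ i) % x) ℕ.≟ toℕ j
  ... | yes p = ⊥-elim (neq (toℕ-injective (trans (toℕ-rep (suc (toℕ i))) p)))
  ... | no _  = refl

  C-irreflexive : 2 ≤ x → ∀ i → C x i i ≡ false
  C-irreflexive 2≤x i = cong₂ _∨_ (next?-no {i} {i} loop) (next?-no {i} {i} loop)
    where
    loop : nxt i ≢ i
    loop eq = no-short-period (toℕ i) 1 (s≤s z≤n) 2≤x (trans (cong (_% x) (+-comm (toℕ i) 1))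
      (trans (sym (toℕ-rep (suc (toℕ i)))) (trans (cong toℕ eq) (sym (m<n⇒m%n≡m (toℕ<n i))))))

  module _ (3≤x : 3 ≤ x) where

    no-2-cycle : ∀ i → nxt (nxt i) ≢ i
    no-2-cycle i eq = no-short-period (toℕ i) 2 (s≤s z≤n) 3≤x (trans (cong (_% x) (+-comm (toℕ i) 2))
      (trans (sym (toℕ-rep (suc (suc (toℕ i))))) (trans (cong toℕ (trans (sym (nxt-rep (suc (toℕ i)))) eq)) (sym (m<n⇒m%n≡m (toℕ<n i))))))

    -- With at least 3 vertices the successor and the predecessor are distinct, so the disjunction
    -- becomes a sum.
    bit-C : ∀ i j → bit (C x i j) ≡ 𝟙 (nxt i) j + 𝟙 (prv i) j
    bit-C i j with nxt i ≟ᶠ j | nxt j ≟ᶠ i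
    ... | yes p | yes q = ⊥-elim (no-2-cycle i (trans (cong nxt p) q))
    ... | yes p | no ¬q = trans (cong bit (cong₂ _∨_ (next?-yes {i} p) (next?-no {j} ¬q)))
      (sym (cong₂ _+_ (trans (cong (λ z → 𝟙 z j) p) (𝟙-diag j)) (𝟙-off λ prv≡ → ¬q (trans (cong nxt (sym prv≡)) (nxt-prv i)))))
    ... | no ¬p | yes q = trans (cong bit (cong₂ _∨_ (next?-no {i} ¬p) (next?-yes {j} q)))
      (sym (cong₂ _+_ (𝟙-off ¬p) (trans (cong (λ z → 𝟙 z j) (trans (cong prv (sym q)) (prv-nxt j))) (𝟙-diag j))))
    ... | no ¬p | no ¬q = trans (cong bit (cong₂ _∨_ (next?-no {i} ¬p) (next?-no {j} ¬q)))
      (sym (cong₂ _+_ (𝟙-off ¬p) (𝟙-off λ prv≡ → ¬q (trans (cong nxt (sym prv≡)) (nxt-prv i)))))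

    sum-C : ∀ i (f : Fin x → ℕ) → sum (λ j → bit (C x i j) * f j) ≡ f (nxt i) + f (prv i)
    sum-C i f = trans (sum-cong-≗ λ j → trans (cong (_* f j) (bit-C i j)) (*-distribʳ-+ (f j) (𝟙 (nxt i) j) (𝟙 (prv i) j)))
      (trans (∑-distrib-+ (λ j → 𝟙 (nxt i) j * f j) (λ j → 𝟙 (prv i) j * f j)) (cong₂ _+_ (sum-𝟙ˡ (nxt i) f) (sum-𝟙ˡ (prv i) f)))

    deg-C : ∀ i → deg (C x) i ≡ 2
    deg-C i = trans (sum-cong-≗ λ j → sym (*-identityʳ (bit (C x i j)))) (sum-C i (λ _ → 1))

    private
      P = coned (C x)

    -- Walks on the cycle are lifted to the line that covers it. The start `a + n` keeps every point
    -- within `n` steps of it a natural number, and the three loops are the diagonal entries `1 + 2`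
    -- of `coned`.
    mpow-C : ∀ n a j → mpow P n (rep (a + n)) j ≡ lineWalks n (λ l → 𝟙 (rep (a + l)) j)
    mpow-C zero    a j = refl
    mpow-C (suc n) a j = begin
      mpow P (suc n) i j ≡⟨ sum-coned (C x) F i ⟩
      F i + (deg (C x) i * F i + sum (λ l → bit (C x i l) * F l)) ≡⟨ cong₂ (λ d s → F i + (d * F i + s)) (deg-C i) (sum-C i F) ⟩
      F i + (2 * F i + (F (nxt i) + F (prv i))) ≡⟨ alg (F i) (F (nxt i)) (F (prv i)) ⟩
      F (prv i) + 3 * F i + F (nxt i)
        ≡⟨ cong₂ _+_ (cong₂ (λ y z → y + 3 * z) (trans (cong F (trans (cong (prv ∘ rep) (+-suc a n)) (prv-rep (a + n)))) (mpow-C n a j))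
                                                (trans (cong (F ∘ rep) (+-suc a n)) (trans (mpow-C n (suc a) j) (shift 1 a (λ l → sym (+-suc a l))))))
                     (trans (cong F (trans (nxt-rep (a + suc n)) (cong (rep ∘ suc) (+-suc a n)))) (trans (mpow-C n (suc (suc a)) j)
                       (shift 2 a (λ l → trans (cong suc (sym (+-suc a l))) (sym (+-suc a (suc l))))))) ⟩
      lineWalks (suc n) (λ l → 𝟙 (rep (a + l)) j) ∎
      where
      open ≡-Reasoning
      i = rep (a + suc n)
      F : Fin x → ℕ
      F l = mpow P n l j
      alg : ∀ f g h → f + (2 * f + (g + h)) ≡ h + 3 * f + g
      alg = solve-∀
      shift : ∀ c a → (∀ l → c + a + l ≡ a + (c + l)) → lineWalks n (λ l → 𝟙 (rep (c + a + l)) j) ≡ lineWalks n (λ l → 𝟙 (rep (a + (c + l))) j)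
      shift c a eq = lineWalks-cong n λ l _ → cong (λ z → 𝟙 (rep z) j) (eq l)

    private
      -- Congruent to `toℕ i - n` modulo `x`, so that `i` lies under the middle `l = n` of the
      -- window in `mpow-C`.
      origin : ℕ → Fin x → ℕ
      origin n i = toℕ i + n * k

      origin+n : ∀ n i → origin n i + n ≡ toℕ i + n * x
      origin+n n i = alg (toℕ i) n k
        where
        alg : ∀ t n k → t + n * k + n ≡ t + n * suc k
        alg = solve-∀

      origin+n% : ∀ n i → (origin n i + n) % x ≡ toℕ i
      origin+n% n i = trans (cong (_% x) (origin+n n i)) (trans ([m+kn]%n≡m%n (toℕ i) n x) (m<n⇒m%n≡m (toℕ<n i)))

      rep-origin : ∀ n i → rep (origin n i + n) ≡ i
      rep-origin n i = trans (rep-cong (origin n i + n) (toℕ i) (trans (origin+n% n i) (sym (m<n⇒m%n≡m (toℕ<n i))))) (rep-toℕ i)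

    diagonal : ∀ n i → mpow P n i i ≡ lineWalks n (λ l → 𝟙 (rep (origin n i + l)) i)
    diagonal n i = trans (cong (λ z → mpow P n z i) (sym (rep-origin n i))) (mpow-C n (origin n i) i)

    -- The other points of the window are at distance at most `n < x` from the middle, so none of
    -- them lies over `i`.
    diagonal-short : ∀ n i → n < x → mpow P n i i ≡ closedLineWalks n
    diagonal-short n i n<x = trans (diagonal n i) (lineWalks-cong n {λ l → 𝟙 (rep (origin n i + l)) i} hits)
      where
      hits : ∀ l → l ≤ n + n → 𝟙 (rep (origin n i + l)) i ≡ dirac n l
      hits l l≤2n with <-cmp l n
      ... | tri≈ _ refl _ = trans (cong (λ z → 𝟙 z i) (rep-origin n i)) (trans (𝟙-diag i) (sym (dirac-diag n)))
      ... | tri< l<n l≢n _ = trans (𝟙-off λ rep≡ → no-short-period (origin n i + l) (n ∸ l) (m<n⇒0<n∸m l<n) (≤-<-trans (m∸n≤m n l) n<x)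
          (trans (cong (_% x) (trans (+-assoc (origin n i) l (n ∸ l)) (cong (origin n i +_) (m+[n∸m]≡n (<⇒≤ l<n)))))
            (trans (origin+n% n i) (sym (trans (sym (toℕ-rep (origin n i + l))) (cong toℕ rep≡)))))) (sym (dirac-off (l≢n ∘ sym)))
      ... | tri> _ l≢n n<l = trans (𝟙-off λ rep≡ → no-short-period (origin n i + n) (l ∸ n) (m<n⇒0<n∸m n<l)
            (≤-<-trans (≤-trans (∸-monoˡ-≤ n l≤2n) (≤-reflexive (m+n∸n≡m n n))) n<x)
            (trans (cong (_% x) (trans (+-assoc (origin n i) n (l ∸ n)) (cong (origin n i +_) (m+[n∸m]≡n (<⇒≤ n<l)))))
              (trans (sym (toℕ-rep (origin n i + l))) (trans (cong toℕ rep≡) (sym (origin+n% n i)))))) (sym (dirac-off (l≢n ∘ sym)))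

    -- At length `x` the point `l = 0`, one full turn from the middle, lies over `i` as well and is
    -- reached by at least one walk.
    diagonal-return : ∀ i → closedLineWalks x + 1 ≤ mpow P x i i
    diagonal-return i = begin
      lineWalks x (dirac x) + 1 ≤⟨ +-monoʳ-≤ (lineWalks x (dirac x)) (lineWalks-first x (dirac 0)) ⟩
      lineWalks x (dirac x) + lineWalks x (dirac 0) ≡⟨ lineWalks-+ x (dirac x) (dirac 0) ⟨
      lineWalks x (λ l → dirac x l + dirac 0 l) ≤⟨ lineWalks-mono x {λ l → dirac x l + dirac 0 l} hits ⟩
      lineWalks x (λ l → 𝟙 (rep (origin x i + l)) i) ≡⟨ diagonal x i ⟨
      mpow P x i i ∎
      where
      open ≤-Reasoning
      hits : ∀ l → dirac x l + dirac 0 l ≤ 𝟙 (rep (origin x i + l)) i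
      hits zero = ≤-reflexive (sym (trans (cong (λ z → 𝟙 z i) (trans (rep-cong (origin x i + 0) (toℕ i) (trans (trans (cong (_% x) (+-identityʳ (origin x i))) (sym ([m+n]%n≡m%n (origin x i) x)))
        (trans (origin+n% x i) (sym (m<n⇒m%n≡m (toℕ<n i)))))) (rep-toℕ i))) (𝟙-diag i)))
      hits (suc l) with k ℕ.≟ l
      ... | yes refl rewrite dirac-diag k = ≤-reflexive (sym (trans (cong (λ z → 𝟙 z i) (rep-origin x i)) (𝟙-diag i)))
      ... | no k≢l rewrite dirac-off k≢l = z≤n

-- The orders of the components from the traces

componentTrace : ℕ → ℕ → ℕ
componentTrace k x = trace (mpow (coned (C x)) k)

componentTrace-0 : ∀ x → componentTrace 0 x ≡ x
componentTrace-0 x = trans (sum-cong-≗ {x} 𝟙-diag) (trans (sum-const x 1) (*-identityʳ x))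

componentTrace-short : ∀ {k x} → 3 ≤ x → k < x → componentTrace k x ≡ x * closedLineWalks k
componentTrace-short {k} {suc x} 3≤x k<x = trans (sum-cong-≗ λ i → Mod.diagonal-short x 3≤x k i k<x) (sum-const (suc x) (closedLineWalks k))

componentTrace-return : ∀ {x} → 3 ≤ x → x * closedLineWalks x < componentTrace x x
componentTrace-return {suc x} 3≤x = <-≤-trans (*-monoʳ-< (suc x) (m<m+n (closedLineWalks (suc x)) {1} (s≤s z≤n)))
  (≤-trans (≤-reflexive (sym (sum-const (suc x) (closedLineWalks (suc x) + 1)))) (sum-mono (Mod.diagonal-return x 3≤x)))

C-simple : ∀ {x} → 2 ≤ x → IsSimple (C x)
C-simple {suc x} 2≤x = Mod.C-sym x , Mod.C-irreflexive x 2≤x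

deg-C₂ : ∀ i → deg (C 2) i ≡ 1
deg-C₂ zero       = refl
deg-C₂ (suc zero) = refl

2≤⇒≡2⊎3≤ : ∀ {x} → 2 ≤ x → x ≡ 2 ⊎ 3 ≤ x
2≤⇒≡2⊎3≤ 2≤x = Sum.swap (Sum.map (λ 2<x → 2<x) sym (m≤n⇒m<n∨m≡n 2≤x))

C-degrees : ∀ {x} → 2 ≤ x → Degrees₁₂ (C x)
C-degrees {suc x} 2≤x i with 2≤⇒≡2⊎3≤ 2≤x
... | inj₁ refl = inj₁ (deg-C₂ i)
... | inj₂ 3≤x  = inj₂ (Mod.deg-C x 3≤x i)

C-matched : ∀ {x} → 2 ≤ x → Matched (C x)
C-matched {suc x} 2≤x i j d≡1 _ with 2≤⇒≡2⊎3≤ 2≤x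
... | inj₁ refl = deg-C₂ j
... | inj₂ 3≤x  = ⊥-elim (1≢2 (trans (sym d≡1) (Mod.deg-C x 3≤x i)))
  where
  1≢2 : 1 ≢ 2
  1≢2 ()

traceSum : ℕ → List ℕ → ℕ
traceSum k xs = total (map (componentTrace k) xs)

trace-coned-union : ∀ xs k → trace (mpow (coned (union xs)) k) ≡ traceSum k xs
trace-coned-union []       k = refl
trace-coned-union (x ∷ xs) k = trans (trace-coned-⊕ (C x) (union xs) k) (cong (componentTrace k x +_) (trace-coned-union xs k))

module _ {A : Set} {f g : A → ℕ} where

  total-map-≤ : ∀ {xs} → Allˡ (λ x → f x ≤ g x) xs → total (map f xs) ≤ total (map g xs)
  total-map-≤ []           = z≤n
  total-map-≤ (f≤g ∷ f≤gs) = +-mono-≤ f≤g (total-map-≤ f≤gs)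

  total-map-< : ∀ {x xs} → Allˡ (λ x → f x ≤ g x) xs → x ∈ xs → f x < g x → total (map f xs) < total (map g xs)
  total-map-< (f≤g ∷ f≤gs) (here refl)  f<g = +-mono-<-≤ f<g (total-map-≤ f≤gs)
  total-map-< (f≤g ∷ f≤gs) (there x∈xs) f<g = +-mono-≤-< f≤g (total-map-< f≤gs x∈xs f<g)

  total-map-≡ : ∀ {xs} → Allˡ (λ x → f x ≡ g x) xs → total (map f xs) ≡ total (map g xs)
  total-map-≡ []           = refl
  total-map-≡ (f≡g ∷ f≡gs) = cong₂ _+_ f≡g (total-map-≡ f≡gs)

scaled : ℕ → List ℕ → ℕ
scaled w xs = total (map (_* w) xs)

scaled-total : ∀ w xs → scaled w xs ≡ total xs * w
scaled-total w []       = refl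
scaled-total w (x ∷ xs) = trans (cong (x * w +_) (scaled-total w xs)) (sym (*-distribʳ-+ w x (total xs)))

traceSum-0 : ∀ xs → traceSum 0 xs ≡ total xs
traceSum-0 []       = refl
traceSum-0 (x ∷ xs) = cong₂ _+_ (componentTrace-0 x) (traceSum-0 xs)

module _ {xs ys : List ℕ} (traces≡ : ∀ k → traceSum k xs ≡ traceSum k ys) where

  private
    scaled≡ : ∀ w → scaled w xs ≡ scaled w ys
    scaled≡ w = trans (scaled-total w xs) (trans (cong (_* w) (trans (sym (traceSum-0 xs)) (trans (traces≡ 0) (traceSum-0 ys)))) (sym (scaled-total w ys)))

  -- If all `ys` exceed `m ≥ 3`, then at exponent `m` they only have walks that do not go around,
  -- and these depend on the total order alone, which exponent 0 fixes. A cycle of length `m` in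
  -- `xs` adds walks that do go around. For `m = 2` exponent 1 decides instead: the vertices of K₂
  -- have diagonal entry 2, those of a cycle 3.
  least-component : ∀ {m} → 2 ≤ m → Allˡ (m ≤_) xs → Allˡ (m ≤_) ys → m ∈ xs → m ∈ ys
  least-component {m} 2≤m m≤xs m≤ys m∈xs with m ∈? ys
  ... | yes m∈ys = m∈ys
  ... | no m∉ys  = ⊥-elim (contradictory (2≤⇒≡2⊎3≤ 2≤m))
    where
    m<ys : Allˡ (m <_) ys
    m<ys = Allˡ.zipWith (λ { (m≤y , m≢y) → ≤∧≢⇒< m≤y m≢y }) (m≤ys , ¬Any⇒All¬ ys m∉ys)
    contradictory : m ≡ 2 ⊎ 3 ≤ m → ⊥
    contradictory (inj₂ 3≤m) = <-irrefl (begin-equality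
        scaled w xs    ≡⟨ scaled≡ w ⟩
        scaled w ys    ≡⟨ total-map-≡ (Allˡ.map (λ m<y → sym (componentTrace-short (≤-trans 3≤m (<⇒≤ m<y)) m<y)) m<ys) ⟩
        traceSum m ys  ≡⟨ traces≡ m ⟨
        traceSum m xs  ∎)
        (total-map-< (Allˡ.map (λ {x} m≤x → at-least x m≤x (m≤n⇒m<n∨m≡n m≤x)) m≤xs) m∈xs (componentTrace-return 3≤m))
      where
      open ≤-Reasoning
      w = closedLineWalks m
      at-least : ∀ x → m ≤ x → m < x ⊎ m ≡ x → x * w ≤ componentTrace m x
      at-least x m≤x (inj₁ m<x)  = ≤-reflexive (sym (componentTrace-short (≤-trans 3≤m m≤x) m<x))
      at-least x m≤x (inj₂ refl) = <⇒≤ (componentTrace-return 3≤m)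
    contradictory (inj₁ refl) = <-irrefl (begin-equality
        traceSum 1 xs  ≡⟨ traces≡ 1 ⟩
        traceSum 1 ys  ≡⟨ total-map-≡ (Allˡ.map (λ 2<y → componentTrace-short 2<y (≤-trans (s≤s (s≤s z≤n)) 2<y)) m<ys) ⟩
        scaled 3 ys    ≡⟨ scaled≡ 3 ⟨
        scaled 3 xs    ∎)
        (total-map-< (Allˡ.map (λ {x} 2≤x → at-most x (2≤⇒≡2⊎3≤ 2≤x)) m≤xs) m∈xs (s≤s (s≤s (s≤s (s≤s (s≤s z≤n))))))
      where
      open ≤-Reasoning
      at-most : ∀ x → x ≡ 2 ⊎ 3 ≤ x → componentTrace 1 x ≤ x * 3
      at-most x (inj₁ refl) = s≤s (s≤s (s≤s (s≤s z≤n)))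
      at-most x (inj₂ 3≤x)  = ≤-reflexive (componentTrace-short 3≤x (≤-trans (s≤s (s≤s z≤n)) 3≤x))

traceSum-↭ : ∀ {xs ys} k → xs ↭ ys → traceSum k xs ≡ traceSum k ys
traceSum-↭ k p = sum-↭ (map⁺ (componentTrace k) p)

minimum : ∀ x xs → ∃ λ m → m ∈ x ∷ xs × Allˡ (m ≤_) (x ∷ xs)
minimum x []       = x , here refl , ≤-refl ∷ []
minimum x (y ∷ ys) with minimum y ys
... | m , m∈ , m≤ with ≤-total x m
...   | inj₁ x≤m = x , here refl , ≤-refl ∷ Allˡ.map (≤-trans x≤m) m≤
...   | inj₂ m≤x = m , there m∈ , m≤x ∷ m≤

extract : ∀ {m : ℕ} {xs} → m ∈ xs → ∃ λ xs′ → xs ↭ m ∷ xs′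
extract {m} m∈xs with ∈-∃++ m∈xs
... | as , bs , refl = as ++ bs , ↭-shift m as bs

-- The least entry of both lists together occurs in each of them; removing it keeps the traces
-- equal. The recursion runs on the length because the remaining lists come from `extract` and are
-- not sublists by structure.
traces⇒↭ : ∀ n {xs ys} → length xs ≡ n → Allˡ (2 ≤_) xs → Allˡ (2 ≤_) ys → (∀ k → traceSum k xs ≡ traceSum k ys) → xs ↭ ys
traces⇒↭ n {[]} {[]} _ _ _ _ = ↭-refl
traces⇒↭ n {[]} {y ∷ ys} _ _ (2≤y ∷ _) tr≡ = ⊥-elim (<-irrefl (trans (tr≡ 0) (traceSum-0 (y ∷ ys))) (≤-trans (≤-trans (s≤s z≤n) 2≤y) (m≤m+n y (total ys))))
traces⇒↭ (suc n) {x ∷ xs} {ys} len 2≤xs 2≤ys tr≡ = ↭-trans xs↭ (↭-trans (prep m rest↭) (↭-sym ys↭))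
  where
  least : ∃ λ m → m ∈ (x ∷ xs) ++ ys × Allˡ (m ≤_) ((x ∷ xs) ++ ys)
  least = minimum x (xs ++ ys)
  m = proj₁ least
  m≤xs : Allˡ (m ≤_) (x ∷ xs)
  m≤xs = ++⁻ˡ (x ∷ xs) (proj₂ (proj₂ least))
  m≤ys : Allˡ (m ≤_) ys
  m≤ys = ++⁻ʳ (x ∷ xs) (proj₂ (proj₂ least))
  m∈both : m ∈ x ∷ xs × m ∈ ys
  m∈both = Sum.[ (λ m∈xs → m∈xs , least-component tr≡ (Allˡ.lookup 2≤xs m∈xs) m≤xs m≤ys m∈xs)
               , (λ m∈ys → least-component (sym ∘ tr≡) (Allˡ.lookup 2≤ys m∈ys) m≤ys m≤xs m∈ys , m∈ys) ]′ (∈-++⁻ (x ∷ xs) (proj₁ (proj₂ least)))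
  xs↭ = proj₂ (extract (proj₁ m∈both))
  ys↭ = proj₂ (extract (proj₂ m∈both))
  rest↭ : proj₁ (extract (proj₁ m∈both)) ↭ proj₁ (extract (proj₂ m∈both))
  rest↭ = traces⇒↭ n (suc-injective (trans (sym (↭-length xs↭)) len)) (Allˡ.tail (All-resp-↭ xs↭ 2≤xs)) (Allˡ.tail (All-resp-↭ ys↭ 2≤ys))
    λ k → +-cancelˡ-≡ (componentTrace k m) _ _ (trans (sym (traceSum-↭ k xs↭)) (trans (tr≡ k) (traceSum-↭ k ys↭)))

-- Graphs whose components are cycles and single edges

false≢true : ∀ {A : Set} → false ≡ true → A
false≢true ()

count≡0 : ∀ {n} (f : Fin n → Bool) → sum (bit ∘ f) ≡ 0 → ∀ i → f i ≡ false
count≡0 {suc n} f eq i with f zero in f₀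
count≡0 {suc n} f eq zero    | false = f₀
count≡0 {suc n} f eq (suc i) | false = count≡0 (f ∘ suc) eq i

count≡1 : ∀ {n} (f : Fin n → Bool) → sum (bit ∘ f) ≡ 1 → ∃ λ a → f a ≡ true × ∀ c → f c ≡ true → c ≡ a
count≡1 {suc n} f eq with f zero in f₀
... | true  = zero , f₀ , only
  where
  only : ∀ c → f c ≡ true → c ≡ zero
  only zero    _  = refl
  only (suc c) fc = false≢true (trans (sym (count≡0 (f ∘ suc) (suc-injective eq) c)) fc)
... | false with count≡1 (f ∘ suc) eq
...   | a , fa , unique = suc a , fa , only
  where
  only : ∀ c → f c ≡ true → c ≡ suc a
  only zero    fc = false≢true (trans (sym f₀) fc)
  only (suc c) fc = cong suc (unique c fc)

count≡2 : ∀ {n} (f : Fin n → Bool) → sum (bit ∘ f) ≡ 2 →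
          ∃ λ a → ∃ λ b → a ≢ b × f a ≡ true × f b ≡ true × ∀ c → f c ≡ true → c ≡ a ⊎ c ≡ b
count≡2 {suc n} f eq with f zero in f₀
... | true with count≡1 (f ∘ suc) (suc-injective eq)
...   | b , fb , unique = zero , suc b , (λ ()) , f₀ , fb , only
  where
  only : ∀ c → f c ≡ true → c ≡ zero ⊎ c ≡ suc b
  only zero    _  = inj₁ refl
  only (suc c) fc = inj₂ (cong suc (unique c fc))
count≡2 {suc n} f eq | false with count≡2 (f ∘ suc) eq
... | a , b , a≢b , fa , fb , either = suc a , suc b , a≢b ∘ suc-injectiveᶠ , fa , fb , only
  where
  only : ∀ c → f c ≡ true → c ≡ suc a ⊎ c ≡ suc b
  only zero    fc = false≢true (trans (sym f₀) fc)
  only (suc c) fc = Sum.map (cong suc) (cong suc) (either c fc)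

Paired : ∀ {n} → Graph n → Fin n → Set
Paired X i = ∃ λ j → X i j ≡ true × (∀ c → X i c ≡ true → c ≡ j) × (∀ c → X j c ≡ true → c ≡ i)

TwoNeighbours : ∀ {n} → Graph n → Fin n → Set
TwoNeighbours X i = ∃ λ a → ∃ λ b → a ≢ b × X i a ≡ true × X i b ≡ true × ∀ c → X i c ≡ true → c ≡ a ⊎ c ≡ b

-- Neighbours are named rather than counted, so that the property passes to what remains after a
-- component is removed without recomputing degrees.
record PairsAndCycles {n} (X : Graph n) : Set where
  field
    symmetric   : ∀ i j → X i j ≡ X j i
    irreflexive : ∀ i → X i i ≡ false
    kind        : ∀ i → Paired X i ⊎ TwoNeighbours X i

pairsAndCycles : ∀ {n} {X : Graph n} → IsSimple X → Degrees₁₂ X → Matched X → PairsAndCycles X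
pairsAndCycles {n} {X} (X-sym , X-irr) degrees matched = record
  { symmetric = X-sym ; irreflexive = X-irr ; kind = λ i → Sum.map (paired i) (count≡2 (X i)) (degrees i) }
  where
  paired : ∀ i → deg X i ≡ 1 → Paired X i
  paired i d≡1 with count≡1 (X i) d≡1
  ... | j , ij , only-j with count≡1 (X j) (matched i j d≡1 ij)
  ...   | i′ , ji′ , only-i′ = j , ij , only-j , λ c jc → trans (only-i′ c jc) (sym (only-i′ i (trans (X-sym j i) ij)))

-- The value `e zero` is punched out of the codomain, the rest is extended there, and `insert` puts
-- the value back.
extend-injection : ∀ m {n} (e : Fin m → Fin n) → (∀ a b → e a ≡ e b → a ≡ b) →
                   ∃ λ r → Σ (Permutation (m + r) n) λ π → ∀ a → π ⟨$⟩ʳ (a ↑ˡ r) ≡ e a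
extend-injection zero    {n} e e-inj = n , idₚ , λ ()
extend-injection (suc m) {zero} e e-inj with () ← e zero
extend-injection (suc m) {suc n} e e-inj = r , insert zero (e zero) π , extends
  where
  e₀≢ : ∀ a → e zero ≢ e (suc a)
  e₀≢ a eq with () ← e-inj zero (suc a) eq
  rest : Fin m → Fin n
  rest a = punchOut (e₀≢ a)
  IH = extend-injection m rest λ a b eq → suc-injectiveᶠ (e-inj (suc a) (suc b) (punchOut-injective (e₀≢ a) (e₀≢ b) eq))
  r = proj₁ IH
  π = proj₁ (proj₂ IH)
  extends : ∀ a → insert zero (e zero) π ⟨$⟩ʳ (a ↑ˡ r) ≡ e a
  extends zero    = refl
  extends (suc a) = trans (insert-punchIn zero (e zero) π (a ↑ˡ r))
    (trans (cong (punchIn (e zero)) (proj₂ (proj₂ IH) a)) (punchIn-punchOut (e₀≢ a)))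

Residual : ∀ {m n} → Graph m → Graph n → Set
Residual {m} {n} Y X = ∃ λ r → Permutation (m + r) n × Σ (Graph r) λ X′ → PairsAndCycles X′ × X ≃ Y ⊕ X′

-- The permutation that extends `e` lists the copy of `Y` first. By `closed` no edge leaves it, so
-- the vertices that remain keep all their neighbours.
split-component : ∀ {m n} (X : Graph n) → PairsAndCycles X → (Y : Graph m) (e : Fin m → Fin n) → (∀ a b → e a ≡ e b → a ≡ b) →
  (∀ a b → X (e a) (e b) ≡ Y a b) → (∀ a c → X (e a) c ≡ true → ∃ λ b → c ≡ e b) → Residual Y X
split-component {m} {n} X good Y e e-inj induced closed = r , π , X′ , good′ , ≃-sym (iso π Y⊕X′)
  where
  open PairsAndCycles good
  ext = extend-injection m e e-inj
  r = proj₁ ext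
  π = proj₁ (proj₂ ext)
  on-e : ∀ a → π ⟨$⟩ʳ (a ↑ˡ r) ≡ e a
  on-e = proj₂ (proj₂ ext)
  g : Fin r → Fin n
  g j = π ⟨$⟩ʳ (m ↑ʳ j)
  X′ : Graph r
  X′ i j = X (g i) (g j)
  π-injective : ∀ {u v} → π ⟨$⟩ʳ u ≡ π ⟨$⟩ʳ v → u ≡ v
  π-injective eq = trans (sym (inverseˡ π)) (trans (cong (π ⟨$⟩ˡ_) eq) (inverseˡ π))
  disjoint : ∀ a j → g j ≢ e a
  disjoint a j eq with () ← trans (sym (splitAt-↑ʳ m r j)) (trans (cong (splitAt m) (π-injective (trans eq (sym (on-e a))))) (splitAt-↑ˡ m a r))
  g-injective : ∀ {i j} → g i ≡ g j → i ≡ j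
  g-injective {i} {j} eq with refl ← trans (sym (splitAt-↑ʳ m r i)) (trans (cong (splitAt m) (π-injective eq)) (splitAt-↑ʳ m r j)) = refl
  cover : ∀ v → (∃ λ a → v ≡ e a) ⊎ (∃ λ j → v ≡ g j)
  cover v = at (splitAt m (π ⟨$⟩ˡ v)) refl
    where
    at : ∀ s → splitAt m (π ⟨$⟩ˡ v) ≡ s → (∃ λ a → v ≡ e a) ⊎ (∃ λ j → v ≡ g j)
    at s eq with trans (sym (inverseʳ π)) (cong (π ⟨$⟩ʳ_) (trans (sym (join-splitAt m r (π ⟨$⟩ˡ v))) (cong (join m r) eq)))
    at (inj₁ a) eq | v≡ = inj₁ (a , trans v≡ (on-e a))
    at (inj₂ j) eq | v≡ = inj₂ (j , v≡)
  apart : ∀ a j → X (e a) (g j) ≡ false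
  apart a j with X (e a) (g j) in Xag
  ... | false = refl
  ... | true  = ⊥-elim (disjoint (proj₁ (closed a (g j) Xag)) j (proj₂ (closed a (g j) Xag)))
  Y⊕X′ : ∀ u v → (Y ⊕ X′) u v ≡ X (π ⟨$⟩ʳ u) (π ⟨$⟩ʳ v)
  Y⊕X′ = ↑-elim m _
    (λ a → ↑-elim m _ (λ b → trans (⊕-ˡˡ Y X′ a b) (trans (sym (induced a b)) (sym (cong₂ X (on-e a) (on-e b)))))
                      (λ j → trans (⊕-ˡʳ Y X′ a j) (trans (sym (apart a j)) (cong (λ v → X v (g j)) (sym (on-e a))))))
    (λ i → ↑-elim m _ (λ b → trans (⊕-ʳˡ Y X′ i b) (trans (sym (apart b i)) (trans (symmetric (e b) (g i)) (cong (X (g i)) (sym (on-e b))))))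
                      (λ j → ⊕-ʳʳ Y X′ i j))
  neighbour : ∀ {i v} → X (g i) v ≡ true → ∃ λ j → v ≡ g j
  neighbour {i} {v} gv with cover v
  ... | inj₂ v≡g        = v≡g
  ... | inj₁ (a , refl) = false≢true (trans (sym (apart a i)) (trans (symmetric (e a) (g i)) gv))
  kind′ : ∀ i → Paired X (g i) ⊎ TwoNeighbours X (g i) → Paired X′ i ⊎ TwoNeighbours X′ i
  kind′ i (inj₁ (w , iw , only-w , only-i)) with neighbour iw
  ... | j , refl = inj₁ (j , iw , (λ c ic → g-injective (only-w (g c) ic)) , (λ c jc → g-injective (only-i (g c) jc)))
  kind′ i (inj₂ (v , w , v≢w , iv , iw , either)) with neighbour iv | neighbour iw
  ... | a , refl | b , refl = inj₂ (a , b , v≢w ∘ cong g , iv , iw , λ c ic → Sum.map g-injective g-injective (either (g c) ic))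
  good′ : PairsAndCycles X′
  good′ = record { symmetric = λ i j → symmetric (g i) (g j) ; irreflexive = irreflexive ∘ g ; kind = λ i → kind′ i (kind (g i)) }

split-pair : ∀ {n} (X : Graph n) → PairsAndCycles X → ∀ i → Paired X i → Residual (C 2) X
split-pair X good i (j , ij , only-j , only-i) = split-component X good (C 2) e e-inj induced closed
  where
  open PairsAndCycles good
  ji : X j i ≡ true
  ji = trans (symmetric j i) ij
  i≢j : i ≢ j
  i≢j refl = false≢true (trans (sym (irreflexive i)) ij)
  e : Fin 2 → Fin _
  e zero       = i
  e (suc zero) = j
  e-inj : ∀ a b → e a ≡ e b → a ≡ b
  e-inj zero       zero       eq = refl
  e-inj zero       (suc zero) eq = ⊥-elim (i≢j eq)
  e-inj (suc zero) zero       eq = ⊥-elim (i≢j (sym eq))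
  e-inj (suc zero) (suc zero) eq = refl
  induced : ∀ a b → X (e a) (e b) ≡ C 2 a b
  induced zero       zero       = irreflexive i
  induced zero       (suc zero) = ij
  induced (suc zero) zero       = ji
  induced (suc zero) (suc zero) = irreflexive j
  closed : ∀ a c → X (e a) c ≡ true → ∃ λ b → c ≡ e b
  closed zero       c ic = suc zero , only-j c ic
  closed (suc zero) c jc = zero , only-i c jc

module Follow {n : ℕ} (X : Graph n) (good : PairsAndCycles X) (i₀ : Fin n) (two₀ : TwoNeighbours X i₀) where
  open PairsAndCycles good

  -- If `c` were `Paired`, its partner would be `i`, and then `c` would be the only neighbour of
  -- `i`.
  two-closed : ∀ {i c} → TwoNeighbours X i → X i c ≡ true → TwoNeighbours X c
  two-closed {i} {c} (a , b , a≢b , ia , ib , _) ic with kind c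
  ... | inj₂ two = two
  ... | inj₁ (j , _ , only-j , only-c) with only-j i (trans (symmetric c i) ic)
  ...   | refl = ⊥-elim (a≢b (trans (only-c a ia) (sym (only-c b ib))))

  -- The previous vertex is remembered so that the walk can always leave by the other neighbour;
  -- without turning back it must run around the cycle.
  record Dart : Set where
    field
      previous current : Fin n
      two              : TwoNeighbours X current
      adjacent         : X current previous ≡ true
  open Dart

  other : ∀ c p → TwoNeighbours X c → ∃ λ d → X c d ≡ true × d ≢ p
  other c p (a , b , a≢b , ca , cb , _) with a ≟ᶠ p
  ... | yes refl = b , cb , a≢b ∘ sym
  ... | no a≢p   = a , ca , a≢p

  next : Dart → Dart
  next d = record { previous = current d ; current = proj₁ o ; two = two-closed (two d) (proj₁ (proj₂ o))
                  ; adjacent = trans (symmetric (proj₁ o) (current d)) (proj₁ (proj₂ o)) }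
    where o = other (current d) (previous d) (two d)

  dart : ℕ → Dart
  dart zero    = record { previous = proj₁ two₀ ; current = i₀ ; two = two₀ ; adjacent = proj₁ (proj₂ (proj₂ (proj₂ two₀))) }
  dart (suc m) = next (dart m)

  v : ℕ → Fin n
  v m = current (dart m)

  v-adjacent : ∀ m → X (v (suc m)) (v m) ≡ true
  v-adjacent m = adjacent (dart (suc m))

  v-proper : ∀ m → v (suc m) ≢ v m
  v-proper m eq = false≢true (trans (sym (irreflexive (v m))) (trans (cong (λ z → X z (v m)) (sym eq)) (v-adjacent m)))

  no-backtracking : ∀ m → v (suc (suc m)) ≢ v m
  no-backtracking m = proj₂ (proj₂ (other (v (suc m)) (v m) (two (dart (suc m)))))

  at-most-two : ∀ {c x y z} → TwoNeighbours X c → X c x ≡ true → X c y ≡ true → x ≢ y → X c z ≡ true → z ≡ x ⊎ z ≡ y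
  at-most-two (a , b , _ , _ , _ , either) cx cy x≢y cz with either _ cx | either _ cy | either _ cz
  ... | inj₁ refl | inj₁ refl | _         = ⊥-elim (x≢y refl)
  ... | inj₂ refl | inj₂ refl | _         = ⊥-elim (x≢y refl)
  ... | inj₁ refl | inj₂ refl | z≡        = z≡
  ... | inj₂ refl | inj₁ refl | inj₁ z≡a  = inj₂ z≡a
  ... | inj₂ refl | inj₁ refl | inj₂ z≡b  = inj₁ z≡b

  InjectiveBelow : ℕ → Set
  InjectiveBelow m = ∀ a b → a < m → b < m → v a ≡ v b → a ≡ b

  Return : ℕ → Set
  Return m = InjectiveBelow m × ∃ λ i → i < m × v i ≡ v m

  search : ∀ m → InjectiveBelow m ⊎ ∃ Return
  search zero    = inj₁ λ _ _ ()
  search (suc m) = Sum.[ extend , inj₂ ]′ (search m)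
    where
    extend : InjectiveBelow m → InjectiveBelow (suc m) ⊎ ∃ Return
    extend inj with any? {n = m} (λ i → v (toℕ i) ≟ᶠ v m)
    ... | yes (i , eq) = inj₂ (m , inj , toℕ i , toℕ<n i , eq)
    ... | no new       = inj₁ inj′
      where
      new′ : ∀ a → a < m → v a ≢ v m
      new′ a a<m eq = new (fromℕ< a<m , trans (cong v (toℕ-fromℕ< a<m)) eq)
      inj′ : InjectiveBelow (suc m)
      inj′ a b a≤m b≤m eq with m≤n⇒m<n∨m≡n (≤-pred a≤m) | m≤n⇒m<n∨m≡n (≤-pred b≤m)
      ... | inj₁ a<m  | inj₁ b<m  = inj a b a<m b<m eq
      ... | inj₁ a<m  | inj₂ refl = ⊥-elim (new′ a a<m eq)
      ... | inj₂ refl | inj₁ b<m  = ⊥-elim (new′ b b<m (sym eq))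
      ... | inj₂ refl | inj₂ refl = refl

  returns : ∃ Return
  returns = Sum.[ (λ inj → ⊥-elim (clash inj)) , (λ r → r) ]′ (search (suc n))
    where
    clash : InjectiveBelow (suc n) → ⊥
    clash inj with pigeonhole (n<1+n n) (v ∘ toℕ {suc n})
    ... | i , j , i<j , eq = <-irrefl (inj (toℕ i) (toℕ j) (toℕ<n i) (toℕ<n j) eq) i<j

  -- A first return to v (suc i) would give it the third neighbour v j.
  return-to-start : ∀ j → InjectiveBelow j → ∀ i → i < j → v i ≡ v j → i ≡ 0
  return-to-start j       inj zero    _         eq = refl
  return-to-start (suc j) inj (suc i) (s≤s i<j) eq = ⊥-elim (neighbours
      (at-most-two (two (dart (suc i))) (v-adjacent i) (trans (symmetric (v (suc i)) (v (suc (suc i)))) (v-adjacent (suc i))) (no-backtracking i ∘ sym)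
        (trans (cong (λ z → X z (v j)) eq) (v-adjacent j))))
    where
    neighbours : v j ≡ v i ⊎ v j ≡ v (suc (suc i)) → ⊥
    neighbours (inj₁ vj≡vi) = <-irrefl (inj i j (m<n⇒m<1+n i<j) (n<1+n j) (sym vj≡vi)) i<j
    neighbours (inj₂ vj≡)   = Sum.[ (λ i+2≤j → no-backtracking (suc i) (trans (cong (v ∘ suc) (inj (suc (suc i)) j (s≤s i+2≤j) (n<1+n j) (sym vj≡))) (sym eq)))
                                  , (λ { refl → v-proper j (sym eq) }) ]′ (m≤n⇒m<n∨m≡n i<j)

  private
    k+1 = proj₁ returns
    inj : InjectiveBelow k+1
    inj = proj₁ (proj₂ returns)
    returned : v 0 ≡ v k+1
    returned = at (proj₂ (proj₂ returns))
      where
      at : (∃ λ i → i < k+1 × v i ≡ v k+1) → v 0 ≡ v k+1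
      at (i , i<j , eq) = subst (λ i → v i ≡ v k+1) (return-to-start k+1 inj i i<j eq) eq
    positive : 0 < k+1
    positive = ≤-trans (s≤s z≤n) (proj₁ (proj₂ (proj₂ (proj₂ returns))))

  cycle : ∀ j → 0 < j → InjectiveBelow j → v 0 ≡ v j → 3 ≤ j × Residual (C j) X
  -- A return after one step would be a loop, after two steps a reversal.
  cycle 1 _ inj eq = ⊥-elim (v-proper 0 (sym eq))
  cycle 2 _ inj eq = ⊥-elim (no-backtracking 0 (sym eq))
  cycle (suc (suc (suc l))) _ inj eq = 3≤x , split-component X good (C x) e e-inj induced closed
    where
    open Mod (suc (suc l))
    3≤x : 3 ≤ x
    3≤x = s≤s (s≤s (s≤s z≤n))
    e : Fin x → Fin n
    e a = v (toℕ a)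
    e-inj : ∀ a b → e a ≡ e b → a ≡ b
    e-inj a b eq = toℕ-injective (inj (toℕ a) (toℕ b) (toℕ<n a) (toℕ<n b) eq)
    e-nxt : ∀ a → e (nxt a) ≡ v (suc (toℕ a))
    e-nxt a = trans (cong v (toℕ-rep (suc (toℕ a)))) (wrap (m≤n⇒m<n∨m≡n (toℕ<n a)))
      where
      wrap : suc (toℕ a) < x ⊎ suc (toℕ a) ≡ x → v (suc (toℕ a) % x) ≡ v (suc (toℕ a))
      wrap (inj₁ a+1<x) = cong v (m<n⇒m%n≡m a+1<x)
      wrap (inj₂ a+1≡x) = trans (cong (λ z → v (z % x)) a+1≡x) (trans (cong v (n%n≡0 x)) (trans eq (cong v (sym a+1≡x))))
    to-nxt : ∀ a → X (e a) (e (nxt a)) ≡ true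
    to-nxt a = trans (symmetric (e a) (e (nxt a))) (trans (cong (λ z → X z (e a)) (e-nxt a)) (v-adjacent (toℕ a)))
    to-prv : ∀ a → X (e a) (e (prv a)) ≡ true
    to-prv a = trans (symmetric (e a) (e (prv a))) (trans (cong (λ z → X (e (prv a)) (e z)) (sym (nxt-prv a))) (to-nxt (prv a)))
    nxt≢prv : ∀ a → nxt a ≢ prv a
    nxt≢prv a eq = no-2-cycle 3≤x a (trans (cong nxt eq) (nxt-prv a))
    closed-two : ∀ a c → X (e a) c ≡ true → c ≡ e (nxt a) ⊎ c ≡ e (prv a)
    closed-two a c = at-most-two (two (dart (toℕ a))) (to-nxt a) (to-prv a) (nxt≢prv a ∘ e-inj (nxt a) (prv a))
    closed : ∀ a c → X (e a) c ≡ true → ∃ λ b → c ≡ e b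
    closed a c ac = Sum.[ nxt a ,_ , prv a ,_ ]′ (closed-two a c ac)
    bit-true : ∀ b → 1 ≤ bit b → b ≡ true
    bit-true true _ = refl
    bit-false : ∀ b → bit b ≡ 0 → b ≡ false
    bit-false false _ = refl
    induced : ∀ a b → X (e a) (e b) ≡ C x a b
    induced a b with nxt a ≟ᶠ b | prv a ≟ᶠ b
    ... | yes refl | _ = trans (to-nxt a) (sym (bit-true (C x a b) (≤-trans (≤-reflexive (sym (𝟙-diag b))) (≤-trans (m≤m+n _ _) (≤-reflexive (sym (bit-C 3≤x a b)))))))
    ... | no _ | yes refl = trans (to-prv a) (sym (bit-true (C x a b) (≤-trans (≤-reflexive (sym (𝟙-diag b))) (≤-trans (m≤n+m _ _) (≤-reflexive (sym (bit-C 3≤x a b)))))))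
    ... | no nxt≢ | no prv≢ = trans not-adjacent (sym (bit-false (C x a b) (trans (bit-C 3≤x a b) (cong₂ _+_ (𝟙-off nxt≢) (𝟙-off prv≢)))))
      where
      not-adjacent : X (e a) (e b) ≡ false
      not-adjacent with X (e a) (e b) in Xab
      ... | false = refl
      ... | true  = ⊥-elim (Sum.[ (λ eq → nxt≢ (sym (e-inj b (nxt a) eq))) , (λ eq → prv≢ (sym (e-inj b (prv a) eq))) ]′ (closed-two a (e b) Xab))

  split-cycle : ∃ λ j → 3 ≤ j × Residual (C j) X
  split-cycle = k+1 , cycle k+1 positive inj returned

-- The residual graph has fewer vertices, but its order `r` is known only through a permutation, so
-- the recursion runs on a bound.
decompose : ∀ fuel {n} → n ≤ fuel → (X : Graph n) → PairsAndCycles X → ∃ λ xs → Allˡ (2 ≤_) xs × X ≃ union xs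
decompose fuel       {zero}  _         X good = [] , [] , ≃-pointwise λ ()
decompose (suc fuel) {suc n} (s≤s n≤f) X good = finish (first (PairsAndCycles.kind good zero))
  where
  first : Paired X zero ⊎ TwoNeighbours X zero → ∃ λ x → 2 ≤ x × Residual (C x) X
  first (inj₁ paired) = 2 , ≤-refl , split-pair X good zero paired
  first (inj₂ two)    = let (x , 3≤x , residual) = Follow.split-cycle X good zero two in x , <⇒≤ 3≤x , residual
  finish : (∃ λ x → 2 ≤ x × Residual (C x) X) → ∃ λ xs → Allˡ (2 ≤_) xs × X ≃ union xs
  finish (x , 2≤x , r , π , X′ , good′ , X≃) =
    let (xs , 2≤xs , X′≃) = decompose fuel r≤fuel X′ good′ in x ∷ xs , 2≤x ∷ 2≤xs , ≃-trans X≃ (⊕-cong (≃-refl (C x)) X′≃)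
    where
    x+r≡ : x + r ≡ suc n
    x+r≡ = ↔⇒≡ π
    r≤fuel : r ≤ fuel
    r≤fuel = ≤-trans (≤-pred (≤-trans (+-monoˡ-≤ r (≤-trans (s≤s z≤n) 2≤x)) (≤-reflexive x+r≡))) n≤f

-- Assembling the isomorphism

union-simple : ∀ {xs} → Allˡ (2 ≤_) xs → IsSimple (union xs)
union-simple []           = (λ ()) , λ ()
union-simple (_∷_ {x} {xs} 2≤x 2≤xs) = ⊕-simple (C x) (union xs) (C-simple 2≤x) (union-simple 2≤xs)

union-degrees : ∀ {xs} → Allˡ (2 ≤_) xs → Degrees₁₂ (union xs)
union-degrees []           = λ ()
union-degrees (_∷_ {x} {xs} 2≤x 2≤xs) = ⊕-degrees (C x) (union xs) (C-degrees 2≤x) (union-degrees 2≤xs)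

union-matched : ∀ {xs} → Allˡ (2 ≤_) xs → Matched (union xs)
union-matched []           = λ ()
union-matched (_∷_ {x} {xs} 2≤x 2≤xs) = ⊕-matched (C x) (union xs) (C-matched 2≤x) (union-matched 2≤xs)

argmax : ∀ {n} (f : Fin (suc n) → ℕ) → ∃ λ m → ∀ i → f i ≤ f m
argmax {zero}  f = zero , λ { zero → ≤-refl }
argmax {suc n} f = pick (argmax (f ∘ suc))
  where
  pick : (∃ λ m → ∀ i → f (suc i) ≤ f (suc m)) → ∃ λ m → ∀ i → f i ≤ f m
  pick (m , max) with ≤-total (f zero) (f (suc m))
  ... | inj₁ f₀≤ = suc m , λ { zero → f₀≤ ; (suc i) → max i }
  ... | inj₂ ≤f₀ = zero , λ { zero → ≤-refl ; (suc i) → ≤-trans (max i) ≤f₀ }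

relabel : ∀ {n} → Permutation′ n → Graph n → Graph n
relabel π H i j = H (π ⟨$⟩ʳ i) (π ⟨$⟩ʳ j)

base-simple : ∀ {n} {H : Graph (suc n)} → IsSimple H → IsSimple (base H)
base-simple (H-sym , H-irr) = (λ i j → H-sym (suc i) (suc j)) , (H-irr ∘ suc)

cone-determined : ∀ {n} (H : Graph (suc n)) → IsSimple H → ∀ {ys} → Allˡ (2 ≤_) ys → total ys ≡ n → 51 ≤ n →
  (∀ k → trace (mpow (signless H) k) ≡ trace (mpow (signless (cone (union ys))) k)) → H ≃ cone (union ys)
cone-determined {n} H H-simple {ys} 2≤ys refl 51≤n tr≡ = ≃-trans (≃-sym H′≃H) (≃-trans (≃-pointwise H′≗cone) (cone-cong X≃Y))
  where
  Y = union ys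
  Y-simple = union-simple 2≤ys
  Y-degrees = union-degrees 2≤ys
  Y-matched = union-matched 2≤ys
  v = proj₁ (argmax (deg H))
  π : Permutation′ (suc n)
  -- Brings a vertex of maximal degree to `zero`, where `Structure` shows it to be the apex.
  π = transpose zero v
  H′ : Graph (suc n)
  H′ = relabel π H
  H′≃H : H′ ≃ H
  H′≃H = iso π λ _ _ → refl
  H′-simple : IsSimple H′
  H′-simple = (λ i j → proj₁ H-simple (π ⟨$⟩ʳ i) (π ⟨$⟩ʳ j)) , (λ i → proj₂ H-simple (π ⟨$⟩ʳ i))
  zero-max : ∀ i → deg H′ (suc i) ≤ deg H′ zero
  zero-max i = ≤-trans (≤-reflexive (deg-≃ H′≃H (suc i))) (≤-trans (proj₂ (argmax (deg H)) (π ⟨$⟩ʳ suc i)) (≤-reflexive (sym (deg-≃ H′≃H zero))))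
  tr′ : ∀ k → trace (mpow (signless H′) k) ≡ trace (mpow (signless (cone Y)) k)
  tr′ k = trans (trace-signless-≃ H′≃H k) (tr≡ k)
  module S = Structure H′ H′-simple Y Y-simple Y-degrees 51≤n zero-max tr′
  X : Graph n
  X = base H′
  H′≗cone : ∀ i j → H′ i j ≡ cone X i j
  H′≗cone = S.H≗cone
  X-simple : IsSimple X
  X-simple = base-simple H′-simple
  trace-cone : ∀ (Z : Graph n) k → trace (mpow (signless (cone Z)) k) ≡ trace (mpow (bordered (coned Z)) k)
  trace-cone Z k = sum-cong-≗ λ i → mpow-cong (signless-cone Z) k i i
  bordered≡ : ∀ k → trace (mpow (bordered (coned X)) k) ≡ trace (mpow (bordered (coned Y)) k)
  bordered≡ k = trans (sym (trace-cone X k)) (trans (sym (trace-signless-≃ (≃-pointwise H′≗cone) k)) (trans (tr′ k) (trace-cone Y k)))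
  X-matched : Matched X
  X-matched = Compare.traces⇒matched X Y X-simple Y-simple S.base-degrees Y-degrees Y-matched S.base-ends 51≤n (bordered≡ 10)
  decomposition = decompose n ≤-refl X (pairsAndCycles X-simple S.base-degrees X-matched)
  xs = proj₁ decomposition
  X≃xs : X ≃ union xs
  X≃xs = proj₂ (proj₂ decomposition)
  traceSums : ∀ k → traceSum k xs ≡ traceSum k ys
  traceSums k = trans (sym (trace-coned-union xs k)) (trans (sym (trace-coned-≃ X≃xs k))
    (trans (coned-traces X Y X-simple Y-simple S.base-degrees Y-degrees X-matched Y-matched S.base-ends bordered≡ k) (trace-coned-union ys k)))
  X≃Y : X ≃ Y
  X≃Y = ≃-trans X≃xs (union-↭ (traces⇒↭ _ refl (proj₁ (proj₂ decomposition)) 2≤ys traceSums))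

components-≥2 : ∀ {t} {s : Vec ℕ t} → All (3 ≤_) s → ∀ q → Allˡ (2 ≤_) (components s q)
components-≥2 s≥3 q = ++⁺ (cyc s≥3) (replicate⁺ q ≤-refl)
  where
  cyc : ∀ {t} {s : Vec ℕ t} → All (3 ≤_) s → Allˡ (2 ≤_) (toList s)
  cyc []         = []
  cyc (p ∷ ps) = <⇒≤ p ∷ cyc ps

theorem1p2 : (t : ℕ) → 2 ≤ t → (q : ℕ) → (s : Vec ℕ t) → All (3 ≤_) s →
    52 ≤ 1 + (sumV s + q * 2) →
    (H : Graph (1 + (sumV s + q * 2))) → IsSimple H →
    QCospectral H (theGraph s q) → H ≅ theGraph s q
theorem1p2 t 2≤t q s s≥3 52≤ H H-simple H~G = _≃_.bijection H≃G , _≃_.adjacency H≃G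
  where
  G≃cone = theGraph≃cone s q
  H≃G : H ≃ theGraph s q
  -- The equality of orders that `cone-determined` asks for is read off the bijection between
  -- `theGraph s q` and the cone.
  H≃G = ≃-trans (cone-determined H H-simple (components-≥2 s≥3 q) (suc-injective (sym (↔⇒≡ (_≃_.bijection G≃cone)))) (≤-pred 52≤)
    (λ k → trans (cospectral⇒traces H (theGraph s q) H~G k) (trace-signless-≃ G≃cone k))) (≃-sym G≃cone)
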